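{- Let $t\ge1$ be an integer and $g=2t-1$. Let $\lambda\in\mathcal{DD}_{g}^{'1}$, let $\mathbf{v}\in\mathbb{Z}^t$ be its $V_{g,t}$-coding, and set $r_i=v_i-g/2+1$ for $1\le i\le t$. Then $$|\lambda| = \frac{1}{g}\sum_{i=1}^{t} r_i^2-\frac{(g+2)(\lfloor g/2\rfloor +1)}{12}.$$ Moreover, setting $\alpha_i(\lambda)=\#\{s\in\lambda\mid h_s=g-i,\ \varepsilon_s=1\}$, for any field $F$ and any function $\tau:\mathbb{Z}\to F^{\times}$, $$\prod_{s\in\lambda}\frac{\tau(h_s-\varepsilon_s g)}{\tau(h_s)}=\prod_{i=1}^{g-1}\left(\frac{\tau(-i)}{\tau(i)}\right)^{\alpha_i(\lambda)}\prod_{1\le i<j\le t} \frac{\tau(r_i-r_j)}{\tau(j-i)}\, \frac{\tau(r_i+r_j)}{\tau(g+2-i-j)}.$$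
   Context: For a partition $\lambda$, $h_s$ is the hook length of a box $s$, $d_\lambda=\max\{s:\lambda_s\ge s\}$, and $\varepsilon_s=-1$ if $s$ is strictly below the main diagonal of the Ferrers diagram (English convention), $\varepsilon_s=1$ otherwise. $\mathcal{DD}$ is the set of partitions with $\lambda_i=\lambda'_i+1$ for $1\le i\le d_\lambda$ ($\lambda'$ the conjugate; the empty partition included), and $\mathcal{DD}'=\{\lambda'\mid\lambda\in\mathcal{DD}\}$. Word of a partition: $\psi(\lambda)=(c_k)_{k\in\mathbb{Z}}\in\{0,1\}^{\mathbb{Z}}$ encodes the border of the Ferrers diagram read from South-West to North-East ($0$ vertical step, $1$ horizontal step), indexed so that $\#\{k\le -1: c_k=1\}=\#\{k\ge 0: c_k=0\}$; equivalently $c_k=0$ iff $k=\lambda_i-i$ for some $i\ge1$ (with $\lambda_i=0$ beyond the length). The $g$-quotient of $\lambda$ is $(\nu^{(0)},\dots,\nu^{(g-1)})$, where $\nu^{(k)}$ is the partition whose word is, up to a shift of indices, the subword $(c_{gi+k})_{i\in\mathbb{Z}}$. $\mathcal{DD}_{2t-1}^{'1}$ is the set of $\lambda\in\mathcal{DD}'$ whose $(2t-1)$-quotient satisfies $\nu^{(k)}=\emptyset$ for all $k\ne 2t-2$ and $\nu^{(2t-2)}$ is, for some integer $m_1\ge 1$, the rectangular partition with $m_1$ parts all equal to $m_1-1$ (empty if $m_1=1$). $V_{g,t}$-coding: for $i\in\{0,\dots,g-1\}$ let $\beta_i=\max\{(k+1)g+i\mid k\in\mathbb{Z},\ c_{kg+i}=0\}$;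 the $V_{g,t}$-coding is $\mathbf{v}=(v_1>\dots>v_t)$, the $t$ largest of the distinct integers $\beta_0,\dots,\beta_{g-1}$ in decreasing order. (Here the $r_i$ are half-integers, and $r_i\pm r_j$ are integers.) -}

module Defs where

open import Algebra.Apartness.Bundles using (HeytingCommutativeRing; HeytingField)
open import Algebra.Bundles using (CommutativeRing; Semiring)
import Algebra.Definitions.RawSemiring as RawSemiringDefs
import Algebra.Apartness.Properties.HeytingCommutativeRing as HCRProperties
open import Data.Bool.Base using (if_then_else_)
open import Data.Fin.Base as Fin using (Fin; toℕ)
open import Data.Fin.Patterns using (0F; 1F)
open import Data.Fin.Properties using () renaming (_<?_ to _<ᶠ?_)
open import Data.Integer.Base as ℤ using (ℤ; +_; 0ℤ; 1ℤ; -1ℤ; ∣_∣)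
import Data.Integer.Properties as ℤ
open import Data.Integer.Tactic.RingSolver using (solve-∀)
open import Data.List.Base
  using (List; []; _∷_; length; map; foldr; filter; upTo; applyUpTo; replicate; concatMap; allFin; cartesianProduct)
open import Data.List.Properties using (filter-accept; filter-reject)
open import Data.List.Relation.Unary.All using (All; []; _∷_)
import Data.List.Relation.Unary.All.Properties as All
open import Data.List.Relation.Unary.Linked using (Linked; []; [-]; _∷_)
import Data.List.Relation.Unary.Linked.Properties as Linked
open import Data.Nat.Base using (ℕ; zero; suc; _+_; _*_; _∸_; _⊔_; _≤_; _<_; _>_; _≥_; z≤n; s≤s; z<s; NonZero)
open import Data.Nat.ListAction using (sum)
open import Data.Nat.Properties
  using (_<?_; _≤?_; anyUpTo?; ≤-refl; ≤-trans; m≤m+n; m≤n+m; +-monoˡ-≤; +-suc; m≤n⇒m≤1+n; <-trans; n<1+n)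
open import Data.Product.Base using (Σ; ∃; ∃-syntax; _×_; _,_; proj₁; proj₂)
open import Data.Rational.Base as ℚ using (ℚ; 1ℚ; toℚᵘ)
import Data.Rational.Properties as ℚ
open import Data.Rational.Solver using (module +-*-Solver)
open import Data.Rational.Unnormalised.Base as ℚᵘ using (ℚᵘ; mkℚᵘ; *≡*)
import Data.Rational.Unnormalised.Properties as ℚᵘ
open import Data.Sum.Base using (_⊎_)
open import Data.Vec.Functional using (Vector)
open import Level using () renaming (_⊔_ to _⊔ˡ_)
open import Relation.Binary.PropositionalEquality using (_≡_; _≢_; refl; sym; trans; cong; cong₂; subst)
open import Relation.Nullary.Decidable using (Dec; yes; no; does; map′; _×-dec_)

open +-*-Solver using (solve; _:=_; _:+_; _:-_; con)

record Partition : Set where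
  constructor mkPartition
  field
    parts      : List ℕ
    decreasing : Linked _≥_ parts
    positive   : All (_> 0) parts

open Partition public

lookup₀ : List ℕ → ℕ → ℕ
lookup₀ []       _       = 0
lookup₀ (x ∷ xs) zero    = x
lookup₀ (x ∷ xs) (suc i) = lookup₀ xs i

lookup₀≤sum : ∀ xs i → lookup₀ xs i ≤ sum xs
lookup₀≤sum []       i       = z≤n
lookup₀≤sum (x ∷ xs) zero    = m≤m+n x (sum xs)
lookup₀≤sum (x ∷ xs) (suc i) = ≤-trans (lookup₀≤sum xs i) (m≤n+m (sum xs) x)

-- Rows, columns and boxes are numbered from 0, so  part ƛ i  is λᵢ₊₁.
part : Partition → ℕ → ℕ
part ƛ = lookup₀ (parts ƛ)

size : Partition → ℕ
size ƛ = sum (parts ƛ)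

∅ : Partition
∅ = mkPartition [] [] []

replicate-linked : ∀ a b → Linked _≥_ (replicate a b)
replicate-linked zero          b = []
replicate-linked (suc zero)    b = [-]
replicate-linked (suc (suc a)) b = ≤-refl ∷ replicate-linked (suc a) b

-- a rows of length b.
rectangle : ℕ → ℕ → Partition
rectangle a zero    = ∅
rectangle a (suc b) =
  mkPartition (replicate a (suc b)) (replicate-linked a (suc b)) (All.replicate⁺ a z<s)

column : List ℕ → ℕ → ℕ
column xs j = length (filter (j <?_) xs)

column-decreasing : ∀ xs j → column xs j ≥ column xs (suc j)
column-decreasing []       j = z≤n
column-decreasing (x ∷ xs) j with suc j <? x | j <? x
... | yes 1+j<x | yes j<x
  rewrite filter-accept (suc j <?_) {xs = xs} 1+j<x | filter-accept (j <?_) {xs = xs} j<x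
  = s≤s (column-decreasing xs j)
... | yes 1+j<x | no j≮x with () ← j≮x (<-trans (n<1+n j) 1+j<x)
... | no 1+j≮x | yes j<x
  rewrite filter-reject (suc j <?_) {xs = xs} 1+j≮x | filter-accept (j <?_) {xs = xs} j<x
  = m≤n⇒m≤1+n (column-decreasing xs j)
... | no 1+j≮x | no j≮x
  rewrite filter-reject (suc j <?_) {xs = xs} 1+j≮x | filter-reject (j <?_) {xs = xs} j≮x
  = column-decreasing xs j

column-positive : ∀ xs {j} → j < lookup₀ xs 0 → column xs j > 0
column-positive (x ∷ xs) {j} j<x rewrite filter-accept (j <?_) {xs = xs} j<x = z<s

conjugate : Partition → Partition
conjugate ƛ = mkPartition
  (applyUpTo (column (parts ƛ)) (part ƛ 0))
  (Linked.applyUpTo⁺₂ _ _ (column-decreasing (parts ƛ)))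
  (All.applyUpTo⁺₁ _ _ (column-positive (parts ƛ)))

Box : Set
Box = ℕ × ℕ

boxes : Partition → List Box
boxes ƛ = concatMap (λ i → map (i ,_) (upTo (part ƛ i))) (upTo (length (parts ƛ)))

-- Arm plus leg plus 1.
hook : Partition → Box → ℕ
hook ƛ (i , j) = (part ƛ i ∸ suc j) + (part (conjugate ƛ) j ∸ suc i) + 1

-- Strictly below the main diagonal means row number > column number.
ε : Box → ℤ
ε (i , j) = if does (j <? i) then -1ℤ else 1ℤ

-- d_λ = max { s ≥ 1 : λ_s ≥ s }, and 0 for the empty partition.
durfee : Partition → ℕ
durfee ƛ = foldr _⊔_ 0 (filter (λ s → s ≤? part ƛ (s ∸ 1)) (applyUpTo suc (length (parts ƛ))))

DD : Partition → Set
DD ƛ = ∀ i → i < durfee ƛ → part ƛ i ≡ part (conjugate ƛ) i + 1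

DD′ : Partition → Set
DD′ ƛ = ∃[ μ ] DD μ × ƛ ≡ conjugate μ

-- Step k of the border is vertical iff k = λᵢ - i for some i ≥ 1 (i is  suc i  here).
Vertical : Partition → ℤ → Set
Vertical ƛ k = ∃[ i ] k ≡ + part ƛ i ℤ.- + suc i

vertical-bound : ∀ ƛ k i → k ≡ + part ƛ i ℤ.- + suc i → i < size ƛ + ∣ k ∣
vertical-bound ƛ k i k≡ = ≤-trans
  (subst (_≤ part ƛ i + ∣ k ∣) (cong ∣_∣ eq) (ℤ.∣i-j∣≤∣i∣+∣j∣ (+ part ƛ i) k))
  (+-monoˡ-≤ ∣ k ∣ (lookup₀≤sum (parts ƛ) i))
  where
  ring : ∀ a b → a ℤ.- (a ℤ.- b) ≡ b
  ring = solve-∀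
  eq : + part ƛ i ℤ.- k ≡ + suc i
  eq = trans (cong (λ z → + part ƛ i ℤ.- z) k≡) (ring (+ part ƛ i) (+ suc i))

vertical? : ∀ ƛ k → Dec (Vertical ƛ k)
vertical? ƛ k = map′
  (λ (i , _ , k≡) → i , k≡)
  (λ (i , k≡) → i , vertical-bound ƛ k i k≡ , k≡)
  (anyUpTo? (λ i → k ℤ.≟ + part ƛ i ℤ.- + suc i) (size ƛ + ∣ k ∣))

word : Partition → ℤ → Fin 2
word ƛ k = if does (vertical? ƛ k) then 0F else 1F

-- ν k is determined by its word up to a shift s of the indices, so ν is unique.
IsQuotient : (g : ℕ) → Partition → Vector Partition g → Set
IsQuotient g ƛ ν =
  ∀ k → ∃[ s ] (∀ i → word (ν k) i ≡ word ƛ (+ g ℤ.* (i ℤ.+ s) ℤ.+ + toℕ k))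

-- The rectangle has m rows of length m - 1; it is ∅ for m = 1.
DD′¹ : ℕ → Partition → Set
DD′¹ t ƛ = DD′ ƛ ×
  ∃[ ν ] IsQuotient (2 * t ∸ 1) ƛ ν
       × (∀ k → toℕ k ≢ 2 * t ∸ 2 → ν k ≡ ∅)
       × ∃[ m ] m ≥ 1 × (∀ k → toℕ k ≡ 2 * t ∸ 2 → ν k ≡ rectangle m (m ∸ 1))

IsMaximum : (ℤ → Set) → ℤ → Set
IsMaximum P m = P m × (∀ x → P x → x ℤ.≤ m)

record IsVCoding (g t : ℕ) (ƛ : Partition) (v : Vector ℤ t) : Set where
  field
    -- β i = max { (k + 1) g + i : c_{kg+i} = 0 }, where c = word ƛ
    β          : Vector ℤ g
    β-maximum  : ∀ i → IsMaximum
      (λ x → ∃[ k ] x ≡ (k ℤ.+ 1ℤ) ℤ.* + g ℤ.+ + toℕ i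
                  × word ƛ (k ℤ.* + g ℤ.+ + toℕ i) ≡ 0F)
      (β i)
    -- v lists the t largest of the β i in decreasing order
    decreasing : ∀ {i j} → i Fin.< j → v i ℤ.> v j
    chosen     : ∀ i → ∃[ k ] v i ≡ β k
    largest    : ∀ k → (∃[ i ] v i ≡ β k) ⊎ (∀ i → β k ℤ.< v i)

α : ℕ → Partition → ℕ → ℕ
α g ƛ i = length (filter (λ s → (+ hook ƛ s ℤ.≟ + g ℤ.- + i) ×-dec (ε s ℤ.≟ 1ℤ)) (boxes ƛ))

-- rᵢ = r g vᵢ is a half-integer when g is odd; the sums and differences of these
-- numbers are integers, and  toInteger  reads them as such.
r : ℕ → ℤ → ℚ
r g x = x ℚ./ 1 ℚ.- + g ℚ./ 2 ℚ.+ 1ℚ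

IsInteger : ℚ → Set
IsInteger q = ∃[ z ] z ℚ./ 1 ≡ q

toInteger : (q : ℚ) → IsInteger q → ℤ
toInteger q = proj₁

private
  toℚᵘ-/ : ∀ x n → toℚᵘ (x ℚ./ suc n) ℚᵘ.≃ x ℚᵘ./ suc n
  toℚᵘ-/ x n = ℚ.toℚᵘ-fromℚᵘ (mkℚᵘ x n)

  toℚᵘ-/+/ : ∀ x m y n →
    toℚᵘ (x ℚ./ suc m ℚ.+ y ℚ./ suc n) ℚᵘ.≃ x ℚᵘ./ suc m ℚᵘ.+ y ℚᵘ./ suc n
  toℚᵘ-/+/ x m y n = ℚᵘ.≃-trans (ℚ.toℚᵘ-homo-+ (x ℚ./ suc m) (y ℚ./ suc n))
    (ℚᵘ.+-cong (toℚᵘ-/ x m) (toℚᵘ-/ y n))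

/1-homo-+ : ∀ x y → (x ℤ.+ y) ℚ./ 1 ≡ x ℚ./ 1 ℚ.+ y ℚ./ 1
/1-homo-+ x y = ℚ.toℚᵘ-injective (ℚᵘ.≃-trans (toℚᵘ-/ (x ℤ.+ y) 0)
  (ℚᵘ.≃-trans (*≡* (ring x y)) (ℚᵘ.≃-sym (toℚᵘ-/+/ x 0 y 0))))
  where
  ring : ∀ x y → (x ℤ.+ y) ℤ.* 1ℤ ≡ (x ℤ.* 1ℤ ℤ.+ y ℤ.* 1ℤ) ℤ.* 1ℤ
  ring = solve-∀

/1-homo-minus : ∀ x y → (x ℤ.- y) ℚ./ 1 ≡ x ℚ./ 1 ℚ.- y ℚ./ 1
/1-homo-minus x y = trans (rearrange (x-y ℚ./ 1) (y ℚ./ 1))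
  (cong (ℚ._- y ℚ./ 1) (trans (sym (/1-homo-+ x-y y)) (cong (ℚ._/ 1) (ring x y))))
  where
  x-y = x ℤ.- y
  ring : ∀ x y → x ℤ.- y ℤ.+ y ≡ x
  ring = solve-∀
  rearrange : ∀ p q → p ≡ (p ℚ.+ q) ℚ.- q
  rearrange = solve 2 (λ p q → p := (p :+ q) :- q) refl

/2+/2 : ∀ x → x ℚ./ 2 ℚ.+ x ℚ./ 2 ≡ x ℚ./ 1
/2+/2 x = ℚ.toℚᵘ-injective (ℚᵘ.≃-trans (toℚᵘ-/+/ x 1 x 1)
  (ℚᵘ.≃-trans (*≡* (ring x)) (ℚᵘ.≃-sym (toℚᵘ-/ x 0))))
  where
  ring : ∀ x → (x ℤ.* + 2 ℤ.+ x ℤ.* + 2) ℤ.* 1ℤ ≡ x ℤ.* + 4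
  ring = solve-∀

r-difference : ∀ g x y → IsInteger (r g x ℚ.- r g y)
r-difference g x y = x ℤ.- y ,
  trans (/1-homo-minus x y) (rearrange (x ℚ./ 1) (y ℚ./ 1) (+ g ℚ./ 2))
  where
  rearrange : ∀ p q h → p ℚ.- q ≡ (p ℚ.- h ℚ.+ 1ℚ) ℚ.- (q ℚ.- h ℚ.+ 1ℚ)
  rearrange = solve 3
    (λ p q h → p :- q := (p :- h :+ con 1ℚ) :- (q :- h :+ con 1ℚ)) refl

r-sum : ∀ g x y → IsInteger (r g x ℚ.+ r g y)
r-sum g x y = x ℤ.+ y ℤ.- + g ℤ.+ + 2 ,
  trans (/1-homo-+ (x ℤ.+ y ℤ.- + g) (+ 2))
  (trans (cong (ℚ._+ + 2 ℚ./ 1)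
    (trans (/1-homo-minus (x ℤ.+ y) (+ g)) (cong₂ ℚ._-_ (/1-homo-+ x y) (sym (/2+/2 (+ g))))))
  (rearrange (x ℚ./ 1) (y ℚ./ 1) (+ g ℚ./ 2)))
  where
  rearrange : ∀ p q h →
    p ℚ.+ q ℚ.- (h ℚ.+ h) ℚ.+ + 2 ℚ./ 1 ≡ (p ℚ.- h ℚ.+ 1ℚ) ℚ.+ (q ℚ.- h ℚ.+ 1ℚ)
  rearrange = solve 3
    (λ p q h → p :+ q :- (h :+ h) :+ con (+ 2 ℚ./ 1)
             := (p :- h :+ con 1ℚ) :+ (q :- h :+ con 1ℚ)) refl

open RawSemiringDefs (Semiring.rawSemiring (CommutativeRing.semiring ℚ.+-*-commutativeRing)) public
  using () renaming (sum to ∑ℚ)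

instance
  2t-1-nonZero : ∀ {t} .{{_ : NonZero t}} → NonZero (2 * t ∸ 1)
  2t-1-nonZero {suc n} = subst NonZero (sym (+-suc n (n + 0))) _

-- The pairs i < j.
pairs : (t : ℕ) → List (Fin t × Fin t)
pairs t = filter (λ (i , j) → i <ᶠ? j) (cartesianProduct (allFin t) (allFin t))

-- HeytingField is the library's notion of field; a classical field is one with _#_ = _≉_.
module FieldNotation {c ℓ₁ ℓ₂} (F : HeytingField c ℓ₁ ℓ₂) where
  open HeytingField F public using (Carrier; _≈_) renaming (_*_ to _·_)
  open HeytingField F using (_#_; 0#; 1#; #⇒invertible; heytingCommutativeRing)
  open CommutativeRing (HeytingCommutativeRing.commutativeRing heytingCommutativeRing)
    using (semiring; *-congʳ)
  open Semiring semiring using (rawSemiring)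
  open RawSemiringDefs rawSemiring public using (_^_)

  F× : Set (c ⊔ˡ ℓ₂)
  F× = Σ Carrier (_# 0#)

  infix 8 _⁻¹
  infixl 7 _÷_

  -- The library inverts the difference  proj₁ u - 0#.
  _⁻¹ : F× → Carrier
  (_ , u#0) ⁻¹ = proj₁ (#⇒invertible u#0)

  ⁻¹-inverseʳ : ∀ u → proj₁ u · u ⁻¹ ≈ 1#
  ⁻¹-inverseʳ (u , u#0) = HeytingField.trans F
    (*-congʳ (HeytingField.sym F (x-0≈x u))) (proj₂ (proj₂ (#⇒invertible u#0)))
    where open HCRProperties heytingCommutativeRing using (x-0≈x)

  _÷_ : F× → F× → Carrier
  u ÷ w = proj₁ u · w ⁻¹

  ∏ : ∀ {a} {A : Set a} → List A → (A → Carrier) → Carrier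
  ∏ xs f = foldr (λ x y → f x · y) 1# xs

  infix 1 ∏
  syntax ∏ xs (λ x → e) = ∏[ x ∈ xs ] e

-- Shift the word of λ by 1 and call the positions of the letter 0 beads.  For λ in DD′ the
-- beads are antisymmetric about the bead 0, so the set B of positive beads determines λ, and
-- B lists the nested hooks of the diagram.  The shape of the quotient says that the bead x ≠ 0
-- forces the bead x - g.  The numbers w = r + g/2 = v + 1 are then exactly the t positions in
-- the upper half w > g/2 with w a gap and w - g a bead.
--
-- Let the beads enter in increasing order.  A new largest bead X replaces X or g - X among the
-- w by X + g, that is, |X - g/2| among the r by X + g/2.  So Σ f(r), for f even, grows by
-- f(X + g/2) - f(X - g/2).  For f(r) = r² this gives the size, which is 2 Σ X.
--
-- For the product write the group of units additively and take T(n) = τ(|n|).  The kernel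
-- K(r, r′) = T(r - r′) + T(r + r′) is even in both arguments.  Applying the formula for Σ f(r)
-- to f = K(X + g/2, _) - K(X - g/2, _) shows that the sum of K over pairs grows by exactly the
-- contribution of the hook of X, the first row and column of the diagram.  Replacing τ by T
-- only affects the boxes with ε = 1 and hook length below g, which gives the exponents αᵢ.
module Submission where

open import Defs
open import Algebra.Apartness.Bundles using (HeytingCommutativeRing; HeytingField)
open import Algebra.Bundles using (AbelianGroup; CommutativeMonoid; CommutativeRing)
import Algebra.Properties.AbelianGroup as AbelianGroupProperties
import Algebra.Properties.CommutativeSemigroup as CommutativeSemigroupProperties
import Algebra.Properties.Monoid.Mult as Mult
open import Data.Bool.Base using (Bool; true; false; if_then_else_)
open import Data.Fin.Base as Fin using (Fin; zero; suc; toℕ; fromℕ<)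
open import Data.Fin.Patterns using (0F; 1F)
import Data.Fin.Properties as Fin
open import Data.Integer.Base as ℤ using (ℤ; +_; -[1+_]; -_; 0ℤ; 1ℤ; -1ℤ; ∣_∣)
  renaming (_+_ to _+ᶻ_; _-_ to _-ᶻ_; _*_ to _*ᶻ_)
import Data.Integer.DivMod as ℤ
import Data.Integer.Properties as ℤ
open import Data.Integer.Tactic.RingSolver using (solve-∀)
open import Data.List.Base
  using (List; []; _∷_; _++_; allFin; applyUpTo; cartesianProduct; concatMap; filter; foldr; length;
    map; replicate; tabulate; upTo)
open import Data.List.Membership.Propositional using (_∈_)
open import Data.List.Membership.Propositional.Properties
  using (∈-∃++; ∈-applyUpTo⁺; ∈-filter⁺; ∈-tabulate⁺; ∈-tabulate⁻)
import Data.List.Properties as List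
open import Data.List.Relation.Binary.Permutation.Propositional as ↭ using (_↭_)
open import Data.List.Relation.Binary.Permutation.Propositional.Properties using (shift; ∈-resp-↭; ↭-length)
import Data.List.Relation.Binary.Permutation.Setoid.Properties as Permutation
open import Data.List.Relation.Unary.All as All using (All; []; _∷_)
open import Data.List.Relation.Unary.AllPairs using ([]; _∷_)
open import Data.List.Relation.Unary.Any using (here; there)
open import Data.List.Relation.Unary.Linked as Linked using (Linked; []; [-]; _∷_)
open import Data.List.Relation.Unary.Unique.Propositional using (Unique)
import Data.List.Relation.Unary.Unique.Propositional.Properties as Unique
open import Data.Nat.Base as ℕ
  using (ℕ; zero; suc; pred; _∸_; _⊔_; _≤_; _<_; _≥_; _<ᵇ_; z≤n; s≤s; z<s; NonZero)
import Data.Nat.Divisibility as ℕ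
import Data.Nat.DivMod as ℕ
import Data.Nat.ListAction as ℕ
import Data.Nat.Properties as ℕ
open import Data.Product.Base using (∃-syntax; _×_; _,_; proj₁; proj₂)
open import Data.Rational.Base as ℚ using (ℚ; 1ℚ; toℚᵘ)
import Data.Rational.Properties as ℚ
open import Data.Rational.Solver using (module +-*-Solver)
open import Data.Rational.Unnormalised.Base as ℚᵘ using (mkℚᵘ; *≡*)
import Data.Rational.Unnormalised.Properties as ℚᵘ
open import Data.Sum.Base using (_⊎_; inj₁; inj₂)
open import Data.Vec.Base as Vec using (Vec; []; _∷_)
open import Data.Vec.Functional using (Vector)
open import Level using () renaming (_⊔_ to _⊔ˡ_)
open import Relation.Binary.Definitions using (tri<; tri≈; tri>)
open import Relation.Binary.PropositionalEquality as ≡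
  using (_≡_; _≢_; refl; sym; trans; cong; cong₂; subst; subst₂; module ≡-Reasoning)
import Relation.Binary.Reasoning.Setoid as SetoidReasoning
import Relation.Binary.Reflection as Reflection
open import Relation.Nullary.Decidable using (Dec; yes; no; does; _×-dec_)
open import Relation.Nullary.Negation using (¬_; contradiction)
open import Relation.Unary using (Decidable)

-- The exception at 0 in the closedness condition is what forces the upper half. Among positive
-- positions the beads of a residue class form an initial segment, so the class has a first gap
-- there; below 0 the multiples of g may be gaps again.
--
-- A new largest bead X also turns the bead -X into a gap. If X > g/2, the position X was itself a
-- first gap and is now filled. If X < g/2, the gap g - X loses the bead -X that lay g below it. In
-- both cases X + g becomes a first gap, and X = g/2 is excluded because g is odd.
--
-- The obstacle in the product is self-interaction. The position replaced by X + g does not pair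
-- with itself, whereas the formula for Σ f(r) runs over all positions. The surplus term does not
-- vanish. It is exactly the discrepancy between the sum over the empty diagram, which contains a
-- term for the hook length 0, and the first row of the hook, which contains the corner 2X instead.
--
-- The empty diagram has r = t - 1/2, ..., 3/2, 1/2. Its squares give the constant in the size
-- formula, and its differences and sums give the denominators of the product.

open AbelianGroupProperties ℤ.+-0-abelianGroup using (∙-cancelˡ; ∙-cancelʳ)

-- Linear identities in an abelian group

module AbelianGroupSolver {c ℓ} (G : AbelianGroup c ℓ) where

  open AbelianGroup G renaming (ε to 0#; refl to ≈-refl; sym to ≈-sym; trans to ≈-trans)
  open AbelianGroupProperties G
  open CommutativeSemigroupProperties commutativeSemigroup using (interchange)
  open Mult monoid using (×-homo-+) renaming (_×_ to _⋆ⁿ_)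
  open SetoidReasoning setoid

  infixl 6 _:+_ _:-_

  data Expr (n : ℕ) : Set where
    var     : Fin n → Expr n
    _:+_ _:-_ : Expr n → Expr n → Expr n
    `0       : Expr n

  ⟦_⟧ : ∀ {n} → Expr n → Vec Carrier n → Carrier
  ⟦ var i ⟧ ρ = Vec.lookup ρ i
  ⟦ d :+ e ⟧ ρ = ⟦ d ⟧ ρ ∙ ⟦ e ⟧ ρ
  ⟦ d :- e ⟧ ρ = ⟦ d ⟧ ρ - ⟦ e ⟧ ρ
  ⟦ `0 ⟧     ρ = 0#

  infixr 8 _⋆_

  _⋆_ : ℤ → Carrier → Carrier
  (+ n)    ⋆ x = n ⋆ⁿ x
  -[1+ n ] ⋆ x = (suc n ⋆ⁿ x) ⁻¹

  ⊖-⋆ : ∀ m n x → (m ℤ.⊖ n) ⋆ x ≈ m ⋆ⁿ x - n ⋆ⁿ x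
  ⊖-⋆ m       zero    x = ≈-sym (≈-trans (∙-congˡ ε⁻¹≈ε) (identityʳ _))
  ⊖-⋆ zero    (suc n) x = ≈-sym (identityˡ _)
  ⊖-⋆ (suc m) (suc n) x rewrite ℤ.[1+m]⊖[1+n]≡m⊖n m n = begin
    (m ℤ.⊖ n) ⋆ x                        ≈⟨ ⊖-⋆ m n x ⟩
    m ⋆ⁿ x - n ⋆ⁿ x                      ≈⟨ identityˡ _ ⟨
    0# ∙ (m ⋆ⁿ x - n ⋆ⁿ x)                ≈⟨ ∙-congʳ (inverseʳ x) ⟨
    (x - x) ∙ (m ⋆ⁿ x - n ⋆ⁿ x)          ≈⟨ interchange _ _ _ _ ⟩
    (x ∙ m ⋆ⁿ x) ∙ (x ⁻¹ ∙ (n ⋆ⁿ x) ⁻¹)  ≈⟨ ∙-congˡ (⁻¹-∙-comm x (n ⋆ⁿ x)) ⟩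
    (suc m ⋆ⁿ x) - (suc n ⋆ⁿ x)          ∎

  +-⋆ : ∀ i j x → (i ℤ.+ j) ⋆ x ≈ i ⋆ x ∙ j ⋆ x
  +-⋆ (+ m)    (+ n)    x = ×-homo-+ x m n
  +-⋆ (+ m)    -[1+ n ] x = ⊖-⋆ m (suc n) x
  +-⋆ -[1+ m ] (+ n)    x = ≈-trans (⊖-⋆ n (suc m) x) (comm _ _)
  +-⋆ -[1+ m ] -[1+ n ] x = begin
    (suc (suc (m ℕ.+ n)) ⋆ⁿ x) ⁻¹    ≡⟨ cong (λ k → (suc k ⋆ⁿ x) ⁻¹) (ℕ.+-suc m n) ⟨
    ((suc m ℕ.+ suc n) ⋆ⁿ x) ⁻¹      ≈⟨ ⁻¹-cong (×-homo-+ x (suc m) (suc n)) ⟩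
    (suc m ⋆ⁿ x ∙ suc n ⋆ⁿ x) ⁻¹      ≈⟨ ⁻¹-∙-comm _ _ ⟨
    (suc m ⋆ⁿ x) ⁻¹ - suc n ⋆ⁿ x      ∎

  neg-⋆ : ∀ i x → (ℤ.- i) ⋆ x ≈ (i ⋆ x) ⁻¹
  neg-⋆ (+ zero)  x = ≈-sym ε⁻¹≈ε
  neg-⋆ (+ suc n) x = ≈-refl
  neg-⋆ -[1+ n ]  x = ≈-sym (⁻¹-involutive _)

  -- By commutativity, the integer coefficients of the variables determine the value of an
  -- expression.
  Normal : ℕ → Set
  Normal = Vec ℤ

  unit : ∀ {n} → Fin n → Normal n
  unit zero    = 1ℤ ∷ Vec.replicate _ 0ℤ
  unit (suc i) = 0ℤ ∷ unit i

  normalise : ∀ {n} → Expr n → Normal n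
  normalise (var i) = unit i
  normalise (d :+ e) = Vec.zipWith ℤ._+_ (normalise d) (normalise e)
  normalise (d :- e) = Vec.zipWith ℤ._+_ (normalise d) (Vec.map ℤ.-_ (normalise e))
  normalise `0       = Vec.replicate _ 0ℤ

  ⟦_⟧⇓ : ∀ {n} → Normal n → Vec Carrier n → Carrier
  ⟦ [] ⟧⇓     []      = 0#
  ⟦ z ∷ zs ⟧⇓ (x ∷ ρ) = z ⋆ x ∙ ⟦ zs ⟧⇓ ρ

  0-correct : ∀ {n} (ρ : Vec Carrier n) → ⟦ Vec.replicate n 0ℤ ⟧⇓ ρ ≈ 0#
  0-correct []      = ≈-refl
  0-correct (x ∷ ρ) = ≈-trans (identityˡ _) (0-correct ρ)

  unit-correct : ∀ {n} (i : Fin n) ρ → ⟦ unit i ⟧⇓ ρ ≈ Vec.lookup ρ i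
  unit-correct zero    (x ∷ ρ) = ≈-trans (∙-cong (identityʳ x) (0-correct ρ)) (identityʳ x)
  unit-correct (suc i) (x ∷ ρ) = ≈-trans (identityˡ _) (unit-correct i ρ)

  +-correct : ∀ {n} (ys zs : Normal n) ρ →
    ⟦ Vec.zipWith ℤ._+_ ys zs ⟧⇓ ρ ≈ ⟦ ys ⟧⇓ ρ ∙ ⟦ zs ⟧⇓ ρ
  +-correct []       []       []      = ≈-sym (identityˡ 0#)
  +-correct (y ∷ ys) (z ∷ zs) (x ∷ ρ) =
    ≈-trans (∙-cong (+-⋆ y z x) (+-correct ys zs ρ)) (interchange _ _ _ _)

  neg-correct : ∀ {n} (zs : Normal n) ρ → ⟦ Vec.map ℤ.-_ zs ⟧⇓ ρ ≈ ⟦ zs ⟧⇓ ρ ⁻¹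
  neg-correct []       []      = ≈-sym ε⁻¹≈ε
  neg-correct (z ∷ zs) (x ∷ ρ) =
    ≈-trans (∙-cong (neg-⋆ z x) (neg-correct zs ρ)) (⁻¹-∙-comm _ _)

  correct : ∀ {n} (e : Expr n) ρ → ⟦ normalise e ⟧⇓ ρ ≈ ⟦ e ⟧ ρ
  correct (var i) ρ = unit-correct i ρ
  correct (d :+ e) ρ = ≈-trans (+-correct (normalise d) (normalise e) ρ) (∙-cong (correct d ρ) (correct e ρ))
  correct (d :- e) ρ = ≈-trans (+-correct (normalise d) _ ρ)
    (∙-cong (correct d ρ) (≈-trans (neg-correct (normalise e) ρ) (⁻¹-cong (correct e ρ))))
  correct `0       ρ = 0-correct ρ

  open Reflection setoid var ⟦_⟧ (λ e → ⟦ normalise e ⟧⇓) correct public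
    using (solve; _⊜_)

-- Finite sums and sums over pairs in an abelian group

module Sums {c ℓ} (G : AbelianGroup c ℓ) where

  open AbelianGroup G public
    using (Carrier; _≈_; setoid; reflexive)
    renaming (refl to ≈-refl; sym to ≈-sym; trans to ≈-trans; _∙_ to infixl 6 _⊕_; _-_ to infixl 6 _⊖_;
      ε to 𝟘; ∙-cong to ⊕-cong; ∙-congˡ to ⊕-congˡ; ∙-congʳ to ⊕-congʳ;
              identityˡ to ⊕-identityˡ; identityʳ to ⊕-identityʳ; assoc to ⊕-assoc; comm to ⊕-comm; _⁻¹
                to ⊖_; ⁻¹-cong to ⊖‿cong)
  open AbelianGroupSolver G public using (solve; _⊜_; _:+_; _:-_; `0)
  open SetoidReasoning setoid

  ⊖-cong : ∀ {w x y z} → w ≈ x → y ≈ z → w ⊖ y ≈ x ⊖ z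
  ⊖-cong w≈x y≈z = ⊕-cong w≈x (⊖‿cong y≈z)

  sum< : ℕ → (ℕ → Carrier) → Carrier
  sum< zero    F = 𝟘
  sum< (suc n) F = sum< n F ⊕ F n

  infix 5 sum<
  syntax sum< n (λ i → e) = ∑[ i < n ] e

  sum : ∀ {a} {A : Set a} → List A → (A → Carrier) → Carrier
  sum xs F = foldr (λ x y → F x ⊕ y) 𝟘 xs

  infix 5 sum
  syntax sum xs (λ x → e) = ∑[ x ∈ xs ] e

  sum<-cong : ∀ n {F H : ℕ → Carrier} → (∀ {i} → i < n → F i ≈ H i) → sum< n F ≈ sum< n H
  sum<-cong zero    F≈H = ≈-refl
  sum<-cong (suc n) F≈H = ⊕-cong (sum<-cong n λ i<n → F≈H (ℕ.m≤n⇒m≤1+n i<n)) (F≈H ℕ.≤-refl)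

  sum<-≡0 : ∀ n {F : ℕ → Carrier} → (∀ {i} → i < n → F i ≈ 𝟘) → sum< n F ≈ 𝟘
  sum<-≡0 zero    F≈0 = ≈-refl
  sum<-≡0 (suc n) F≈0 =
    ≈-trans (⊕-cong (sum<-≡0 n λ i<n → F≈0 (ℕ.m≤n⇒m≤1+n i<n)) (F≈0 ℕ.≤-refl)) (⊕-identityˡ 𝟘)

  sum<-none : ∀ {n} {F : ℕ → Carrier} → n ≡ 0 → sum< n F ≈ 𝟘
  sum<-none refl = ≈-refl

  sum<-suc : ∀ n (F : ℕ → Carrier) → sum< (suc n) F ≈ F 0 ⊕ sum< n (λ i → F (suc i))
  sum<-suc zero    F = ≈-trans (⊕-identityˡ _) (≈-sym (⊕-identityʳ _))
  sum<-suc (suc n) F = ≈-trans (⊕-congʳ (sum<-suc n F)) (⊕-assoc _ _ _)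

  sum<-+ : ∀ m n (F : ℕ → Carrier) → sum< (m ℕ.+ n) F ≈ sum< m F ⊕ sum< n (λ i → F (m ℕ.+ i))
  sum<-+ zero    n F = ≈-sym (⊕-identityˡ _)
  sum<-+ (suc m) n F = begin
    sum< (suc (m ℕ.+ n)) F                                           ≈⟨ sum<-suc (m ℕ.+ n) F ⟩
    F 0 ⊕ sum< (m ℕ.+ n) (λ i → F (suc i))                           ≈⟨ ⊕-congˡ (sum<-+ m n _) ⟩
    F 0 ⊕ (sum< m (λ i → F (suc i)) ⊕ sum< n (λ i → F (suc m ℕ.+ i)))  ≈⟨ ⊕-assoc _ _ _ ⟨
    F 0 ⊕ sum< m (λ i → F (suc i)) ⊕ sum< n (λ i → F (suc m ℕ.+ i))    ≈⟨ ⊕-congʳ (sum<-suc m F) ⟨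
    sum< (suc m) F ⊕ sum< n (λ i → F (suc m ℕ.+ i))                  ∎

  sum<-⊕ : ∀ n (F H : ℕ → Carrier) → (∑[ i < n ] (F i ⊕ H i)) ≈ sum< n F ⊕ sum< n H
  sum<-⊕ zero    F H = ≈-sym (⊕-identityˡ 𝟘)
  sum<-⊕ (suc n) F H = ≈-trans (⊕-congʳ (sum<-⊕ n F H))
    (solve 4 (λ a b c d → (a :+ b) :+ (c :+ d) ⊜ (a :+ c) :+ (b :+ d)) ≈-refl _ _ _ _)

  sum<-⊖ : ∀ n (F H : ℕ → Carrier) → (∑[ i < n ] (F i ⊖ H i)) ≈ sum< n F ⊖ sum< n H
  sum<-⊖ zero    F H = solve 0 (`0 ⊜ `0 :- `0) ≈-refl
  sum<-⊖ (suc n) F H = ≈-trans (⊕-congʳ (sum<-⊖ n F H))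
    (solve 4 (λ a b c d → (a :- b) :+ (c :- d) ⊜ (a :+ c) :- (b :+ d)) ≈-refl _ _ _ _)

  module _ {a} {A : Set a} where

    sum-cong : ∀ (xs : List A) {F H : A → Carrier} → (∀ x → F x ≈ H x) → sum xs F ≈ sum xs H
    sum-cong []       F≈H = ≈-refl
    sum-cong (x ∷ xs) F≈H = ⊕-cong (F≈H x) (sum-cong xs F≈H)

    sum-⊕ : ∀ (xs : List A) (F H : A → Carrier) → (∑[ x ∈ xs ] (F x ⊕ H x)) ≈ sum xs F ⊕ sum xs H
    sum-⊕ []       F H = ≈-sym (⊕-identityˡ 𝟘)
    sum-⊕ (x ∷ xs) F H = ≈-trans (⊕-congˡ (sum-⊕ xs F H))
      (solve 4 (λ a b c d → (a :+ b) :+ (c :+ d) ⊜ (a :+ c) :+ (b :+ d)) ≈-refl _ _ _ _)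

    sum-⊖ : ∀ (xs : List A) (F H : A → Carrier) → (∑[ x ∈ xs ] (F x ⊖ H x)) ≈ sum xs F ⊖ sum xs H
    sum-⊖ []       F H = solve 0 (`0 ⊜ `0 :- `0) ≈-refl
    sum-⊖ (x ∷ xs) F H = ≈-trans (⊕-congˡ (sum-⊖ xs F H))
      (solve 4 (λ a b c d → (a :- b) :+ (c :- d) ⊜ (a :+ c) :- (b :+ d)) ≈-refl _ _ _ _)

    sum-↭ : ∀ {xs ys : List A} (F : A → Carrier) → xs ↭ ys → sum xs F ≈ sum ys F
    sum-↭ F ↭.refl         = ≈-refl
    sum-↭ F (↭.prep x p)   = ⊕-congˡ (sum-↭ F p)
    sum-↭ F (↭.swap x y p) = ≈-trans (⊕-congˡ (⊕-congˡ (sum-↭ F p)))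
      (solve 3 (λ a b c → a :+ (b :+ c) ⊜ b :+ (a :+ c)) ≈-refl _ _ _)
    sum-↭ F (↭.trans p q)  = ≈-trans (sum-↭ F p) (sum-↭ F q)

    pairSum : (A → A → Carrier) → List A → Carrier
    pairSum K []       = 𝟘
    pairSum K (x ∷ xs) = sum xs (K x) ⊕ pairSum K xs

    -- Only a swap reverses the order within a pair, and it does so for the single pair x, y.
    pairSum-↭ : ∀ {K : A → A → Carrier} → (∀ x y → K x y ≈ K y x) →
      ∀ {xs ys} → xs ↭ ys → pairSum K xs ≈ pairSum K ys
    pairSum-↭ sym-K ↭.refl         = ≈-refl
    pairSum-↭ sym-K (↭.prep x p)   = ⊕-cong (sum-↭ _ p) (pairSum-↭ sym-K p)
    pairSum-↭ {K} sym-K {x ∷ y ∷ xs} {_ ∷ _ ∷ ys} (↭.swap x y p) = begin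
      (K x y ⊕ sum xs (K x)) ⊕ (sum xs (K y) ⊕ pairSum K xs)
        ≈⟨ ⊕-cong (⊕-cong (sym-K x y) (sum-↭ _ p)) (⊕-cong (sum-↭ _ p) (pairSum-↭ sym-K p)) ⟩
      (K y x ⊕ sum ys (K x)) ⊕ (sum ys (K y) ⊕ pairSum K ys)
        ≈⟨ solve 4 (λ a b c d → (a :+ b) :+ (c :+ d) ⊜ (a :+ c) :+ (b :+ d)) ≈-refl _ _ _ _ ⟩
      (K y x ⊕ sum ys (K y)) ⊕ (sum ys (K x) ⊕ pairSum K ys) ∎
    pairSum-↭ sym-K (↭.trans p q)  = ≈-trans (pairSum-↭ sym-K p) (pairSum-↭ sym-K q)

-- Diagrams as nested hooks

-- p and c are the row and column lengths of one Ferrers diagram.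
Dual : (p c : ℕ → ℕ) → Set
Dual p c = ∀ i j → (j < p i → i < c j) × (i < c j → j < p i)

module _ {p c : ℕ → ℕ} (dual : Dual p c) where

  Dual-≤ : ∀ {i n} → p i ≤ n → ∀ {j} → n ≤ j → c j ≤ i
  Dual-≤ {i} pᵢ≤n n≤j = ℕ.≮⇒≥ λ i<cⱼ →
    ℕ.<⇒≱ (proj₂ (dual i _) i<cⱼ) (ℕ.≤-trans pᵢ≤n n≤j)

  Dual-swap : Dual c p
  Dual-swap i j = proj₂ (dual j i) , proj₁ (dual j i)

module _ {p c : ℕ → ℕ} (dual : Dual p c) where

  rows-≤ : ∀ i → p i ≤ p 0
  rows-≤ i = ℕ.≮⇒≥ λ p₀<pᵢ →
    ℕ.<-irrefl refl (proj₂ (dual 0 (p 0)) (ℕ.≤-<-trans z≤n (proj₁ (dual i (p 0)) p₀<pᵢ)))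

  rows-vanish : ∀ {n} → c 0 ≤ n → ∀ {i} → n ≤ i → p i ≡ 0
  rows-vanish c₀≤n n≤i = ℕ.n≤0⇒n≡0 (Dual-≤ (Dual-swap dual) c₀≤n n≤i)

  row≡suc : ∀ {i j} → i < c j → p i ≡ suc (pred (p i))
  row≡suc {i} {j} i<cⱼ = sym (ℕ.suc-pred (p i) {{ℕ.>-nonZero (ℕ.≤-<-trans z≤n (proj₂ (dual i j) i<cⱼ))}})

-- Deletion of the outermost hook. Rows of length 0 stay 0 under `pred`, so the function is total
-- and no number of rows has to be carried along.
inner : (ℕ → ℕ) → ℕ → ℕ
inner p i = pred (p (suc i))

<-pred : ∀ {m n} → suc m < n → m < pred n
<-pred {n = suc n} (s≤s m<n) = m<n

pred-< : ∀ {m n} → m < pred n → suc m < n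
pred-< {n = suc n} m<n = s≤s m<n

Dual-tail : ∀ {p c} → Dual p c → Dual (λ i → p (suc i)) (λ j → pred (c j))
Dual-tail dual i j =
    (λ j<pᵢ → <-pred (proj₁ (dual (suc i) j) j<pᵢ))
  , (λ i<cⱼ → proj₂ (dual (suc i) j) (pred-< i<cⱼ))

Dual-inner : ∀ {p c} → Dual p c → Dual (inner p) (inner c)
Dual-inner dual i j =
    (λ j<pᵢ → <-pred (proj₁ (dual (suc i) (suc j)) (pred-< j<pᵢ)))
  , (λ i<cⱼ → <-pred (proj₂ (dual (suc i) (suc j)) (pred-< i<cⱼ)))

-- The diagram is a union of nested hooks; the entries X are their arm lengths plus 1,
-- and the leg of each hook is one longer than its arm.
data Shape (p c : ℕ → ℕ) : List ℕ → Set where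
  empty : (∀ i → p i ≡ 0) → Shape p c []
  frame : ∀ {X B} → 0 < X → p 0 ≡ X → c 0 ≡ suc X → Dual p c → All (_< X) B →
          Shape (inner p) (inner c) B → Shape p c (X ∷ B)

-- The diagonal box i of the inner diagram is the diagonal box i + 1 of the outer one, so the
-- condition on the legs passes inwards. The recursion is on a bound for the first row. The inner
-- first row is `pred (p 1)`, hence shorter than `p 0`; the bound on B records this and makes the
-- entries strictly decrease.
shape : ∀ {p c} → Dual p c → (∀ {i} → i < p i → c i ≡ suc (p i)) →
        ∃[ B ] Shape p c B × All (_≤ p 0) B
shape {p} {c} = go (p 0) ℕ.≤-refl
  where
  go : ∀ n {p c} → p 0 ≤ n → Dual p c → (∀ {i} → i < p i → c i ≡ suc (p i)) →
       ∃[ B ] Shape p c B × All (_≤ p 0) B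
  go n {p} {c} p₀≤n dual legs with p 0 in p₀
  ... | zero  = [] , empty (λ i → ℕ.n≤0⇒n≡0 (subst (p i ≤_) p₀ (rows-≤ dual i))) , []
  go (suc n) {p} {c} (s≤s x≤n) dual legs | suc x =
    extend (go n {inner p} {inner c} (ℕ.≤-trans inner≤x x≤n) (Dual-inner dual) legsᵢ)
    where
    inner≤x : inner p 0 ≤ x
    inner≤x = ℕ.pred-mono-≤ (subst (p 1 ≤_) p₀ (rows-≤ dual 1))
    legsᵢ : ∀ {i} → i < inner p i → inner c i ≡ suc (inner p i)
    legsᵢ {i} i<pᵢ = trans (cong pred (legs i+1<))
      (sym (ℕ.suc-pred (p (suc i)) {{ℕ.>-nonZero (ℕ.<-trans z<s i+1<)}}))
      where
      i+1< : suc i < p (suc i)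
      i+1< = pred-< i<pᵢ
    extend : ∃[ B ] Shape (inner p) (inner c) B × All (_≤ inner p 0) B →
             ∃[ B ] Shape p c B × All (_≤ suc x) B
    extend (B , shapeᵢ , B≤) =
        suc x ∷ B
      , frame z<s p₀ (trans (legs (subst (0 <_) (sym p₀) z<s)) (cong suc p₀)) dual B<X shapeᵢ
      , ℕ.≤-refl ∷ All.map ℕ.<⇒≤ B<X
      where
      B<X : All (_< suc x) B
      B<X = All.map (λ Y≤ → s≤s (ℕ.≤-trans Y≤ inner≤x)) B≤

-- Beads and the border word

-- Position k + 1 of the border is vertical exactly when it is a bead; B lists the
-- positive beads, and a positive bead X is mirrored by the gap -X.
Bead : List ℕ → ℤ → Set
Bead []      x = x ℤ.≤ 0ℤ
Bead (X ∷ B) x = (x ≡ + X ⊎ Bead B x) × x ≢ - + X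

suc-row : ∀ a b → + suc a -ᶻ + suc b ≡ + a -ᶻ + b
suc-row a b = ring (+ a) (+ b)
  where
  ring : ∀ a b → (1ℤ +ᶻ a) -ᶻ (1ℤ +ᶻ b) ≡ a -ᶻ b
  ring = solve-∀

module _ {p c X} (p₀ : p 0 ≡ X) (c₀ : c 0 ≡ suc X) (dual : Dual p c) where

  row-suc : ∀ {i} → i < X → p (suc i) ≡ suc (inner p i)
  row-suc i<X = row≡suc dual (subst (_ <_) (sym c₀) (s≤s i<X))

  row-zero : ∀ {i} → X ≤ i → p (suc i) ≡ 0
  row-zero X≤i = rows-vanish dual (ℕ.≤-reflexive c₀) (s≤s X≤i)

  inner-zero : ∀ {i} → X ≤ i → inner p i ≡ 0
  inner-zero X≤i = cong pred (row-zero X≤i)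

0-n≡-n : ∀ n → + 0 -ᶻ + n ≡ - + n
0-n≡-n n = ℤ.+-identityˡ (- + n)

+≢- : ∀ {X} → 0 < X → + X ≢ - + X
+≢- {suc X} _ ()

-- Row 0 gives the bead X. For i < X, row i + 1 of the outer diagram has the same position as row i
-- of the inner one, since both its length and its index drop by 1. From there on all rows are
-- empty: the outer rows X + 1, X + 2, ... continue with -(X + 1), whereas the inner rows continue
-- with -X. So exactly the inner bead -X is lost.
vertical⇔bead : ∀ {p c B} → Shape p c B → ∀ x →
  ((∃[ i ] x ≡ + p i -ᶻ + i) → Bead B x) × (Bead B x → ∃[ i ] x ≡ + p i -ᶻ + i)
vertical⇔bead {p} (empty p≡0) x = to , from
  where
  to : (∃[ i ] x ≡ + p i -ᶻ + i) → x ℤ.≤ 0ℤ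
  to (i , refl) rewrite p≡0 i | 0-n≡-n i = ℤ.neg-mono-≤ (ℤ.+≤+ z≤n)
  from : x ℤ.≤ 0ℤ → ∃[ i ] x ≡ + p i -ᶻ + i
  from x≤0 = ∣ x ∣ , (begin-equality
    x                        ≡⟨ ℤ.neg-involutive x ⟨
    - - x                    ≡⟨ cong -_ (ℤ.0≤i⇒+∣i∣≡i (ℤ.neg-mono-≤ x≤0)) ⟨
    - + ∣ - x ∣              ≡⟨ cong (λ n → - + n) (ℤ.∣-i∣≡∣i∣ x) ⟩
    - + ∣ x ∣                ≡⟨ 0-n≡-n ∣ x ∣ ⟨
    + 0 -ᶻ + ∣ x ∣           ≡⟨ cong (λ n → + n -ᶻ + ∣ x ∣) (p≡0 ∣ x ∣) ⟨
    + p ∣ x ∣ -ᶻ + ∣ x ∣     ∎)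
    where open ℤ.≤-Reasoning
vertical⇔bead {p} {c} {X ∷ B} (frame 0<X p₀ c₀ dual _ shapeᵢ) x = to , from
  where
  ≢-X : ∀ {i} → i < X → + inner p i -ᶻ + i ≢ - + X
  ≢-X {i} i<X eq = ℕ.<⇒≱ i<X (subst (X ≤_) (ℤ.+-injective q+X≡i) (ℕ.m≤n+m X (inner p i)))
    where
    ring : ∀ a b x → a +ᶻ x ≡ (a -ᶻ b) +ᶻ (b +ᶻ x)
    ring = solve-∀
    ring′ : ∀ b x → - x +ᶻ (b +ᶻ x) ≡ b
    ring′ = solve-∀
    q+X≡i : + inner p i +ᶻ + X ≡ + i
    q+X≡i = trans (ring (+ inner p i) (+ i) (+ X))
      (trans (cong (_+ᶻ (+ i +ᶻ + X)) eq) (ring′ (+ i) (+ X)))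
  to : (∃[ i ] x ≡ + p i -ᶻ + i) → Bead (X ∷ B) x
  to (zero , refl) rewrite p₀ | ℤ.+-identityʳ (+ X) = inj₁ refl , +≢- 0<X
  to (suc i , refl) with i ℕ.<? X
  ... | yes i<X rewrite row-suc p₀ c₀ dual i<X | suc-row (inner p i) i =
    inj₂ (proj₁ (vertical⇔bead shapeᵢ _) (i , refl)) , ≢-X i<X
  ... | no i≮X rewrite row-zero p₀ c₀ dual (ℕ.≮⇒≥ i≮X) =
      inj₂ (proj₁ (vertical⇔bead shapeᵢ _) (suc i , cong (λ n → + n -ᶻ + suc i)
        (sym (inner-zero p₀ c₀ dual (ℕ.m≤n⇒m≤1+n (ℕ.≮⇒≥ i≮X))))))
    , λ eq → ℕ.<-irrefl (ℤ.+-injective (ℤ.neg-injective (sym eq))) (s≤s (ℕ.≮⇒≥ i≮X))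
  from : Bead (X ∷ B) x → ∃[ i ] x ≡ + p i -ᶻ + i
  from (inj₁ refl , _) = 0 , trans (sym (ℤ.+-identityʳ (+ X))) (cong (λ n → + n -ᶻ + 0) (sym p₀))
  from (inj₂ bead , x≢-X) with proj₂ (vertical⇔bead shapeᵢ x) bead
  ... | i , x≡ with i ℕ.<? X
  ...   | yes i<X = suc i , trans x≡ (trans (sym (suc-row (inner p i) i))
                      (cong (λ n → + n -ᶻ + suc i) (sym (row-suc p₀ c₀ dual i<X))))
  ...   | no i≮X with x≡′ ← trans x≡ (trans (cong (λ n → + n -ᶻ + i)
    (inner-zero p₀ c₀ dual (ℕ.≮⇒≥ i≮X))) (0-n≡-n i))
                 with ℕ.m≤n⇒m<n∨m≡n (ℕ.≮⇒≥ i≮X)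
  ...     | inj₂ refl = contradiction x≡′ x≢-X
  ...     | inj₁ (s≤s X≤i) = i , trans x≡′ (trans (sym (0-n≡-n i))
    (cong (λ n → + n -ᶻ + i) (sym (row-zero p₀ c₀ dual X≤i))))

-- Sums over beads and over hook lengths

module ShapeSums {a ℓ} (G : AbelianGroup a ℓ) where
  open Sums G
  open SetoidReasoning setoid

  resp : ∀ (F : ℤ → Carrier) {x y} → x ≡ y → F x ≈ F y
  resp F x≡y = reflexive (cong F x≡y)

  sum<-reverse : ∀ n (F : ℤ → Carrier) → (∑[ j < n ] F (+ n -ᶻ + j)) ≈ (∑[ j < n ] F (+ suc j))
  sum<-reverse zero    F = ≈-refl
  sum<-reverse (suc n) F = begin
    (∑[ j < suc n ] F (+ suc n -ᶻ + j))              ≈⟨ sum<-suc n _ ⟩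
    F (+ suc n -ᶻ + 0) ⊕ (∑[ j < n ] F (+ suc n -ᶻ + suc j))
      ≈⟨ ⊕-cong (resp F (ℤ.+-identityʳ (+ suc n))) (sum<-cong n λ {j} _ → resp F (suc-row n j)) ⟩
    F (+ suc n) ⊕ (∑[ j < n ] F (+ n -ᶻ + j))        ≈⟨ ⊕-congˡ (sum<-reverse n F) ⟩
    F (+ suc n) ⊕ (∑[ j < n ] F (+ suc j))           ≈⟨ ⊕-comm _ _ ⟩
    (∑[ j < suc n ] F (+ suc j))                     ∎

  -- The hooks of a row of length x above the diagram, together with the distances
  -- from its bead to the beads below, fill an interval.
  rowHooks : ∀ N x {p c} (F : ℤ → Carrier) → Dual p c → p 0 ≤ x → (∀ j → c j ≤ N) →
    (∑[ j < x ] F (+ x -ᶻ + j +ᶻ + c j)) ⊕ (∑[ i < N ] F (+ x -ᶻ + p i +ᶻ + suc i))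
      ≈ (∑[ n < x ℕ.+ N ] F (+ suc n))
  rowHooks zero    x {p} {c} F dual p₀≤x c≤N = begin
    (∑[ j < x ] F (+ x -ᶻ + j +ᶻ + c j)) ⊕ 𝟘   ≈⟨ ⊕-identityʳ _ ⟩
    (∑[ j < x ] F (+ x -ᶻ + j +ᶻ + c j))       ≈⟨ sum<-cong x
      (λ {j} _ → resp F (trans (cong (λ n → + x -ᶻ + j +ᶻ + n) (ℕ.n≤0⇒n≡0 (c≤N j))) (ℤ.+-identityʳ _))) ⟩
    (∑[ j < x ] F (+ x -ᶻ + j))                ≈⟨ sum<-reverse x F ⟩
    (∑[ n < x ] F (+ suc n))                   ≈⟨ reflexive
      (cong (λ m → sum< m (λ n → F (+ suc n))) (ℕ.+-identityʳ x)) ⟨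
    (∑[ n < x ℕ.+ 0 ] F (+ suc n))             ∎
  rowHooks (suc N) x {p} {c} F dual p₀≤x c≤N with ℕ.m≤n⇒∃[o]m+o≡n p₀≤x
  -- The d columns beyond the first row give 1, ..., d and the first row itself gives d + 1. All
  -- other terms belong to the diagram without its first row, taken with row length `y`, and are
  -- raised by d + 1; this is `F′`.
  ... | d , refl = begin
    (∑[ j < y ℕ.+ d ] F (+ (y ℕ.+ d) -ᶻ + j +ᶻ + c j)) ⊕ (∑[ i < suc N ] F (+ (y ℕ.+ d) -ᶻ + p i +ᶻ + suc i))
      ≈⟨ ⊕-cong (sum<-+ y d _) (sum<-suc N _) ⟩
    (∑[ j < y ] F (+ (y ℕ.+ d) -ᶻ + j +ᶻ + c j)) ⊕
      (∑[ k < d ] F (+ (y ℕ.+ d) -ᶻ + (y ℕ.+ k) +ᶻ + c (y ℕ.+ k)))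
      ⊕ (F (+ (y ℕ.+ d) -ᶻ + y +ᶻ + 1) ⊕ (∑[ i < N ] F (+ (y ℕ.+ d) -ᶻ + p (suc i) +ᶻ + suc (suc i))))
      ≈⟨ ⊕-cong (⊕-cong (sum<-cong y left) (≈-trans (sum<-cong d λ {k} _ → resp F (middle k))
        (sum<-reverse d F)))
                (⊕-cong (resp F (corner (+ y) (+ d)))
                  (sum<-cong N λ {i} _ → resp F (right (+ y) (+ d) (+ p (suc i)) (+ i)))) ⟩
    (∑[ j < y ] F′ (+ y -ᶻ + j +ᶻ + pred (c j))) ⊕ (∑[ n < d ] F (+ suc n))
      ⊕ (F (+ suc d) ⊕ (∑[ i < N ] F′ (+ y -ᶻ + p (suc i) +ᶻ + suc i)))
      ≈⟨ solve 4 (λ a b c d → a :+ b :+ (c :+ d) ⊜ b :+ (c :+ (a :+ d))) ≈-refl _ _ _ _ ⟩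
    (∑[ n < d ] F (+ suc n)) ⊕ (F (+ suc d) ⊕ ((∑[ j < y ] F′ (+ y -ᶻ + j +ᶻ + pred (c j)))
      ⊕ (∑[ i < N ] F′ (+ y -ᶻ + p (suc i) +ᶻ + suc i))))
      ≈⟨ ⊕-congˡ (⊕-congˡ (rowHooks N y F′ (Dual-tail dual) (rows-≤ dual 1) (λ j → ℕ.pred-mono-≤ (c≤N j)))) ⟩
    (∑[ n < d ] F (+ suc n)) ⊕ (F (+ suc d) ⊕ (∑[ n < y ℕ.+ N ] F (+ suc n +ᶻ + suc d)))
      ≈⟨ ⊕-congˡ (⊕-cong (resp F (cong (λ n → + suc n) (sym (ℕ.+-identityʳ d))))
        (sum<-cong (y ℕ.+ N) λ {n} _ → resp F (advance (+ n) (+ d)))) ⟩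
    (∑[ n < d ] F (+ suc n)) ⊕ (F (+ suc (d ℕ.+ 0)) ⊕ (∑[ n < y ℕ.+ N ] F (+ suc (d ℕ.+ suc n))))
      ≈⟨ ⊕-congˡ (sum<-suc (y ℕ.+ N) _) ⟨
    (∑[ n < d ] F (+ suc n)) ⊕ (∑[ n < suc (y ℕ.+ N) ] F (+ suc (d ℕ.+ n)))
      ≈⟨ sum<-+ d (suc (y ℕ.+ N)) _ ⟨
    (∑[ n < d ℕ.+ suc (y ℕ.+ N) ] F (+ suc n))
      ≈⟨ reflexive (cong (λ m → sum< m (λ n → F (+ suc n))) lengths) ⟩
    (∑[ n < y ℕ.+ d ℕ.+ suc N ] F (+ suc n)) ∎
    where
    y = p 0
    F′ : ℤ → Carrier
    F′ z = F (z +ᶻ + suc d)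
    left : ∀ {j} → j < y → F (+ (y ℕ.+ d) -ᶻ + j +ᶻ + c j) ≈ F′ (+ y -ᶻ + j +ᶻ + pred (c j))
    left {j} j<y = resp F (trans (cong (λ n → + (y ℕ.+ d) -ᶻ + j +ᶻ + n) (row≡suc (Dual-swap dual) j<y))
      (ring (+ y) (+ d) (+ j) (+ pred (c j))))
      where
      ring : ∀ y d j c → y +ᶻ d -ᶻ j +ᶻ (1ℤ +ᶻ c) ≡ y -ᶻ j +ᶻ c +ᶻ (1ℤ +ᶻ d)
      ring = solve-∀
    middle : ∀ k → + (y ℕ.+ d) -ᶻ + (y ℕ.+ k) +ᶻ + c (y ℕ.+ k) ≡ + d -ᶻ + k
    middle k = trans (cong (λ n → + (y ℕ.+ d) -ᶻ + (y ℕ.+ k) +ᶻ + n)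
      (rows-vanish (Dual-swap dual) ℕ.≤-refl (ℕ.m≤m+n y k))) (ring (+ y) (+ d) (+ k))
      where
      ring : ∀ y d k → y +ᶻ d -ᶻ (y +ᶻ k) +ᶻ 0ℤ ≡ d -ᶻ k
      ring = solve-∀
    corner : ∀ y d → y +ᶻ d -ᶻ y +ᶻ 1ℤ ≡ 1ℤ +ᶻ d
    corner = solve-∀
    right : ∀ y d p i → y +ᶻ d -ᶻ p +ᶻ (1ℤ +ᶻ (1ℤ +ᶻ i)) ≡ y -ᶻ p +ᶻ (1ℤ +ᶻ i) +ᶻ (1ℤ +ᶻ d)
    right = solve-∀
    advance : ∀ n d → (1ℤ +ᶻ n) +ᶻ (1ℤ +ᶻ d) ≡ 1ℤ +ᶻ (d +ᶻ (1ℤ +ᶻ n))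
    advance = solve-∀
    lengths : d ℕ.+ suc (y ℕ.+ N) ≡ y ℕ.+ d ℕ.+ suc N
    lengths = trans (cong (d ℕ.+_) (sym (ℕ.+-suc y N)))
      (trans (sym (ℕ.+-assoc d y (suc N))) (cong (ℕ._+ suc N) (ℕ.+-comm d y)))

  -- Column 0 has X + 1 boxes, so row X is not empty and the cut-off N exceeds X. This lets sums
  -- over rows be split into row 0, the X rows meeting the inner diagram, and empty rows.
  frame-rows : ∀ {p c X N} → 0 < X → c 0 ≡ suc X → Dual p c → (∀ {i} → N ≤ i → p i ≡ 0) →
    ∃[ k ] N ≡ suc (X ℕ.+ k)
  frame-rows {p} {c} {X} {N} 0<X c₀ dual vanish with ℕ.m≤n⇒∃[o]m+o≡n X<N
    where
    X<N : suc X ≤ N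
    X<N = ℕ.≰⇒> λ N≤X → ℕ.<-irrefl (sym (vanish N≤X)) (proj₂ (dual X 0) (subst (X <_) (sym c₀) ℕ.≤-refl))
  ... | k , eq = k , sym eq

  -- The rows of the empty diagram sit at 0, -1, -2, ..., and each Z in B moves one bead from -Z to
  -- Z.
  beadSum : ∀ {p c B} N (F : ℤ → Carrier) → Shape p c B → (∀ {i} → N ≤ i → p i ≡ 0) →
    (∑[ i < N ] F (+ p i -ᶻ + i)) ≈ (∑[ i < N ] F (- + i)) ⊕ (∑[ Z ∈ B ] (F (+ Z) ⊖ F (- + Z)))
  beadSum N F (empty p≡0) vanish = ≈-trans
    (sum<-cong N λ {i} _ → resp F (trans (cong (λ n → + n -ᶻ + i) (p≡0 i)) (0-n≡-n i)))
    (≈-sym (⊕-identityʳ _))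
  beadSum {p} {c} {X ∷ B} N F (frame 0<X p₀ c₀ dual _ shapeᵢ) vanish with frame-rows 0<X c₀ dual vanish
  ... | k , refl = begin
    (∑[ i < suc (X ℕ.+ k) ] F (+ p i -ᶻ + i))
      ≈⟨ ≈-trans (sum<-suc (X ℕ.+ k) _) (⊕-congˡ (sum<-+ X k _)) ⟩
    F (+ p 0 -ᶻ + 0) ⊕ ((∑[ i < X ] F (+ p (suc i) -ᶻ + suc i)) ⊕
      (∑[ i < k ] F (+ p (suc (X ℕ.+ i)) -ᶻ + suc (X ℕ.+ i))))
      ≈⟨ ⊕-cong (resp F (trans (cong (λ n → + n -ᶻ + 0) p₀) (ℤ.+-identityʳ (+ X))))
           (⊕-cong (sum<-cong X λ {i} i<X → resp F
             (trans (cong (λ n → + n -ᶻ + suc i) (row-suc p₀ c₀ dual i<X)) (suc-row (inner p i) i)))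
                   (sum<-cong k λ {i} _ → resp F
                     (trans (cong (λ n → + n -ᶻ + suc (X ℕ.+ i)) (row-zero p₀ c₀ dual (ℕ.m≤m+n X i)))
                       (0-n≡-n (suc (X ℕ.+ i)))))) ⟩
    F (+ X) ⊕ ((∑[ i < X ] F (+ inner p i -ᶻ + i)) ⊕ (∑[ i < k ] F (- + suc (X ℕ.+ i))))
      ≈⟨ ⊕-congˡ (⊕-congʳ (beadSum X F shapeᵢ (inner-zero p₀ c₀ dual))) ⟩
    F (+ X) ⊕ ((∑[ i < X ] F (- + i)) ⊕ (∑[ Z ∈ B ] (F (+ Z) ⊖ F (- + Z))) ⊕
      (∑[ i < k ] F (- + suc (X ℕ.+ i))))
      -- `F (- + X)` is added to extend the range 0, ..., X - 1 to X, and subtracted in the term of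
      -- X.
      ≈⟨ solve 5 (λ a b c d e → a :+ (b :+ c :+ d) ⊜ b :+ e :+ d :+ (a :- e :+ c)) ≈-refl _ _ _ _
        (F (- + X)) ⟩
    (∑[ i < suc X ] F (- + i)) ⊕ (∑[ i < k ] F (- + suc (X ℕ.+ i))) ⊕ (∑[ Z ∈ X ∷ B ] (F (+ Z) ⊖ F (- + Z)))
      ≈⟨ ⊕-congʳ (sum<-+ (suc X) k (λ i → F (- + i))) ⟨
    (∑[ i < suc (X ℕ.+ k) ] F (- + i)) ⊕ (∑[ Z ∈ X ∷ B ] (F (+ Z) ⊖ F (- + Z))) ∎

  module _ (φ : Bool → ℤ → Carrier) where

    -- The integer is the hook length of the box (i, j) inside the diagram, free of truncated
    -- subtraction; the Boolean says whether ε = -1.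
    boxTerm : (p c : ℕ → ℕ) → ℕ → ℕ → Carrier
    boxTerm p c i j = φ (j <ᵇ i) (+ p i -ᶻ + i +ᶻ + c j -ᶻ + suc j)

    boxSum : ℕ → (p c : ℕ → ℕ) → Carrier
    boxSum N p c = ∑[ i < N ] ∑[ j < p i ] boxTerm p c i j

    -- The hook lengths of the first row, corner included, are 1, ..., X - 1 and 2X, with X - Z
    -- replaced by X + Z for every Z in B.
    rowSum : ℕ → List ℕ → Carrier
    rowSum X B = (∑[ n < pred X ] φ false (+ suc n)) ⊕ φ false (+ X +ᶻ + X)
      ⊖ (∑[ Z ∈ B ] (φ false (+ X -ᶻ + Z) ⊖ φ false (+ X +ᶻ + Z)))

    -- Below the corner the hook lengths are 1, ..., X, with the same replacement of X - Z by X + Z.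
    columnSum : ℕ → List ℕ → Carrier
    columnSum X B = (∑[ n < X ] φ true (+ suc n))
      ⊕ (∑[ Z ∈ B ] (φ true (+ X +ᶻ + Z) ⊖ φ true (+ X -ᶻ + Z)))

    hooksSum : List ℕ → Carrier
    hooksSum []      = 𝟘
    hooksSum (X ∷ B) = rowSum X B ⊕ columnSum X B ⊕ hooksSum B

    -- By `rowHooks` for the diagram without its first row, the hook lengths are 1, ..., 2X without
    -- the distances from X to the X topmost beads of the inner diagram. By `beadSum` these
    -- distances are X, ..., 2X - 1 with X + Z replaced by X - Z, so 1, ..., X - 1 and 2X survive
    -- before the correction by B.
    firstRow : ∀ {p c X B} → 0 < X → p 0 ≡ X → c 0 ≡ suc X → Dual p c → Shape (inner p) (inner c) B →
      (∑[ j < X ] φ false (+ X +ᶻ + c j -ᶻ + suc j)) ≈ rowSum X B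
    firstRow {p} {c} {suc x} {B} 0<X p₀ c₀ dual shapeᵢ = begin
      (∑[ j < X ] F (+ X +ᶻ + c j -ᶻ + suc j))
        ≈⟨ sum<-cong X (λ {j} j<X → resp F (trans (cong (λ n → + X +ᶻ + n -ᶻ + suc j) (c≡suc j<X))
          (ring₁ (+ X) (+ j) (+ pred (c j))))) ⟩
      (∑[ j < X ] F (+ X -ᶻ + j +ᶻ + pred (c j)))
        ≈⟨ solve 2 (λ a b → a ⊜ a :+ b :- b) ≈-refl _ _ ⟩
      (∑[ j < X ] F (+ X -ᶻ + j +ᶻ + pred (c j))) ⊕ (∑[ i < X ] F (+ X -ᶻ + p (suc i) +ᶻ + suc i))
        ⊖ (∑[ i < X ] F (+ X -ᶻ + p (suc i) +ᶻ + suc i))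
        ≈⟨ ⊖-cong (rowHooks X X F (Dual-tail dual) (subst (p 1 ≤_) p₀ (rows-≤ dual 1)) pred-c≤X)
             (sum<-cong X λ {i} i<X → resp F (trans
               (cong (λ n → + X -ᶻ + n +ᶻ + suc i) (row-suc p₀ c₀ dual i<X))
                 (ring₂ (+ X) (+ inner p i) (+ i)))) ⟩
      (∑[ n < X ℕ.+ X ] F (+ suc n)) ⊖ (∑[ i < X ] F (+ X -ᶻ (+ inner p i -ᶻ + i)))
        ≈⟨ ⊖-cong (⊕-congʳ (sum<-+ x X _)) (beadSum X (λ z → F (+ X -ᶻ z)) shapeᵢ (inner-zero p₀ c₀ dual)) ⟩
      (∑[ n < x ] F (+ suc n)) ⊕ (∑[ i < X ] F (+ suc (x ℕ.+ i))) ⊕ F (+ X +ᶻ + X)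
        ⊖ ((∑[ i < X ] F (+ X -ᶻ - + i)) ⊕ (∑[ Z ∈ B ] (F (+ X -ᶻ + Z) ⊖ F (+ X -ᶻ - + Z))))
        ≈⟨ ⊖-cong ≈-refl (⊕-cong (sum<-cong X λ {i} _ → resp F (cong (+ X +ᶻ_) (ℤ.neg-involutive (+ i))))
             (sum-cong B λ Z → ⊖-cong ≈-refl (resp F (cong (+ X +ᶻ_) (ℤ.neg-involutive (+ Z)))))) ⟩
      (∑[ n < x ] F (+ suc n)) ⊕ (∑[ i < X ] F (+ X +ᶻ + i)) ⊕ F (+ X +ᶻ + X)
        ⊖ ((∑[ i < X ] F (+ X +ᶻ + i)) ⊕ (∑[ Z ∈ B ] (F (+ X -ᶻ + Z) ⊖ F (+ X +ᶻ + Z))))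
        ≈⟨ solve 4 (λ a b c d → a :+ b :+ c :- (b :+ d) ⊜ a :+ c :- d) ≈-refl _ _ _ _ ⟩
      rowSum X B ∎
      where
      X = suc x
      F = φ false
      c≡suc : ∀ {j} → j < X → c j ≡ suc (pred (c j))
      c≡suc j<X = row≡suc (Dual-swap dual) (subst (_ <_) (sym p₀) j<X)
      pred-c≤X : ∀ j → pred (c j) ≤ X
      pred-c≤X j = ℕ.pred-mono-≤ (subst (c j ≤_) c₀ (rows-≤ (Dual-swap dual) j))
      ring₁ : ∀ x j c → x +ᶻ (1ℤ +ᶻ c) -ᶻ (1ℤ +ᶻ j) ≡ x -ᶻ j +ᶻ c
      ring₁ = solve-∀
      ring₂ : ∀ x q i → x -ᶻ (1ℤ +ᶻ q) +ᶻ (1ℤ +ᶻ i) ≡ x -ᶻ (q -ᶻ i)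
      ring₂ = solve-∀

    -- The hook lengths below the corner are the positions of the inner beads raised by X, so
    -- `beadSum` alone evaluates them.
    firstColumn : ∀ {p c X B} → p 0 ≡ X → c 0 ≡ suc X → Dual p c → Shape (inner p) (inner c) B →
      (∑[ i < X ] φ true (+ inner p i -ᶻ + i +ᶻ + X)) ≈ columnSum X B
    firstColumn {p} {c} {X} {B} p₀ c₀ dual shapeᵢ = begin
      (∑[ i < X ] F (+ inner p i -ᶻ + i +ᶻ + X))
        ≈⟨ beadSum X (λ z → F (z +ᶻ + X)) shapeᵢ (inner-zero p₀ c₀ dual) ⟩
      (∑[ i < X ] F (- + i +ᶻ + X)) ⊕ (∑[ Z ∈ B ] (F (+ Z +ᶻ + X) ⊖ F (- + Z +ᶻ + X)))
        ≈⟨ ⊕-cong (≈-trans (sum<-cong X λ {i} _ → resp F (ℤ.+-comm (- + i) (+ X))) (sum<-reverse X F))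
                  (sum-cong B λ Z → ⊖-cong (resp F (ℤ.+-comm (+ Z) (+ X)))
                    (resp F (ℤ.+-comm (- + Z) (+ X)))) ⟩
      columnSum X B ∎
      where F = φ true

    -- A box outside the first row and column has the same hook length in the inner diagram and
    -- stays on the same side of the diagonal, since both its coordinates drop by 1.
    boxSum≈hooksSum : ∀ {p c B} N → Shape p c B → (∀ {i} → N ≤ i → p i ≡ 0) → boxSum N p c ≈ hooksSum B
    boxSum≈hooksSum N (empty p≡0) vanish = sum<-≡0 N λ {i} _ → sum<-none (p≡0 i)
    boxSum≈hooksSum {p} {c} {X ∷ B} N (frame 0<X p₀ c₀ dual _ shapeᵢ) vanish with frame-rows 0<X c₀ dual
      vanish
    ... | k , refl = begin
      boxSum (suc (X ℕ.+ k)) p c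
        ≈⟨ ≈-trans (sum<-suc (X ℕ.+ k) _) (⊕-congˡ (sum<-+ X k _)) ⟩
      row 0 ⊕ ((∑[ i < X ] row (suc i)) ⊕ (∑[ i < k ] row (suc (X ℕ.+ i))))
        ≈⟨ ⊕-cong (≈-trans row-0 (firstRow 0<X p₀ c₀ dual shapeᵢ)) (⊕-cong (sum<-cong X row-1+)
             (sum<-≡0 k λ {i} _ → sum<-none (row-zero p₀ c₀ dual (ℕ.m≤m+n X i)))) ⟩
      rowSum X B ⊕ ((∑[ i < X ] (φ true (+ inner p i -ᶻ + i +ᶻ + X) ⊕
        (∑[ j < inner p i ] boxTerm (inner p) (inner c) i j))) ⊕ 𝟘)
        ≈⟨ ⊕-congˡ (≈-trans (⊕-identityʳ _) (sum<-⊕ X _ _)) ⟩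
      rowSum X B ⊕ ((∑[ i < X ] φ true (+ inner p i -ᶻ + i +ᶻ + X)) ⊕ boxSum X (inner p) (inner c))
        ≈⟨ ⊕-assoc _ _ _ ⟨
      rowSum X B ⊕ (∑[ i < X ] φ true (+ inner p i -ᶻ + i +ᶻ + X)) ⊕ boxSum X (inner p) (inner c)
        ≈⟨ ⊕-cong (⊕-congˡ (firstColumn p₀ c₀ dual shapeᵢ))
          (boxSum≈hooksSum X shapeᵢ (inner-zero p₀ c₀ dual)) ⟩
      hooksSum (X ∷ B) ∎
      where
      row : ℕ → Carrier
      row i = ∑[ j < p i ] boxTerm p c i j
      row-0 : row 0 ≈ (∑[ j < X ] φ false (+ X +ᶻ + c j -ᶻ + suc j))
      row-0 rewrite p₀ = sum<-cong X λ {j} _ → resp (φ false)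
        (cong (λ z → z +ᶻ + c j -ᶻ + suc j) (ℤ.+-identityʳ (+ X)))
      row-1+ : ∀ {i} → i < X →
        row (suc i) ≈ φ true (+ inner p i -ᶻ + i +ᶻ + X) ⊕
          (∑[ j < inner p i ] boxTerm (inner p) (inner c) i j)
      row-1+ {i} i<X = begin
        row (suc i)
          ≈⟨ reflexive (cong (λ n → ∑[ j < n ] φ (j <ᵇ suc i) (+ n -ᶻ + suc i +ᶻ + c j -ᶻ + suc j))
            (row-suc p₀ c₀ dual i<X)) ⟩
        (∑[ j < suc q ] φ (j <ᵇ suc i) (+ suc q -ᶻ + suc i +ᶻ + c j -ᶻ + suc j))
          ≈⟨ sum<-suc q _ ⟩
        φ true (+ suc q -ᶻ + suc i +ᶻ + c 0 -ᶻ + 1) ⊕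
          (∑[ j < q ] φ (j <ᵇ i) (+ suc q -ᶻ + suc i +ᶻ + c (suc j) -ᶻ + suc (suc j)))
          ≈⟨ ⊕-cong (resp (φ true) (trans (cong (λ n → + suc q -ᶻ + suc i +ᶻ + n -ᶻ + 1) c₀)
            (ring₁ (+ q) (+ i) (+ X))))
               (sum<-cong q λ {j} j<q → resp (φ (j <ᵇ i))
                 (trans (cong (λ n → + suc q -ᶻ + suc i +ᶻ + n -ᶻ + suc (suc j)) (c≡suc j<q))
                 (ring₂ (+ q) (+ i) (+ inner c j) (+ j)))) ⟩
        φ true (+ q -ᶻ + i +ᶻ + X) ⊕ (∑[ j < q ] boxTerm (inner p) (inner c) i j) ∎
        where
        q = inner p i
        c≡suc : ∀ {j} → j < q → c (suc j) ≡ suc (inner c j)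
        c≡suc j<q = row≡suc (Dual-swap dual) (pred-< j<q)
        ring₁ : ∀ q i x → (1ℤ +ᶻ q) -ᶻ (1ℤ +ᶻ i) +ᶻ (1ℤ +ᶻ x) -ᶻ 1ℤ ≡ q -ᶻ i +ᶻ x
        ring₁ = solve-∀
        ring₂ : ∀ q i c j → (1ℤ +ᶻ q) -ᶻ (1ℤ +ᶻ i) +ᶻ (1ℤ +ᶻ c) -ᶻ (1ℤ +ᶻ (1ℤ +ᶻ j)) ≡ q -ᶻ i +ᶻ c -ᶻ
          (1ℤ +ᶻ j)
        ring₂ = solve-∀

-- Order and antisymmetry of the beads

data Descending : List ℕ → Set where
  []  : Descending []
  _∷_ : ∀ {X B} → 0 < X × All (_< X) B → Descending B → Descending (X ∷ B)

descending : ∀ {p c B} → Shape p c B → Descending B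
descending (empty _)                     = []
descending (frame 0<X _ _ _ B<X shapeᵢ) = (0<X , B<X) ∷ descending shapeᵢ

bead-< : ∀ {X B x} → 0 < X → All (_< X) B → Bead B x → x ℤ.< + X
bead-< 0<X []          x≤0             = ℤ.≤-<-trans x≤0 (ℤ.+<+ 0<X)
bead-< 0<X (Y<X ∷ B<X) (inj₁ refl , _) = ℤ.+<+ Y<X
bead-< 0<X (Y<X ∷ B<X) (inj₂ bead , _) = bead-< 0<X B<X bead

-- The only gaps at or below 0 are the -Y with Y in B, and these lie above -X.
bead-low : ∀ {X B x} → All (_< X) B → x ℤ.≤ - + X → Bead B x
bead-low {X} []  x≤-X = ℤ.≤-trans x≤-X (ℤ.neg-mono-≤ (ℤ.+≤+ z≤n))
bead-low (Y<X ∷ B<X) x≤-X =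
  inj₂ (bead-low B<X x≤-X) , λ { refl → ℤ.<⇒≱ (ℤ.+<+ Y<X) (ℤ.neg-cancel-≤ x≤-X) }

bead-antisym : ∀ B {x} → Bead B x → Bead B (- x) → x ≡ 0ℤ
bead-antisym []      x≤0 -x≤0 = ℤ.≤-antisym x≤0 (ℤ.neg-cancel-≤ -x≤0)
bead-antisym (X ∷ B) (inj₁ x≡X , _) (_ , -x≢-X) = contradiction (cong -_ x≡X) -x≢-X
bead-antisym (X ∷ B) {x} (inj₂ _ , x≢-X) (inj₁ -x≡X , _) =
  contradiction (trans (sym (ℤ.neg-involutive x)) (cong -_ -x≡X)) x≢-X
bead-antisym (X ∷ B) (inj₂ b , _) (inj₂ b′ , _) = bead-antisym B b b′

i+j-j≡i : ∀ i j → i +ᶻ j -ᶻ j ≡ i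
i+j-j≡i = solve-∀

i-j+j≡i : ∀ i j → i -ᶻ j +ᶻ j ≡ i
i-j+j≡i = solve-∀

i-j≡k⇒i≡k+j : ∀ {i j k} → i -ᶻ j ≡ k → i ≡ k +ᶻ j
i-j≡k⇒i≡k+j {i} {j} refl = sym (i-j+j≡i i j)

-- Edges, and how a new largest bead moves them

module Evolution (t g : ℕ) (1+g≡t+t : suc g ≡ t ℕ.+ t) where

  0<g : 0 < g
  0<g = ℕ.n≢0⇒n>0 λ g≡0 → 1≢t+t t (trans (cong suc (sym g≡0)) 1+g≡t+t)
    where
    1≢t+t : ∀ t → 1 ≢ t ℕ.+ t
    1≢t+t (suc t) eq rewrite ℕ.+-suc t t with () ← eq

  -- Edge B w says that w lies in the upper half and is the first gap of its residue
  -- class modulo g.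
  Edge : List ℕ → ℤ → Set
  Edge B w = + g ℤ.< w +ᶻ w × ¬ Bead B w × Bead B (w -ᶻ + g)

  -- The bead 0 has to be excepted: for a quotient rectangle with m > 1 rows, the positions -g, ...,
  -- -(m - 1)g are gaps.
  Closed : List ℕ → Set
  Closed B = ∀ {x} → Bead B x → x ≢ 0ℤ → Bead B (x -ᶻ + g)

  -- The edges of the empty diagram. Its beads are the positions up to 0, so the first gaps are 1,
  -- ..., g, and those above g/2 are t, ..., g.
  ground : Fin t → ℤ
  ground i = + g -ᶻ + toℕ i

  -- This keeps only what symmetric sums can see. Functions invariant under w ↦ g - w do not
  -- distinguish the two choices of `a`, and sums do not depend on the order of the list.
  data Evolves : List ℕ → List ℤ → Set where
    start   : Evolves [] (tabulate ground)
    move    : ∀ {X B a R} → a ≡ + X ⊎ a ≡ + g -ᶻ + X →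
              Evolves B (a ∷ R) → Evolves (X ∷ B) (+ X +ᶻ + g ∷ R)
    permute : ∀ {B R R′} → R ↭ R′ → Evolves B R → Evolves B R′

  Evolves-length : ∀ {B R} → Evolves B R → length R ≡ t
  Evolves-length start         = List.length-tabulate ground
  Evolves-length (move _ e)    = Evolves-length e
  Evolves-length (permute p e) = trans (sym (↭-length p)) (Evolves-length e)

  upper⇒positive : ∀ {w} → + g ℤ.< w +ᶻ w → 0ℤ ℤ.< w
  upper⇒positive g<2w = ℤ.≰⇒> λ w≤0 → ℤ.<⇒≱ g<2w (ℤ.≤-trans (ℤ.+-mono-≤ w≤0 w≤0) (ℤ.+≤+ z≤n))

  i+g≢i : ∀ {i} → i +ᶻ + g ≢ i
  i+g≢i {i} eq = ℕ.<-irrefl (sym (ℤ.+-injective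
    (trans (ring i (+ g)) (trans (cong (_-ᶻ i) eq) (ℤ.+-inverseʳ i))))) 0<g
    where
    ring : ∀ i g → g ≡ i +ᶻ g -ᶻ i
    ring = solve-∀

  i-g≢i : ∀ {i} → i -ᶻ + g ≢ i
  i-g≢i {i} eq = i+g≢i {i} (sym (i-j≡k⇒i≡k+j eq))

  upper-half : ∀ {i j} → + g ℤ.< i +ᶻ i → + g ℤ.< j +ᶻ j → i +ᶻ j ≢ + g
  upper-half {i} {j} g<2i g<2j i+j≡g = ℤ.<-irrefl (sym eq) (ℤ.+-mono-< g<2i g<2j)
    where
    ring : ∀ i j → (i +ᶻ i) +ᶻ (j +ᶻ j) ≡ (i +ᶻ j) +ᶻ (i +ᶻ j)
    ring = solve-∀
    eq : (i +ᶻ i) +ᶻ (j +ᶻ j) ≡ + g +ᶻ + g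
    eq = trans (ring i j) (cong₂ _+ᶻ_ i+j≡g i+j≡g)

  -- No bead sits at g/2, the centre of the reflection w ↦ g - w, because g is odd.
  g≢double : ∀ X → X ℕ.+ X ≢ g
  g≢double X X+X≡g = parity X t (trans (cong suc X+X≡g) 1+g≡t+t)
    where
    parity : ∀ m n → suc (m ℕ.+ m) ≢ n ℕ.+ n
    parity zero    (suc n) eq rewrite ℕ.+-suc n n with () ← eq
    parity (suc m) (suc n) eq rewrite ℕ.+-suc m m | ℕ.+-suc n n =
      parity m n (ℕ.suc-injective (ℕ.suc-injective eq))

  ground-edge : ∀ i → Edge [] (ground i)
  ground-edge i = upper , (λ w≤0 → ℤ.<⇒≱ (upper⇒positive upper) w≤0)
                , subst (ℤ._≤ 0ℤ) (ring₂ (+ g) (+ toℕ i)) (ℤ.neg-mono-≤ (ℤ.+≤+ z≤n))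
    where
    ring₁ : ∀ g i → g +ᶻ (g -ᶻ (i +ᶻ i)) ≡ (g -ᶻ i) +ᶻ (g -ᶻ i)
    ring₁ = solve-∀
    ring₂ : ∀ g i → - i ≡ g -ᶻ i -ᶻ g
    ring₂ = solve-∀
    2i<g : toℕ i ℕ.+ toℕ i < g
    2i<g = ℕ.s≤s⁻¹ (ℕ.≤-trans (ℕ.≤-reflexive (sym (cong suc (ℕ.+-suc _ _))))
      (subst (suc (toℕ i) ℕ.+ suc (toℕ i) ≤_) (sym 1+g≡t+t) (ℕ.+-mono-≤ (Fin.toℕ<n i) (Fin.toℕ<n i))))
    upper : + g ℤ.< ground i +ᶻ ground i
    upper = subst₂ ℤ._<_
      (trans (cong (+ g +ᶻ_) (ℤ.+-inverseʳ (+ (toℕ i ℕ.+ toℕ i)))) (ℤ.+-identityʳ (+ g)))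
      (ring₁ (+ g) (+ toℕ i))
      (ℤ.+-monoʳ-< (+ g) (ℤ.+-monoˡ-< (- (+ (toℕ i ℕ.+ toℕ i))) (ℤ.+<+ 2i<g)))

  edge-ground : ∀ {w} → Edge [] w → w ∈ tabulate ground
  edge-ground {w} (g<2w , _ , w-g≤0) = subst (_∈ tabulate ground) ground≡w (∈-tabulate⁺ (fromℕ< k<t))
    where
    k = ∣ + g -ᶻ w ∣
    +k≡g-w : + k ≡ + g -ᶻ w
    +k≡g-w = ℤ.0≤i⇒+∣i∣≡i (subst (0ℤ ℤ.≤_) (ring (+ g) w) (ℤ.neg-mono-≤ w-g≤0))
      where
      ring : ∀ g w → - (w -ᶻ g) ≡ g -ᶻ w
      ring = solve-∀
    w≡g-k : + g -ᶻ + k ≡ w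
    w≡g-k = trans (cong (+ g -ᶻ_) +k≡g-w) (ring (+ g) w)
      where
      ring : ∀ g w → g -ᶻ (g -ᶻ w) ≡ w
      ring = solve-∀
    2k<g : k ℕ.+ k < g
    2k<g = ℤ.drop‿+<+ (subst₂ ℤ._<_
      (ring₁ (+ g) (+ k)) (trans (cong (λ w → w +ᶻ w +ᶻ (+ k +ᶻ + k -ᶻ + g)) (sym w≡g-k)) (ring₂ (+ g) (+ k)))
      (ℤ.+-monoˡ-< (+ k +ᶻ + k -ᶻ + g) g<2w))
      where
      ring₁ : ∀ g k → g +ᶻ (k +ᶻ k -ᶻ g) ≡ k +ᶻ k
      ring₁ = solve-∀
      ring₂ : ∀ g k → (g -ᶻ k) +ᶻ (g -ᶻ k) +ᶻ (k +ᶻ k -ᶻ g) ≡ g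
      ring₂ = solve-∀
    k<t : k < t
    k<t = ℕ.≰⇒> λ t≤k → ℕ.<⇒≱ 2k<g (ℕ.≤-trans (ℕ.n≤1+n g)
      (subst (_≤ k ℕ.+ k) (sym 1+g≡t+t) (ℕ.+-mono-≤ t≤k t≤k)))
    ground≡w : ground (fromℕ< k<t) ≡ w
    ground≡w = trans (cong (λ n → + g -ᶻ + n) (Fin.toℕ-fromℕ< k<t)) w≡g-k

  ground-unique : Unique (tabulate ground)
  ground-unique = Unique.tabulate⁺ λ eq → Fin.toℕ-injective
    (ℤ.+-injective (ℤ.neg-injective (∙-cancelˡ (+ g) _ _ eq)))

  record Edges (B : List ℕ) (R : List ℤ) : Set where
    field
      unique   : Unique R
      sound    : ∀ {w} → w ∈ R → Edge B w
      complete : ∀ {w} → Edge B w → w ∈ R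

  module _ {X B} (0<X : 0 < X) (B<X : All (_< X) B) (closed : Closed (X ∷ B)) where

    -- This permits induction over the beads in increasing order. The step from x to x - g could
    -- only break at the two positions where `B` and `X ∷ B` differ: -X has only beads of B below
    -- it, and X is above every bead of B.
    closed-tail : Closed B
    closed-tail {x} b x≢0 with x ℤ.≟ - + X
    ... | yes refl = bead-low B<X (ℤ.i-j≤i (- + X) (+ g))
    ... | no x≢-X with closed (inj₂ b , x≢-X) x≢0
    ...   | inj₂ b′ , _ = b′
    ...   | inj₁ x-g≡X , _ = contradiction (bead-< 0<X B<X b)
      (ℤ.≤⇒≯ (subst (+ X ℤ.≤_) (sym (i-j≡k⇒i≡k+j x-g≡X)) (ℤ.i≤i+j (+ X) (+ g))))

    bead-X : Bead (X ∷ B) (+ X)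
    bead-X = inj₁ refl , +≢- 0<X

    bead-X-g : Bead B (+ X -ᶻ + g)
    bead-X-g with closed bead-X (λ eq → ℕ.<-irrefl (sym (ℤ.+-injective eq)) 0<X)
    ... | inj₂ b , _ = b
    ... | inj₁ eq , _ = contradiction eq i-g≢i

    -- Before X enters, -X is a bead because all of B is below X, and X - g is one by closedness. So
    -- X and g - X both have a bead at distance g below, and one of them lies in the upper half. X
    -- is a gap by size; g - X is a gap because its mirror image X - g is a bead other than 0.
    moved : ∃[ a ] (a ≡ + X ⊎ a ≡ + g -ᶻ + X) × Edge B a
    moved with ℕ.<-cmp (X ℕ.+ X) g
    ... | tri≈ _ 2X≡g _ = contradiction 2X≡g (g≢double X)
    ... | tri> _ _ g<2X = + X , inj₁ refl , ℤ.+<+ g<2X , (λ b → ℤ.<-irrefl refl (bead-< 0<X B<X b)) , bead-X-g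
    ... | tri< 2X<g _ _ = + g -ᶻ + X , inj₂ refl
        , subst₂ ℤ._<_ (ring₁ (+ X) (+ g)) (ring₂ (+ X) (+ g)) (ℤ.+-monoˡ-< (+ g -ᶻ + X -ᶻ + X) (ℤ.+<+ 2X<g))
        , (λ b → ℕ.<⇒≢ 2X<g (2X≡g (bead-antisym B bead-X-g (subst (Bead B) (ring₃ (+ X) (+ g)) b))))
        , subst (Bead B) (ring₄ (+ X) (+ g)) (bead-low B<X ℤ.≤-refl)
      where
      ring₁ : ∀ x g → x +ᶻ x +ᶻ (g -ᶻ x -ᶻ x) ≡ g
      ring₁ = solve-∀
      ring₂ : ∀ x g → g +ᶻ (g -ᶻ x -ᶻ x) ≡ (g -ᶻ x) +ᶻ (g -ᶻ x)
      ring₂ = solve-∀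
      ring₃ : ∀ x g → g -ᶻ x ≡ - (x -ᶻ g)
      ring₃ = solve-∀
      ring₄ : ∀ x g → - x ≡ g -ᶻ x -ᶻ g
      ring₄ = solve-∀
      2X≡g : + X -ᶻ + g ≡ 0ℤ → X ℕ.+ X ≡ g
      2X≡g eq with refl ← ℤ.+-injective (ℤ.i-j≡0⇒i≡j (+ X) (+ g) eq) = contradiction 2X<g
        (ℕ.≤⇒≯ (ℕ.m≤m+n X X))

    unmoved : ∀ {a w} → a ≡ + X ⊎ a ≡ + g -ᶻ + X → + g ℤ.< a +ᶻ a → + g ℤ.< w +ᶻ w → w ≢ a →
      w ≢ + X × w ≢ + g -ᶻ + X
    unmoved (inj₁ refl) g<2a g<2w w≢a = w≢a , λ { refl → upper-half {+ g -ᶻ + X} {+ X} g<2w g<2a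
      (i-j+j≡i (+ g) (+ X)) }
    unmoved (inj₂ refl) g<2a g<2w w≢a = (λ { refl → upper-half {+ g -ᶻ + X} {+ X} g<2a g<2w
      (i-j+j≡i (+ g) (+ X)) }) , w≢a

    -- In both cases `a` ceases to be an edge: either it is X and gets filled, or it is g - X and
    -- loses the bead -X below it.
    vacated : ∀ {a} → a ≡ + X ⊎ a ≡ + g -ᶻ + X → ¬ Bead (X ∷ B) a → a -ᶻ + g ≡ - + X
    vacated (inj₁ refl) ¬b = contradiction bead-X ¬b
    vacated (inj₂ refl) _  = ring (+ X) (+ g)
      where
      ring : ∀ x g → g -ᶻ x -ᶻ g ≡ - x
      ring = solve-∀

    module _ {a R} (a≡ : a ≡ + X ⊎ a ≡ + g -ᶻ + X) (edges : Edges B (a ∷ R)) where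
      open Edges edges

      edges-move : Edges (X ∷ B) (+ X +ᶻ + g ∷ R)
      edges-move = record { unique = unique′ unique ; sound = sound′ unique ; complete = complete′ }
        where
        R<X+g : ∀ {w} → w ∈ R → w ≢ + X +ᶻ + g
        R<X+g w∈R refl = ℤ.<-irrefl refl (bead-< 0<X B<X
          (subst (Bead B) (i+j-j≡i (+ X) (+ g)) (proj₂ (proj₂ (sound (there w∈R))))))
        unique′ : Unique (a ∷ R) → Unique (+ X +ᶻ + g ∷ R)
        unique′ (_ ∷ u) = All.tabulate (λ w∈R eq → R<X+g w∈R (sym eq)) ∷ u
        sound′ : Unique (a ∷ R) → ∀ {w} → w ∈ + X +ᶻ + g ∷ R → Edge (X ∷ B) w
        sound′ _ (here refl) =
            ℤ.+<+ (ℕ.<-≤-trans (ℕ.m<n+m g 0<X) (ℕ.m≤m+n _ _))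
          , (λ { (inj₁ eq , _) → i+g≢i eq
               ; (inj₂ b , _) → ℤ.<⇒≱ (bead-< 0<X B<X b) (ℤ.i≤i+j (+ X) (+ g)) })
          , subst (Bead (X ∷ B)) (sym (i+j-j≡i (+ X) (+ g))) bead-X
        sound′ (a∉R ∷ _) {w} (there w∈R) with sound (there w∈R)
        ... | edge@(g<2w , ¬b , b) with unmoved a≡ (proj₁ (sound (here refl))) g<2w
          (λ w≡a → All.lookup a∉R w∈R (sym w≡a))
        ...   | w≢X , w≢g-X = g<2w , (λ { (inj₁ w≡X , _) → w≢X w≡X ; (inj₂ b′ , _) → ¬b b′ })
                , inj₂ b , λ eq → w≢g-X (trans (i-j≡k⇒i≡k+j eq) (ℤ.+-comm (- + X) (+ g)))
        complete′ : ∀ {w} → Edge (X ∷ B) w → w ∈ + X +ᶻ + g ∷ R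
        complete′ (_ , _ , inj₁ eq , _) = here (i-j≡k⇒i≡k+j eq)
        -- X turns only -X into a new gap, and w is positive, so w was already a gap of B.
        complete′ {w} (g<2w , ¬b , inj₂ b , w-g≢-X)
          with complete {w} (g<2w , (λ b′ → ¬b
            (inj₂ b′ , λ { refl → ℤ.<⇒≱ (upper⇒positive g<2w) (ℤ.neg-mono-≤ (ℤ.+≤+ (z≤n {X}))) })) , b)
        ... | there w∈R = there w∈R
        ... | here refl = contradiction (vacated a≡ ¬b) w-g≢-X

  Edges-↭ : ∀ {B R R′} → R ↭ R′ → Edges B R → Edges B R′
  Edges-↭ p edges = record
    { unique   = Permutation.Unique-resp-↭ (≡.setoid ℤ) (↭.↭⇒↭ₛ p) unique
    ; sound    = λ w∈R′ → sound (∈-resp-↭ (↭.↭-sym p) w∈R′)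
    ; complete = λ edge → ∈-resp-↭ p (complete edge)
    }
    where open Edges edges

  evolution : ∀ {B} → Descending B → Closed B → ∃[ R ] Evolves B R × Edges B R
  evolution [] closed = tabulate ground , start , record
    { unique   = ground-unique
    ; sound    = λ w∈R → let i , w≡ = ∈-tabulate⁻ w∈R in subst (Edge []) (sym w≡) (ground-edge i)
    ; complete = edge-ground
    }
  evolution {X ∷ B} ((0<X , B<X) ∷ desc) closed
    with R , evolves , edges ← evolution desc (closed-tail 0<X B<X closed)
       | a , a≡ , edge ← moved 0<X B<X closed
    with us , vs , refl ← ∈-∃++ (Edges.complete edges edge)
    = + X +ᶻ + g ∷ us ++ vs
    , move a≡ (permute (shift a us vs) evolves)
    , edges-move 0<X B<X closed a≡ (Edges-↭ (shift a us vs) edges)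

-- Sums over the edges, and over pairs of edges

module EdgeSums {a ℓ} (G : AbelianGroup a ℓ) (t g : ℕ) (1+g≡t+t : suc g ≡ t ℕ.+ t) where
  open Sums G
  open ShapeSums G
  open Evolution t g 1+g≡t+t
  open SetoidReasoning setoid

  sum-tabulate : ∀ n (F : ℕ → ℤ) (f : ℤ → Carrier) →
    sum (tabulate {n = n} λ i → F (toℕ i)) f ≈ (∑[ i < n ] f (F i))
  sum-tabulate zero    F f = ≈-refl
  sum-tabulate (suc n) F f =
    ≈-trans (⊕-congˡ (sum-tabulate n (λ i → F (suc i)) f)) (≈-sym (sum<-suc n (λ i → f (F i))))

  evolveSum : ∀ {B R} (f : ℤ → Carrier) → (∀ w → f (+ g -ᶻ w) ≈ f w) → Evolves B R →
    sum R f ≈ sum (tabulate ground) f ⊕ (∑[ X ∈ B ] (f (+ X +ᶻ + g) ⊖ f (+ X)))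
  evolveSum f f-sym start = ≈-sym (⊕-identityʳ _)
  evolveSum {X ∷ B} {_ ∷ R} f f-sym (move {a = a} a≡ e) = begin
    f (+ X +ᶻ + g) ⊕ sum R f
      ≈⟨ solve 3 (λ x y z → x :+ z ⊜ x :- y :+ (y :+ z)) ≈-refl (f (+ X +ᶻ + g)) (f (+ X)) (sum R f) ⟩
    f (+ X +ᶻ + g) ⊖ f (+ X) ⊕ (f (+ X) ⊕ sum R f)
      ≈⟨ ⊕-congˡ (≈-trans (⊕-congʳ (≈-sym (f-a a≡))) (evolveSum f f-sym e)) ⟩
    f (+ X +ᶻ + g) ⊖ f (+ X) ⊕ (sum (tabulate ground) f ⊕ (∑[ Y ∈ B ] (f (+ Y +ᶻ + g) ⊖ f (+ Y))))
      ≈⟨ solve 3 (λ x y z → x :+ (y :+ z) ⊜ y :+ (x :+ z)) ≈-refl _ _ _ ⟩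
    sum (tabulate ground) f ⊕ (∑[ Y ∈ X ∷ B ] (f (+ Y +ᶻ + g) ⊖ f (+ Y))) ∎
    where
    f-a : a ≡ + X ⊎ a ≡ + g -ᶻ + X → f a ≈ f (+ X)
    f-a (inj₁ refl) = ≈-refl
    f-a (inj₂ refl) = f-sym (+ X)
  evolveSum f f-sym (permute p e) = ≈-trans (≈-sym (sum-↭ f p)) (evolveSum f f-sym e)

  module _ (T : ℤ → Carrier) (T-even : ∀ z → T (- z) ≈ T z) where

    -- In the coordinates w = r + g/2, the difference r - r′ is `a -ᶻ b` and the sum r + r′ is
    -- `a +ᶻ b -ᶻ + g`. Evenness in r becomes invariance under a ↦ g - a.
    K : ℤ → ℤ → Carrier
    K a b = T (a -ᶻ b) ⊕ T (a +ᶻ b -ᶻ + g)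

    -- The factor of a box in the product with T for τ: T(h - εg)/T(h), written additively.
    φ : Bool → ℤ → Carrier
    φ below h = T (if below then h +ᶻ + g else h -ᶻ + g) ⊖ T h
      where open import Data.Bool.Base using (if_then_else_)

    K-sym : ∀ a b → K a b ≈ K b a
    K-sym a b = ⊕-cong (≈-trans (≈-sym (T-even _)) (resp T (ring₁ a b))) (resp T (ring₂ a b (+ g)))
      where
      ring₁ : ∀ a b → - (a -ᶻ b) ≡ b -ᶻ a
      ring₁ = solve-∀
      ring₂ : ∀ a b g → a +ᶻ b -ᶻ g ≡ b +ᶻ a -ᶻ g
      ring₂ = solve-∀

    K-reflectʳ : ∀ a b → K a (+ g -ᶻ b) ≈ K a b
    K-reflectʳ a b = ≈-trans (⊕-comm _ _) (⊕-cong (resp T (ring₁ a b (+ g))) (resp T (ring₂ a b (+ g))))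
      where
      ring₁ : ∀ a b g → a +ᶻ (g -ᶻ b) -ᶻ g ≡ a -ᶻ b
      ring₁ = solve-∀
      ring₂ : ∀ a b g → a -ᶻ (g -ᶻ b) ≡ a +ᶻ b -ᶻ g
      ring₂ = solve-∀

    K-reflectˡ : ∀ a b → K (+ g -ᶻ a) b ≈ K a b
    K-reflectˡ a b = ≈-trans (K-sym _ b) (≈-trans (K-reflectʳ b a) (K-sym b a))

    window : ℤ → Carrier
    window y = ∑[ m < suc g ] T (y +ᶻ + m)

    window-suc : ∀ y → window (1ℤ +ᶻ y) ≈ window y ⊕ (T (y +ᶻ + suc g) ⊖ T y)
    window-suc y = begin
      (∑[ m < suc g ] T (1ℤ +ᶻ y +ᶻ + m))
        ≈⟨ sum<-cong (suc g) (λ {m} _ → resp T (ring y (+ m))) ⟩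
      (∑[ m < suc g ] T (y +ᶻ + suc m))
        ≈⟨ solve 2 (λ a b → b ⊜ a :+ b :- a) ≈-refl (T y) _ ⟩
      T y ⊕ (∑[ m < suc g ] T (y +ᶻ + suc m)) ⊖ T y
        ≈⟨ ⊖-cong (≈-trans (⊕-congʳ (resp T (sym (ℤ.+-identityʳ y)))) (≈-sym (sum<-suc (suc g) _))) ≈-refl ⟩
      window y ⊕ T (y +ᶻ + suc g) ⊖ T y
        ≈⟨ ⊕-assoc _ _ _ ⟩
      window y ⊕ (T (y +ᶻ + suc g) ⊖ T y) ∎
      where
      ring : ∀ y m → 1ℤ +ᶻ y +ᶻ m ≡ y +ᶻ (1ℤ +ᶻ m)
      ring = solve-∀

    window-g : window (- + g) ≈ window 0ℤ
    window-g = begin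
      (∑[ m < suc g ] T (- + g +ᶻ + m))
        ≈⟨ sum<-cong (suc g) (λ {m} _ → ≈-trans (≈-sym (T-even _)) (resp T (ring₁ (+ g) (+ m)))) ⟩
      (∑[ m < suc g ] T (+ suc g -ᶻ + m -ᶻ 1ℤ))
        ≈⟨ sum<-reverse (suc g) (λ z → T (z -ᶻ 1ℤ)) ⟩
      (∑[ m < suc g ] T (+ suc m -ᶻ 1ℤ))
        ≈⟨ sum<-cong (suc g) (λ {m} _ → resp T (ring₂ (+ m))) ⟩
      window 0ℤ ∎
      where
      ring₁ : ∀ g m → - (- g +ᶻ m) ≡ 1ℤ +ᶻ g -ᶻ m -ᶻ 1ℤ
      ring₁ = solve-∀
      ring₂ : ∀ m → 1ℤ +ᶻ m -ᶻ 1ℤ ≡ 0ℤ +ᶻ m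
      ring₂ = solve-∀

    -- At `b = + g -ᶻ + i` the two terms of the kernel are T(y + i) and T(y + g - i). For i < t they
    -- fill the interval from y to y + g, which has 2t elements.
    window-K : ∀ y → (∑[ w ∈ tabulate ground ] K (y +ᶻ + g) w) ≈ window y
    window-K y = begin
      (∑[ w ∈ tabulate ground ] K (y +ᶻ + g) w)
        ≈⟨ sum-tabulate t (λ i → + g -ᶻ + i) (K (y +ᶻ + g)) ⟩
      (∑[ i < t ] K (y +ᶻ + g) (+ g -ᶻ + i))
        ≈⟨ sum<-cong t (λ {i} _ → ⊕-cong (resp T (ring₁ y (+ i) (+ g)))
             (resp T (trans (ring₂ y (+ i) (+ g)) (cong (λ s → y +ᶻ (s -ᶻ 1ℤ -ᶻ + i)) (cong +_ 1+g≡t+t))))) ⟩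
      (∑[ i < t ] (T (y +ᶻ + i) ⊕ T (y +ᶻ (+ (t ℕ.+ t) -ᶻ 1ℤ -ᶻ + i))))
        ≈⟨ sum<-⊕ t _ _ ⟩
      (∑[ i < t ] T (y +ᶻ + i)) ⊕ (∑[ i < t ] T (y +ᶻ (+ (t ℕ.+ t) -ᶻ 1ℤ -ᶻ + i)))
        ≈⟨ ⊕-congˡ (sum<-cong t (λ {i} _ → resp T (ring₃ y (+ t) (+ i)))) ⟩
      (∑[ i < t ] T (y +ᶻ + i)) ⊕ (∑[ i < t ] T (y +ᶻ + t -ᶻ 1ℤ +ᶻ (+ t -ᶻ + i)))
        ≈⟨ ⊕-congˡ (sum<-reverse t (λ z → T (y +ᶻ + t -ᶻ 1ℤ +ᶻ z))) ⟩
      (∑[ i < t ] T (y +ᶻ + i)) ⊕ (∑[ i < t ] T (y +ᶻ + t -ᶻ 1ℤ +ᶻ + suc i))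
        ≈⟨ ⊕-congˡ (sum<-cong t (λ {i} _ → resp T (ring₄ y (+ t) (+ i)))) ⟩
      (∑[ i < t ] T (y +ᶻ + i)) ⊕ (∑[ i < t ] T (y +ᶻ + (t ℕ.+ i)))
        ≈⟨ sum<-+ t t (λ m → T (y +ᶻ + m)) ⟨
      (∑[ m < t ℕ.+ t ] T (y +ᶻ + m))
        ≈⟨ reflexive (cong (λ n → ∑[ m < n ] T (y +ᶻ + m)) 1+g≡t+t) ⟨
      window y ∎
      where
      ring₁ : ∀ y i g → y +ᶻ g -ᶻ (g -ᶻ i) ≡ y +ᶻ i
      ring₁ = solve-∀
      ring₂ : ∀ y i g → y +ᶻ g +ᶻ (g -ᶻ i) -ᶻ g ≡ y +ᶻ (1ℤ +ᶻ g -ᶻ 1ℤ -ᶻ i)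
      ring₂ = solve-∀
      ring₃ : ∀ y t i → y +ᶻ (t +ᶻ t -ᶻ 1ℤ -ᶻ i) ≡ y +ᶻ t -ᶻ 1ℤ +ᶻ (t -ᶻ i)
      ring₃ = solve-∀
      ring₄ : ∀ y t i → y +ᶻ t -ᶻ 1ℤ +ᶻ (1ℤ +ᶻ i) ≡ y +ᶻ (t +ᶻ i)
      ring₄ = solve-∀

    -- At X = 0 the two windows are mirror images. Moving both by one step changes the difference by
    -- four boundary terms, which regroup as `φ false (+ X)` and `φ true (+ suc X)`.
    window-difference : ∀ X → window (+ X) ⊖ window (+ X -ᶻ + g)
      ≈ (∑[ n < X ] φ false (+ n)) ⊕ (∑[ n < X ] φ true (+ suc n))
    window-difference zero = begin
      window 0ℤ ⊖ window (0ℤ -ᶻ + g)  ≈⟨ ⊖-cong ≈-refl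
        (≈-trans (resp window (ℤ.+-identityˡ (- + g))) window-g) ⟩
      window 0ℤ ⊖ window 0ℤ           ≈⟨ solve 1 (λ a → a :- a ⊜ `0 :+ `0) ≈-refl _ ⟩
      𝟘 ⊕ 𝟘                           ∎
    window-difference (suc X) = begin
      window (1ℤ +ᶻ + X) ⊖ window (1ℤ +ᶻ + X -ᶻ + g)
        ≈⟨ ⊖-cong (window-suc (+ X)) (≈-trans (resp window (ring₁ (+ X) (+ g))) (window-suc (+ X -ᶻ + g))) ⟩
      window (+ X) ⊕ (T (+ X +ᶻ + suc g) ⊖ T (+ X))
        ⊖ (window (+ X -ᶻ + g) ⊕ (T (+ X -ᶻ + g +ᶻ + suc g) ⊖ T (+ X -ᶻ + g)))
        ≈⟨ ⊖-cong (⊕-congˡ (⊖-cong (resp T (ring₂ (+ X) (+ g))) ≈-refl))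
          (⊕-congˡ (⊖-cong (resp T (ring₃ (+ X) (+ g))) ≈-refl)) ⟩
      window (+ X) ⊕ (T (+ suc X +ᶻ + g) ⊖ T (+ X))
        ⊖ (window (+ X -ᶻ + g) ⊕ (T (+ suc X) ⊖ T (+ X -ᶻ + g)))
        ≈⟨ solve 6 (λ w w′ a b c d → w :+ (a :- b) :- (w′ :+ (c :- d)) ⊜ w :- w′ :+
          ((d :- b) :+ (a :- c))) ≈-refl _ _ _ _ _ _ ⟩
      window (+ X) ⊖ window (+ X -ᶻ + g) ⊕ (φ false (+ X) ⊕ φ true (+ suc X))
        ≈⟨ ⊕-congʳ (window-difference X) ⟩
      (∑[ n < X ] φ false (+ n)) ⊕ (∑[ n < X ] φ true (+ suc n)) ⊕ (φ false (+ X) ⊕ φ true (+ suc X))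
        ≈⟨ solve 4 (λ a b c d → a :+ b :+ (c :+ d) ⊜ (a :+ c) :+ (b :+ d)) ≈-refl _ _ _ _ ⟩
      (∑[ n < suc X ] φ false (+ n)) ⊕ (∑[ n < suc X ] φ true (+ suc n)) ∎
      where
      ring₁ : ∀ x g → 1ℤ +ᶻ x -ᶻ g ≡ 1ℤ +ᶻ (x -ᶻ g)
      ring₁ = solve-∀
      ring₂ : ∀ x g → x +ᶻ (1ℤ +ᶻ g) ≡ 1ℤ +ᶻ x +ᶻ g
      ring₂ = solve-∀
      ring₃ : ∀ x g → x -ᶻ g +ᶻ (1ℤ +ᶻ g) ≡ 1ℤ +ᶻ x
      ring₃ = solve-∀

    -- The change of the kernel when an element X, or g - X, is replaced by X + g.
    ΔK : ℕ → ℤ → Carrier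
    ΔK X b = K (+ X +ᶻ + g) b ⊖ K (+ X) b

    -- The difference of windows contains φ(0) = T(g) - T(0), where the first row has the corner
    -- term φ(2X) = T(2X - g) - T(2X). The self-interaction `ΔK X (+ X)` is their difference.
    ΔK-ground : ∀ {X} → 0 < X → sum (tabulate ground) (ΔK X)
      ≈ ΔK X (+ X) ⊕ ((∑[ n < pred X ] φ false (+ suc n)) ⊕ φ false (+ X +ᶻ + X) ⊕
        (∑[ n < X ] φ true (+ suc n)))
    ΔK-ground {X@(suc x)} _ = begin
      sum (tabulate ground) (ΔK X)
        ≈⟨ sum-⊖ (tabulate ground) _ _ ⟩
      sum (tabulate ground) (K (+ X +ᶻ + g)) ⊖ sum (tabulate ground) (K (+ X))
        ≈⟨ ⊖-cong (window-K (+ X)) (≈-trans (reflexive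
          (cong (λ z → sum (tabulate ground) (K z)) (sym (i-j+j≡i (+ X) (+ g))))) (window-K (+ X -ᶻ + g))) ⟩
      window (+ X) ⊖ window (+ X -ᶻ + g)
        ≈⟨ window-difference X ⟩
      (∑[ n < X ] φ false (+ n)) ⊕ (∑[ n < X ] φ true (+ suc n))
        ≈⟨ ⊕-congʳ (≈-trans (sum<-suc x _) (⊕-congʳ φ-0)) ⟩
      T (+ g) ⊖ T 0ℤ ⊕ (∑[ n < x ] φ false (+ suc n)) ⊕ (∑[ n < X ] φ true (+ suc n))
        ≈⟨ solve 6 (λ a b c d e f → a :- b :+ c :+ d ⊜ (a :+ e) :- (b :+ f) :+ (c :+ (f :- e) :+ d)) ≈-refl
             (T (+ g)) (T 0ℤ) _ _ (T (+ X +ᶻ + X)) (T (+ X +ᶻ + X -ᶻ + g)) ⟩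
      (T (+ g) ⊕ T (+ X +ᶻ + X)) ⊖ (T 0ℤ ⊕ T (+ X +ᶻ + X -ᶻ + g))
        ⊕ ((∑[ n < x ] φ false (+ suc n)) ⊕ φ false (+ X +ᶻ + X) ⊕ (∑[ n < X ] φ true (+ suc n)))
        ≈⟨ ⊕-congʳ (⊖-cong (⊕-cong (resp T (ring₁ (+ X) (+ g))) (resp T (ring₂ (+ X) (+ g))))
          (⊕-congʳ (resp T (sym (ℤ.+-inverseʳ (+ X)))))) ⟩
      ΔK X (+ X) ⊕ ((∑[ n < x ] φ false (+ suc n)) ⊕ φ false (+ X +ᶻ + X) ⊕ (∑[ n < X ] φ true (+ suc n))) ∎
      where
      φ-0 : φ false 0ℤ ≈ T (+ g) ⊖ T 0ℤ
      φ-0 = ⊖-cong (≈-trans (resp T (ℤ.+-identityˡ (- + g))) (T-even (+ g))) ≈-refl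
      ring₁ : ∀ x g → g ≡ x +ᶻ g -ᶻ x
      ring₁ = solve-∀
      ring₂ : ∀ x g → x +ᶻ x ≡ x +ᶻ g +ᶻ x -ᶻ g
      ring₂ = solve-∀

    ΔK-step : ∀ X Y → ΔK X (+ Y +ᶻ + g) ⊖ ΔK X (+ Y)
      ≈ (φ true (+ X +ᶻ + Y) ⊖ φ true (+ X -ᶻ + Y)) ⊖ (φ false (+ X -ᶻ + Y) ⊖ φ false (+ X +ᶻ + Y))
    ΔK-step X Y = begin
      ΔK X (+ Y +ᶻ + g) ⊖ ΔK X (+ Y)
        ≈⟨ ⊖-cong (⊖-cong (⊕-cong (resp T (ring₁ (+ X) (+ Y) (+ g))) (resp T (ring₂ (+ X) (+ Y) (+ g))))
                          (⊕-cong (resp T (ring₃ (+ X) (+ Y) (+ g))) (resp T (ring₄ (+ X) (+ Y) (+ g)))))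
                  (⊖-cong (⊕-cong (resp T (ring₅ (+ X) (+ Y) (+ g))) (resp T (ring₆ (+ X) (+ Y) (+ g))))
                    ≈-refl) ⟩
      (T (+ X -ᶻ + Y) ⊕ T (+ X +ᶻ + Y +ᶻ + g)) ⊖ (T (+ X -ᶻ + Y -ᶻ + g) ⊕ T (+ X +ᶻ + Y))
        ⊖ ((T (+ X -ᶻ + Y +ᶻ + g) ⊕ T (+ X +ᶻ + Y)) ⊖ (T (+ X -ᶻ + Y) ⊕ T (+ X +ᶻ + Y -ᶻ + g)))
        ≈⟨ solve 6 (λ a b c d e f → (a :+ b) :- (c :+ d) :- ((e :+ d) :- (a :+ f))
             ⊜ ((b :- d) :- (e :- a)) :- ((c :- a) :- (f :- d))) ≈-refl _ _ _ _ _ _ ⟩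
      (φ true (+ X +ᶻ + Y) ⊖ φ true (+ X -ᶻ + Y)) ⊖ (φ false (+ X -ᶻ + Y) ⊖ φ false (+ X +ᶻ + Y)) ∎
      where
      ring₁ : ∀ x y g → x +ᶻ g -ᶻ (y +ᶻ g) ≡ x -ᶻ y
      ring₁ = solve-∀
      ring₂ : ∀ x y g → x +ᶻ g +ᶻ (y +ᶻ g) -ᶻ g ≡ x +ᶻ y +ᶻ g
      ring₂ = solve-∀
      ring₃ : ∀ x y g → x -ᶻ (y +ᶻ g) ≡ x -ᶻ y -ᶻ g
      ring₃ = solve-∀
      ring₄ : ∀ x y g → x +ᶻ (y +ᶻ g) -ᶻ g ≡ x +ᶻ y
      ring₄ = solve-∀
      ring₅ : ∀ x y g → x +ᶻ g -ᶻ y ≡ x -ᶻ y +ᶻ g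
      ring₅ = solve-∀
      ring₆ : ∀ x y g → x +ᶻ g +ᶻ y -ᶻ g ≡ x +ᶻ y
      ring₆ = solve-∀

    pairSum-evolve : ∀ {B R} → Descending B → Evolves B R →
      pairSum K R ≈ pairSum K (tabulate ground) ⊕ hooksSum φ B
    pairSum-evolve desc start = ≈-sym (⊕-identityʳ _)
    pairSum-evolve desc (permute p e) = ≈-trans (≈-sym (pairSum-↭ K-sym p)) (pairSum-evolve desc e)
    pairSum-evolve {X ∷ B} {_ ∷ R} ((0<X , _) ∷ desc) (move {a = a} a≡ e) = begin
      sum R (K (+ X +ᶻ + g)) ⊕ pairSum K R
        -- The self-interaction is added in order to sum `ΔK X` over all of `a ∷ R`, where
        -- `evolveSum` applies. It reappears in `ΔK-ground` and cancels.
        ≈⟨ solve 4 (λ x y p f → x :+ p ⊜ f :+ (x :- y) :- f :+ (y :+ p)) ≈-refl _ (sum R (K a)) _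
          (ΔK X (+ X)) ⟩
      ΔK X (+ X) ⊕ (sum R (K (+ X +ᶻ + g)) ⊖ sum R (K a)) ⊖ ΔK X (+ X) ⊕ pairSum K (a ∷ R)
        ≈⟨ ⊕-cong (⊖-cong change ≈-refl) (pairSum-evolve desc e) ⟩
      (ΔK X (+ X) ⊕ ((∑[ n < pred X ] φ false (+ suc n)) ⊕ φ false (+ X +ᶻ + X) ⊕
        (∑[ n < X ] φ true (+ suc n))))
        ⊕ ((∑[ Y ∈ B ] (φ true (+ X +ᶻ + Y) ⊖ φ true (+ X -ᶻ + Y))) ⊖
          (∑[ Y ∈ B ] (φ false (+ X -ᶻ + Y) ⊖ φ false (+ X +ᶻ + Y))))
        ⊖ ΔK X (+ X) ⊕ (pairSum K (tabulate ground) ⊕ hooksSum φ B)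
        ≈⟨ solve 8 (λ d r₁ r₂ c y z p h →
               (d :+ (r₁ :+ r₂ :+ c)) :+ (y :- z) :- d :+ (p :+ h) ⊜ p :+ ((r₁ :+ r₂ :- z) :+ (c :+ y) :+ h))
             ≈-refl _ _ _ _ _ _ _ _ ⟩
      pairSum K (tabulate ground) ⊕ hooksSum φ (X ∷ B) ∎
      where
      K-a : ∀ {a} → a ≡ + X ⊎ a ≡ + g -ᶻ + X → ∀ b → K a b ≈ K (+ X) b
      K-a (inj₁ refl) b = ≈-refl
      K-a (inj₂ refl) b = K-reflectˡ (+ X) b
      ΔK-a : ΔK X a ≈ ΔK X (+ X)
      ΔK-a = ⊖-cong (K-aʳ (+ X +ᶻ + g)) (K-aʳ (+ X))
        where
        K-aʳ : ∀ b → K b a ≈ K b (+ X)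
        K-aʳ b = ≈-trans (K-sym b a) (≈-trans (K-a a≡ b) (K-sym (+ X) b))
      change : ΔK X (+ X) ⊕ (sum R (K (+ X +ᶻ + g)) ⊖ sum R (K a))
        ≈ (ΔK X (+ X) ⊕ ((∑[ n < pred X ] φ false (+ suc n)) ⊕ φ false (+ X +ᶻ + X) ⊕
          (∑[ n < X ] φ true (+ suc n))))
          ⊕ ((∑[ Y ∈ B ] (φ true (+ X +ᶻ + Y) ⊖ φ true (+ X -ᶻ + Y))) ⊖
            (∑[ Y ∈ B ] (φ false (+ X -ᶻ + Y) ⊖ φ false (+ X +ᶻ + Y))))
      change = begin
        ΔK X (+ X) ⊕ (sum R (K (+ X +ᶻ + g)) ⊖ sum R (K a))
          ≈⟨ ⊕-cong (≈-sym ΔK-a) (≈-trans (⊖-cong ≈-refl (sum-cong R (K-a a≡))) (≈-sym (sum-⊖ R _ _))) ⟩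
        sum (a ∷ R) (ΔK X)
          ≈⟨ evolveSum (ΔK X) (λ w → ⊖-cong (K-reflectʳ (+ X +ᶻ + g) w) (K-reflectʳ (+ X) w)) e ⟩
        sum (tabulate ground) (ΔK X) ⊕ (∑[ Y ∈ B ] (ΔK X (+ Y +ᶻ + g) ⊖ ΔK X (+ Y)))
          ≈⟨ ⊕-cong (ΔK-ground 0<X) (≈-trans (sum-cong B (ΔK-step X)) (sum-⊖ B _ _)) ⟩
        _ ∎

-- From partitions in DD′ to nested hooks

lookup₀-≤ : ∀ {x xs} → Linked _≥_ (x ∷ xs) → ∀ i → lookup₀ (x ∷ xs) i ≤ x
lookup₀-≤ _          zero    = ℕ.≤-refl
lookup₀-≤ [-]        (suc i) = z≤n
lookup₀-≤ (y≤x ∷ ys) (suc i) = ℕ.≤-trans (lookup₀-≤ ys i) y≤x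

lookup₀-column : ∀ {xs} → Linked _≥_ xs → Dual (lookup₀ xs) (column xs)
lookup₀-column {[]}     _  i j = (λ ()) , (λ ())
lookup₀-column {x ∷ xs} xs↓ i j with j ℕ.<? x
... | yes j<x rewrite List.filter-accept (j ℕ.<?_) {xs = xs} j<x = to i , from i
  where
  to : ∀ i → j < lookup₀ (x ∷ xs) i → i < suc (column xs j)
  to zero    _  = z<s
  to (suc i) j< = s≤s (proj₁ (lookup₀-column (Linked.tail xs↓) i j) j<)
  from : ∀ i → i < suc (column xs j) → j < lookup₀ (x ∷ xs) i
  from zero    _        = j<x
  from (suc i) (s≤s i<) = proj₂ (lookup₀-column (Linked.tail xs↓) i j) i<
... | no j≮x rewrite List.filter-reject (j ℕ.<?_) {xs = xs} j≮x =
    (λ j< → contradiction (ℕ.<-≤-trans j< (lookup₀-≤ xs↓ i)) j≮x)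
  , (λ i< → contradiction (ℕ.<-≤-trans (proj₂ (lookup₀-column (Linked.tail xs↓) i j) i<)
    (lookup₀-≤ xs↓ (suc i))) j≮x)

lookup₀-applyUpTo : ∀ n {f : ℕ → ℕ} → (∀ {j} → n ≤ j → f j ≡ 0) → ∀ j → lookup₀ (applyUpTo f n) j ≡ f j
lookup₀-applyUpTo zero    f≡0 j       = sym (f≡0 z≤n)
lookup₀-applyUpTo (suc n) f≡0 zero    = refl
lookup₀-applyUpTo (suc n) f≡0 (suc j) = lookup₀-applyUpTo n (λ n≤j → f≡0 (s≤s n≤j)) j

lookup₀-length : ∀ xs {i} → length xs ≤ i → lookup₀ xs i ≡ 0
lookup₀-length []       _           = refl
lookup₀-length (x ∷ xs) (s≤s len≤i) = lookup₀-length xs len≤i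

col : Partition → ℕ → ℕ
col ƛ = column (parts ƛ)

part-col : ∀ ƛ → Dual (part ƛ) (col ƛ)
part-col ƛ = lookup₀-column (decreasing ƛ)

part-conjugate : ∀ ƛ j → part (conjugate ƛ) j ≡ col ƛ j
part-conjugate ƛ = lookup₀-applyUpTo (part ƛ 0) (rows-vanish (Dual-swap (part-col ƛ)) ℕ.≤-refl)

Dual-unique : ∀ {p c c′} → Dual p c → Dual p c′ → ∀ j → c j ≡ c′ j
Dual-unique dual dual′ j = ℕ.≤-antisym (le dual dual′) (le dual′ dual)
  where
  le : ∀ {p c c′} → Dual p c → Dual p c′ → c j ≤ c′ j
  le dual dual′ = ℕ.≮⇒≥ λ c′<c → ℕ.<-irrefl refl (proj₁ (dual′ _ j) (proj₂ (dual _ j) c′<c))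

col-conjugate : ∀ ƛ j → col (conjugate ƛ) j ≡ part ƛ j
col-conjugate ƛ = Dual-unique (part-col (conjugate ƛ))
  λ i j → subst (λ n → (j < n → i < part ƛ j) × (i < part ƛ j → j < n)) (sym (part-conjugate ƛ i))
    (Dual-swap (part-col ƛ) i j)

≤-maximum : ∀ {x} xs → x ∈ xs → x ≤ foldr _⊔_ 0 xs
≤-maximum (y ∷ xs) (here refl) = ℕ.m≤m⊔n y _
≤-maximum (y ∷ xs) (there x∈)  = ℕ.m≤n⇒m≤o⊔n y (≤-maximum xs x∈)

<-durfee : ∀ ƛ {i} → i < part ƛ i → i < durfee ƛ
<-durfee ƛ {i} i<pᵢ = ≤-maximum _ (∈-filter⁺ (λ s → s ℕ.≤? part ƛ (s ∸ 1)) (∈-applyUpTo⁺ suc i<length) i<pᵢ)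
  where
  i<length : i < length (parts ƛ)
  i<length = ℕ.≰⇒> λ len≤i → ℕ.n≮0 (subst (i <_) (lookup₀-length (parts ƛ) len≤i) i<pᵢ)

-- Conjugation fixes the diagonal, so a diagonal box of ƛ is one of μ and brings i below `durfee μ`.
-- There the condition on μ is the desired one with rows and columns exchanged.
DD′-legs : ∀ {ƛ} → DD′ ƛ → ∀ {i} → i < part ƛ i → col ƛ i ≡ suc (part ƛ i)
DD′-legs (μ , dd , refl) {i} i<pᵢ = begin
  col (conjugate μ) i              ≡⟨ col-conjugate μ i ⟩
  part μ i                         ≡⟨ dd i (<-durfee μ
    (proj₂ (part-col μ i i) (subst (i <_) (part-conjugate μ i) i<pᵢ))) ⟩
  part (conjugate μ) i ℕ.+ 1       ≡⟨ ℕ.+-comm _ 1 ⟩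
  suc (part (conjugate μ) i)       ∎
  where open ≡-Reasoning

DD′-shape : ∀ {ƛ} → DD′ ƛ → ∃[ B ] Shape (part ƛ) (col ƛ) B
DD′-shape {ƛ} dd′ with B , s , _ ← shape (part-col ƛ) (DD′-legs dd′) = B , s

word-vertical : ∀ ƛ k → (word ƛ k ≡ 0F → Vertical ƛ k) × (Vertical ƛ k → word ƛ k ≡ 0F)
word-vertical ƛ k = does⇔ (vertical? ƛ k)
  where
  letter : ∀ {P : Set} → Dec P → Fin 2
  letter P? = if does P? then 0F else 1F
  does⇔ : ∀ {P : Set} (P? : Dec P) →
    (letter P? ≡ 0F → P) × (P → letter P? ≡ 0F)
  does⇔ (yes p) = (λ _ → p) , (λ _ → refl)
  does⇔ (no ¬p) = (λ ()) , (λ p → contradiction p ¬p)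

word-bead : ∀ {ƛ B} → Shape (part ƛ) (col ƛ) B → ∀ k →
  (word ƛ k ≡ 0F → Bead B (k +ᶻ 1ℤ)) × (Bead B (k +ᶻ 1ℤ) → word ƛ k ≡ 0F)
word-bead {ƛ} {B} s k = to , from
  where
  ring₁ : ∀ p i → p -ᶻ (1ℤ +ᶻ i) +ᶻ 1ℤ ≡ p -ᶻ i
  ring₁ = solve-∀
  ring₂ : ∀ k → k ≡ k +ᶻ 1ℤ -ᶻ 1ℤ
  ring₂ = solve-∀
  ring₃ : ∀ p i → p -ᶻ i -ᶻ 1ℤ ≡ p -ᶻ (1ℤ +ᶻ i)
  ring₃ = solve-∀
  to : word ƛ k ≡ 0F → Bead B (k +ᶻ 1ℤ)
  to w with i , eq ← proj₁ (word-vertical ƛ k) w =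
    proj₁ (vertical⇔bead s (k +ᶻ 1ℤ)) (i , trans (cong (_+ᶻ 1ℤ) eq) (ring₁ (+ part ƛ i) (+ i)))
  from : Bead B (k +ᶻ 1ℤ) → word ƛ k ≡ 0F
  from b with i , eq ← proj₂ (vertical⇔bead s (k +ᶻ 1ℤ)) b =
    proj₂ (word-vertical ƛ k) (i , trans (ring₂ k) (trans (cong (_-ᶻ 1ℤ) eq) (ring₃ (+ part ƛ i) (+ i))))

hook≡ : ∀ ƛ {i j} → j < part ƛ i → + hook ƛ (i , j) ≡ + part ƛ i -ᶻ + i +ᶻ + col ƛ j -ᶻ + suc j
hook≡ ƛ {i} {j} j<pᵢ rewrite part-conjugate ƛ j
  with ℕ.m≤n⇒∃[o]m+o≡n j<pᵢ | ℕ.m≤n⇒∃[o]m+o≡n (proj₁ (part-col ƛ i j) j<pᵢ)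
... | a , pᵢ≡ | b , cⱼ≡ rewrite sym pᵢ≡ | sym cⱼ≡ | ℕ.m+n∸m≡n (suc j) a | ℕ.m+n∸m≡n (suc i) b =
  ring (+ a) (+ b) (+ i) (+ j)
  where
  ring : ∀ a b i j → a +ᶻ b +ᶻ 1ℤ ≡ (1ℤ +ᶻ j +ᶻ a) -ᶻ i +ᶻ (1ℤ +ᶻ i +ᶻ b) -ᶻ (1ℤ +ᶻ j)
  ring = solve-∀

-- Sums over the boxes of a partition

module BoxSums {a ℓ} (G : AbelianGroup a ℓ) where
  open Sums G
  open ShapeSums G

  sum-++ : ∀ {a} {A : Set a} (xs ys : List A) F → sum (xs ++ ys) F ≈ sum xs F ⊕ sum ys F
  sum-++ []       ys F = ≈-sym (⊕-identityˡ _)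
  sum-++ (x ∷ xs) ys F = ≈-trans (⊕-congˡ (sum-++ xs ys F)) (≈-sym (⊕-assoc _ _ _))

  sum-map : ∀ {a b} {A : Set a} {B : Set b} (h : A → B) xs F → sum (map h xs) F ≈ (∑[ x ∈ xs ] F (h x))
  sum-map h []       F = ≈-refl
  sum-map h (x ∷ xs) F = ⊕-congˡ (sum-map h xs F)

  sum-concatMap : ∀ {a b} {A : Set a} {B : Set b} (h : A → List B) xs F →
    sum (concatMap h xs) F ≈ (∑[ x ∈ xs ] sum (h x) F)
  sum-concatMap h []       F = ≈-refl
  sum-concatMap h (x ∷ xs) F = ≈-trans (sum-++ (h x) _ F) (⊕-congˡ (sum-concatMap h xs F))

  sum-applyUpTo : ∀ {a} {A : Set a} (f : ℕ → A) n F → sum (applyUpTo f n) F ≈ (∑[ i < n ] F (f i))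
  sum-applyUpTo f zero    F = ≈-refl
  sum-applyUpTo f (suc n) F =
    ≈-trans (⊕-congˡ (sum-applyUpTo (λ i → f (suc i)) n F)) (≈-sym (sum<-suc n _))

  sum-boxes : ∀ ƛ F → sum (boxes ƛ) F ≈ (∑[ i < length (parts ƛ) ] ∑[ j < part ƛ i ] F (i , j))
  sum-boxes ƛ F = ≈-trans (sum-concatMap _ (upTo (length (parts ƛ))) F)
    (≈-trans (sum-applyUpTo _ (length (parts ƛ)) _)
      (sum<-cong (length (parts ƛ)) λ {i} _ →
        ≈-trans (sum-map (i ,_) (upTo (part ƛ i)) F) (sum-applyUpTo _ (part ƛ i) _)))

  sum-hooks : ∀ {ƛ B} (φ : Bool → ℤ → Carrier) → Shape (part ƛ) (col ƛ) B →
    (∑[ s ∈ boxes ƛ ] φ (does (proj₂ s ℕ.<? proj₁ s)) (+ hook ƛ s)) ≈ hooksSum φ B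
  sum-hooks {ƛ} φ s = ≈-trans (sum-boxes ƛ _)
    (≈-trans (sum<-cong (length (parts ƛ)) λ {i} _ → sum<-cong (part ƛ i) λ {j} j<pᵢ → resp (φ (j <ᵇ i))
      (hook≡ ƛ j<pᵢ))
      (boxSum≈hooksSum φ (length (parts ƛ)) s (lookup₀-length (parts ƛ))))

-- Deleting the head of xs from both lists keeps the inclusion, as xs has no repetition, and the
-- length bound leaves nothing of ys at the end. It matches edges with the coding regardless of
-- order.
unique-⊆⇒↭ : ∀ {a} {A : Set a} {xs ys : List A} → Unique xs → (∀ {x} → x ∈ xs → x ∈ ys) →
  length ys ≤ length xs → xs ↭ ys
unique-⊆⇒↭ {xs = []} {[]} _ _ _ = ↭.refl
unique-⊆⇒↭ {xs = x ∷ xs} (x∉xs ∷ u) xs⊆ys len with ∈-∃++ (xs⊆ys (here refl))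
... | us , vs , refl = ↭.trans (↭.prep x (unique-⊆⇒↭ u xs⊆ len′)) (↭.↭-sym (shift x us vs))
  where
  xs⊆ : ∀ {y} → y ∈ xs → y ∈ us ++ vs
  xs⊆ y∈xs with ∈-resp-↭ (shift x us vs) (xs⊆ys (there y∈xs))
  ... | here refl = contradiction refl (All.lookup x∉xs y∈xs)
  ... | there y∈ = y∈
  len′ : length (us ++ vs) ≤ length xs
  len′ = ℕ.s≤s⁻¹ (subst (_≤ suc (length xs)) (↭-length (shift x us vs)) len)

bead-total : ∀ {B} → Descending B → ∀ x → Bead B x ⊎ Bead B (- x)
bead-total [] x with ℤ.≤-total x 0ℤ
... | inj₁ x≤0 = inj₁ x≤0
... | inj₂ 0≤x = inj₂ (ℤ.neg-mono-≤ 0≤x)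
bead-total {X ∷ B} ((0<X , _) ∷ desc) x with bead-total desc x | x ℤ.≟ + X | x ℤ.≟ - + X
... | _      | yes refl | _ = inj₁ (inj₁ refl , +≢- 0<X)
... | _      | no _     | yes refl = inj₂ (inj₁ (ℤ.neg-involutive (+ X)) , λ eq → +≢- 0<X
  (ℤ.neg-injective (sym eq)))
... | inj₁ b | no _     | no x≢-X = inj₁ (inj₂ b , x≢-X)
... | inj₂ b | no x≢X   | no _ = inj₂ (inj₂ b , λ eq → x≢X (ℤ.neg-injective eq))

-- The quotient condition as closedness of the beads

part-rectangle : ∀ m b {i} → i < m → part (rectangle m b) i ≡ b
part-rectangle m zero    _ = refl
part-rectangle m (suc b) i<m = go m i<m
  where
  go : ∀ m {i} → i < m → lookup₀ (replicate m (suc b)) i ≡ suc b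
  go (suc m) {zero}  _         = refl
  go (suc m) {suc i} (s≤s i<m) = go m i<m

part-rectangle-0 : ∀ m b {i} → m ≤ i → part (rectangle m b) i ≡ 0
part-rectangle-0 m zero    _ = refl
part-rectangle-0 m (suc b) m≤i = lookup₀-length (replicate m (suc b))
  (subst (_≤ _) (sym (List.length-replicate m)) m≤i)

-- The word of the rectangle, with the index shifted by 1.
RectangleWord : ℕ → ℤ → Set
RectangleWord m z = (0ℤ ℤ.≤ z × z ℤ.< + m) ⊎ z ℤ.≤ - + m

-- The rows i < m lie at m - 1 - i and cover 0, ..., m - 1; the empty rows i ≥ m lie at -i.
rectangle-vertical : ∀ {m} → m ≥ 1 → ∀ {k} →
  (Vertical (rectangle m (m ∸ 1)) k → RectangleWord m (k +ᶻ 1ℤ)) ×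
  (RectangleWord m (k +ᶻ 1ℤ) → Vertical (rectangle m (m ∸ 1)) k)
rectangle-vertical {suc n} _ {k} = to , from
  where
  m = suc n
  ring₁ : ∀ p i → p -ᶻ (1ℤ +ᶻ i) +ᶻ 1ℤ ≡ p -ᶻ i
  ring₁ = solve-∀
  to : Vertical (rectangle m n) k → RectangleWord m (k +ᶻ 1ℤ)
  to (i , refl) with i ℕ.<? m
  ... | yes i<m@(s≤s i≤n) rewrite part-rectangle m n i<m | ring₁ (+ n) (+ i) =
      inj₁ (ℤ.i≤j⇒0≤j-i (ℤ.+≤+ i≤n) , ℤ.≤-<-trans (ℤ.i-j≤i (+ n) (+ i)) (ℤ.+<+ (ℕ.n<1+n n)))
  ... | no i≮m rewrite part-rectangle-0 m n (ℕ.≮⇒≥ i≮m) | ring₁ 0ℤ (+ i) | 0-n≡-n i =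
      inj₂ (ℤ.neg-mono-≤ (ℤ.+≤+ (ℕ.≮⇒≥ i≮m)))
  ring₂ : ∀ k → k ≡ - - (k +ᶻ 1ℤ) -ᶻ 1ℤ
  ring₂ = solve-∀
  ring₃ : ∀ i → - i -ᶻ 1ℤ ≡ 0ℤ -ᶻ (1ℤ +ᶻ i)
  ring₃ = solve-∀
  ring₄ : ∀ n k → k ≡ n -ᶻ (1ℤ +ᶻ (n -ᶻ (k +ᶻ 1ℤ)))
  ring₄ = solve-∀
  from : RectangleWord m (k +ᶻ 1ℤ) → Vertical (rectangle m n) k
  from (inj₁ (0≤z , z<m)) = i , trans (ring₄ (+ n) k)
    (cong₂ _-ᶻ_ (cong +_ (sym (part-rectangle m n (s≤s i≤n)))) (cong (1ℤ +ᶻ_) (sym +i≡)))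
    where
    z≤n′ : k +ᶻ 1ℤ ℤ.≤ + n
    z≤n′ = ℤ.i<j⇒i≤pred[j] z<m
    i = ∣ + n -ᶻ (k +ᶻ 1ℤ) ∣
    +i≡ : + i ≡ + n -ᶻ (k +ᶻ 1ℤ)
    +i≡ = ℤ.0≤i⇒+∣i∣≡i (ℤ.i≤j⇒0≤j-i z≤n′)
    i≤n : i ≤ n
    i≤n = ℤ.drop‿+≤+ (subst (ℤ._≤ + n) (sym +i≡)
      (subst (+ n -ᶻ (k +ᶻ 1ℤ) ℤ.≤_) (ℤ.+-identityʳ (+ n)) (ℤ.+-monoʳ-≤ (+ n) (ℤ.neg-mono-≤ 0≤z))))
  from (inj₂ z≤-m) = i , trans (ring₂ k) (trans (cong (λ z → - z -ᶻ 1ℤ) (sym +i≡))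
    (trans (ring₃ (+ i)) (cong (λ n → + n -ᶻ + suc i) (sym (part-rectangle-0 m n m≤i)))))
    where
    i = ∣ - (k +ᶻ 1ℤ) ∣
    m≤-z : + m ℤ.≤ - (k +ᶻ 1ℤ)
    m≤-z = subst (ℤ._≤ - (k +ᶻ 1ℤ)) (ℤ.neg-involutive (+ m)) (ℤ.neg-mono-≤ z≤-m)
    +i≡ : + i ≡ - (k +ᶻ 1ℤ)
    +i≡ = ℤ.0≤i⇒+∣i∣≡i (ℤ.≤-trans (ℤ.+≤+ z≤n) m≤-z)
    m≤i : m ≤ i
    m≤i = ℤ.drop‿+≤+ (subst (+ m ℤ.≤_) (sym +i≡) m≤-z)

module QuotientEdges (t g : ℕ) (1+g≡t+t : suc g ≡ t ℕ.+ t) where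
  open Evolution t g 1+g≡t+t

  g-nonZero : NonZero g
  g-nonZero = ℕ.>-nonZero 0<g

  class : ℤ → Fin g
  class x = fromℕ< (ℤ.n%ℕd<d x g {{g-nonZero}})

  level : ℤ → ℤ
  level x = ℤ._/ℕ_ x g {{g-nonZero}}

  class-level : ∀ x → x ≡ level x *ᶻ + g +ᶻ + toℕ (class x)
  class-level x = trans (ℤ.a≡a%ℕn+[a/ℕn]*n x g {{g-nonZero}})
    (trans (ℤ.+-comm (+ ℤ._%ℕ_ x g {{g-nonZero}}) (level x *ᶻ + g))
      (cong (λ n → level x *ᶻ + g +ᶻ + n) (sym (Fin.toℕ-fromℕ< (ℤ.n%ℕd<d x g {{g-nonZero}})))))

  -- The multiples of g are the component g - 1 of the quotient, once the word has been shifted by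
  -- 1. Its index shift s is still unknown.
  module _ {B} (desc : Descending B) {m} (m≥1 : m ≥ 1) {s}
    (rect : ∀ y → (RectangleWord m (y -ᶻ s) → Bead B (y *ᶻ + g)) ×
      (Bead B (y *ᶻ + g) → RectangleWord m (y -ᶻ s)))
    where

    bead-0 : Bead B 0ℤ
    bead-0 with bead-total desc 0ℤ
    ... | inj₁ b = b
    ... | inj₂ b = b

    neg-*g : ∀ y → - y *ᶻ + g ≡ - (y *ᶻ + g)
    neg-*g y = sym (ℤ.neg-distribˡ-* y (+ g))

    rect-total : ∀ y → RectangleWord m (y -ᶻ s) ⊎ RectangleWord m (- y -ᶻ s)
    rect-total y with bead-total desc (y *ᶻ + g)
    ... | inj₁ b = inj₁ (proj₂ (rect y) b)
    ... | inj₂ b = inj₂ (proj₂ (rect (- y)) (subst (Bead B) (sym (neg-*g y)) b))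

    rect-antisym : ∀ {y} → RectangleWord m (y -ᶻ s) → RectangleWord m (- y -ᶻ s) → y ≡ 0ℤ
    rect-antisym {y} r r′ = ℤ.*-cancelʳ-≡ y 0ℤ (+ g) {{g-nonZero}}
      (bead-antisym B (proj₁ (rect y) r) (subst (Bead B) (neg-*g y) (proj₁ (rect (- y)) r′)))

    rect-0 : RectangleWord m 0ℤ
    rect-0 = inj₁ (ℤ.≤-refl , ℤ.+<+ m≥1)

    -- The symmetry of the word of the diagram leaves no room for a shift.
    shift≡0 : s ≡ 0ℤ
    shift≡0 with ℤ.<-cmp 0ℤ s
    ... | tri≈ _ 0≡s _ = sym 0≡s
    -- The bead 0 gives 0 < -s < m, and antisymmetry at s gives m ≤ -2s. At y = 1 - s the mirror
    -- pair then falls on 1 - 2s > m and on -1 > -m, both gaps of the rectangle.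
    ... | tri> _ _ s<0 = contradiction (rect-total (1ℤ -ᶻ s)) λ
      { (inj₁ (inj₁ (_ , <m)))   → ℤ.<⇒≱ <m (ℤ.≤-trans m≤-2s
        (subst (- s -ᶻ s ℤ.≤_) (ring₁ s) (ℤ.i≤j+i (- s -ᶻ s) 1ℤ)))
      ; (inj₁ (inj₂ ≤-m))        → ℤ.<⇒≱ (ℤ.<-≤-trans
        (ℤ.≤-<-trans (ℤ.neg-mono-≤ (ℤ.+≤+ (z≤n {m}))) (ℤ.+<+ z<s))
          (ℤ.≤-trans (ℤ.+-monoʳ-≤ 1ℤ (ℤ.≤-trans (ℤ.+≤+ z≤n) m≤-2s)) (ℤ.≤-reflexive (ring₁ s)))) ≤-m
      ; (inj₂ (inj₁ (0≤ , _)))   → contradiction (subst (0ℤ ℤ.≤_) (ring₂ s) 0≤) λ ()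
      ; (inj₂ (inj₂ ≤-m))        → ℤ.<⇒≱ (ℤ.≤-<-trans (ℤ.i<j⇒suc[i]≤j 0<-s) -s<m)
        (ℤ.neg-cancel-≤ (subst (ℤ._≤ - + m) (ring₂ s) ≤-m)) }
      where
      ring₁ : ∀ s → 1ℤ +ᶻ (- s -ᶻ s) ≡ 1ℤ -ᶻ s -ᶻ s
      ring₁ = solve-∀
      ring₂ : ∀ s → - (1ℤ -ᶻ s) -ᶻ s ≡ - 1ℤ
      ring₂ = solve-∀
      0<-s : 0ℤ ℤ.< - s
      0<-s = ℤ.neg-mono-< s<0
      -s<m : - s ℤ.< + m
      -s<m with proj₂ (rect 0ℤ) bead-0
      ... | inj₁ (_ , <m) = subst (ℤ._< + m) (ℤ.+-identityˡ (- s)) <m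
      ... | inj₂ ≤-m = contradiction (ℤ.≤-trans (subst (ℤ._≤ - + m) (ℤ.+-identityˡ (- s)) ≤-m)
        (ℤ.neg-mono-≤ (ℤ.+≤+ z≤n))) (ℤ.<⇒≱ 0<-s)
      m≤-2s : + m ℤ.≤ - s -ᶻ s
      m≤-2s = ℤ.≮⇒≥ λ -2s<m → ℤ.<-irrefl
        (rect-antisym (subst (RectangleWord m) (sym (ℤ.+-inverseʳ s)) rect-0)
          (inj₁ (ℤ.<⇒≤ (ℤ.+-mono-< 0<-s 0<-s) , -2s<m))) s<0
    -- Here the bead 0 gives -s ≤ -m, hence also -2s ≤ -m, so s and -s are both occupied and
    -- antisymmetry forces s = 0.
    ... | tri< 0<s _ _ with proj₂ (rect 0ℤ) bead-0
    ...   | inj₁ (0≤-s , _) = contradiction (ℤ.neg-cancel-≤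
      (subst (0ℤ ℤ.≤_) (ℤ.+-identityˡ (- s)) 0≤-s)) (ℤ.<⇒≱ 0<s)
    ...   | inj₂ -s≤-m = rect-antisym (subst (RectangleWord m) (sym (ℤ.+-inverseʳ s)) rect-0)
      (inj₂ (ℤ.≤-trans (ℤ.+-mono-≤ (ℤ.neg-mono-≤ (ℤ.<⇒≤ 0<s)) ℤ.≤-refl) -s≤-m))

    -- In the word of the rectangle only the position 0 has a gap right below a bead, and with shift
    -- 0 this is y = 0.
    closed-multiples : ∀ {y} → Bead B (y *ᶻ + g) → y ≢ 0ℤ → Bead B ((y -ᶻ 1ℤ) *ᶻ + g)
    closed-multiples {y} b y≢0 = proj₁ (rect (y -ᶻ 1ℤ))
      (subst (RectangleWord m) (ring y s) (down (proj₂ (rect y) b)))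
      where
      ring : ∀ y s → (y -ᶻ s) -ᶻ 1ℤ ≡ (y -ᶻ 1ℤ) -ᶻ s
      ring = solve-∀
      down : RectangleWord m (y -ᶻ s) → RectangleWord m (y -ᶻ s -ᶻ 1ℤ)
      down (inj₂ ≤-m) = inj₂ (ℤ.≤-trans (ℤ.i-j≤i (y -ᶻ s) 1ℤ) ≤-m)
      down (inj₁ (0≤ , <m)) = inj₁
        ( ℤ.i≤j⇒0≤j-i (ℤ.i<j⇒suc[i]≤j (ℤ.≤∧≢⇒< 0≤ λ eq → y≢0 (trans (ℤ.i-j≡0⇒i≡j y s (sym eq)) shift≡0)))
        , ℤ.≤-<-trans (ℤ.i-j≤i (y -ᶻ s) 1ℤ) <m)

  module _ {ƛ B} (shp : Shape (part ƛ) (col ƛ) B) {ν : Vector Partition g} (quotient : IsQuotient g ƛ ν) where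

    private
      σ : Fin g → ℤ
      σ k = proj₁ (quotient k)

    quotient-bead : ∀ k i →
      (Vertical (ν k) i → Bead B (+ g *ᶻ (i +ᶻ σ k) +ᶻ + toℕ k +ᶻ 1ℤ)) ×
      (Bead B (+ g *ᶻ (i +ᶻ σ k) +ᶻ + toℕ k +ᶻ 1ℤ) → Vertical (ν k) i)
    quotient-bead k i =
        (λ v → proj₁ (word-bead {ƛ} shp x) (trans (sym word≡) (proj₂ (word-vertical (ν k) i) v)))
      , (λ b → proj₁ (word-vertical (ν k) i) (trans word≡ (proj₂ (word-bead {ƛ} shp x) b)))
      where
      x = + g *ᶻ (i +ᶻ σ k) +ᶻ + toℕ k
      word≡ : word (ν k) i ≡ word ƛ x
      word≡ = proj₂ (quotient k) i

    -- The class of `x -ᶻ 1ℤ` undoes the shift of the word. If its component is empty, its beads are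
    -- closed downwards. The remaining class, of index g - 1, consists of the multiples of g.
    quotient⇒closed : ∀ {m} → (∀ k → toℕ k ≢ pred g → ν k ≡ ∅) → m ≥ 1 →
      (∀ k → toℕ k ≡ pred g → ν k ≡ rectangle m (m ∸ 1)) → Closed B
    quotient⇒closed {m} ν≡∅ m≥1 ν≡rect {x} b x≢0 = go (toℕ k ℕ.≟ pred g)
      where
      k = class (x -ᶻ 1ℤ)
      go : Dec (toℕ k ≡ pred g) → Bead B (x -ᶻ + g)
      go (no k≢) = subst (Bead B) (ring₂ (+ g) (level (x -ᶻ 1ℤ)) (σ k) (+ toℕ k) x (class-level (x -ᶻ 1ℤ)))
          (proj₁ (quotient-bead k _) (vertical-pred (proj₂ (quotient-bead k (level (x -ᶻ 1ℤ) -ᶻ σ k))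
            (subst (Bead B) (ring₁ (+ g) (level (x -ᶻ 1ℤ)) (σ k) (+ toℕ k) x (class-level (x -ᶻ 1ℤ))) b))))
        where
        vertical-pred : ∀ {i} → Vertical (ν k) i → Vertical (ν k) (i -ᶻ 1ℤ)
        vertical-pred {i} v = subst (λ μ → Vertical μ (i -ᶻ 1ℤ)) (sym (ν≡∅ k k≢))
          (∅-pred (subst (λ μ → Vertical μ i) (ν≡∅ k k≢) v))
          where
          ∅-pred : ∀ {i} → Vertical ∅ i → Vertical ∅ (i -ᶻ 1ℤ)
          ∅-pred (i , refl) = suc i , ring (+ i)
            where
            ring : ∀ i → 0ℤ -ᶻ (1ℤ +ᶻ i) -ᶻ 1ℤ ≡ 0ℤ -ᶻ (1ℤ +ᶻ (1ℤ +ᶻ i))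
            ring = solve-∀
        ring₁ : ∀ g q s k x → x -ᶻ 1ℤ ≡ q *ᶻ g +ᶻ k → x ≡ g *ᶻ (q -ᶻ s +ᶻ s) +ᶻ k +ᶻ 1ℤ
        ring₁ g q s k x eq = trans (i-j≡k⇒i≡k+j eq) (ring g q s k)
          where
          ring : ∀ g q s k → q *ᶻ g +ᶻ k +ᶻ 1ℤ ≡ g *ᶻ (q -ᶻ s +ᶻ s) +ᶻ k +ᶻ 1ℤ
          ring = solve-∀
        ring₂ : ∀ g q s k x → x -ᶻ 1ℤ ≡ q *ᶻ g +ᶻ k → g *ᶻ (q -ᶻ s -ᶻ 1ℤ +ᶻ s) +ᶻ k +ᶻ 1ℤ ≡ x -ᶻ g
        ring₂ g q s k x eq = trans (ring g q s k) (cong (_-ᶻ g) (sym (i-j≡k⇒i≡k+j {x} eq)))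
          where
          ring : ∀ g q s k → g *ᶻ (q -ᶻ s -ᶻ 1ℤ +ᶻ s) +ᶻ k +ᶻ 1ℤ ≡ q *ᶻ g +ᶻ k +ᶻ 1ℤ -ᶻ g
          ring = solve-∀
      go (yes k≡) = subst (Bead B) (trans (ring₁ y (+ g)) (cong (_-ᶻ + g) (sym x≡)))
          (closed-multiples (descending shp) m≥1 {σ k} rect {y} (subst (Bead B) x≡ b) y≢0)
        where
        y = level (x -ᶻ 1ℤ) +ᶻ 1ℤ
        1+k≡g : 1ℤ +ᶻ + toℕ k ≡ + g
        1+k≡g = cong +_ (trans (cong suc k≡) (ℕ.suc-pred g {{g-nonZero}}))
        ring₁ : ∀ y g → (y -ᶻ 1ℤ) *ᶻ g ≡ y *ᶻ g -ᶻ g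
        ring₁ = solve-∀
        ring₂ : ∀ q g k → q *ᶻ g +ᶻ k +ᶻ 1ℤ ≡ q *ᶻ g +ᶻ (1ℤ +ᶻ k)
        ring₂ = solve-∀
        ring₃ : ∀ q g → q *ᶻ g +ᶻ g ≡ (q +ᶻ 1ℤ) *ᶻ g
        ring₃ = solve-∀
        ring₄ : ∀ y s g k → g *ᶻ (y -ᶻ 1ℤ -ᶻ s +ᶻ s) +ᶻ k +ᶻ 1ℤ ≡ (y -ᶻ 1ℤ) *ᶻ g +ᶻ (1ℤ +ᶻ k)
        ring₄ = solve-∀
        ring₅ : ∀ y s → y -ᶻ 1ℤ -ᶻ s +ᶻ 1ℤ ≡ y -ᶻ s
        ring₅ = solve-∀
        x≡ : x ≡ y *ᶻ + g
        x≡ = trans (i-j≡k⇒i≡k+j (class-level (x -ᶻ 1ℤ))) (trans (ring₂ (level (x -ᶻ 1ℤ)) (+ g) (+ toℕ k))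
          (trans (cong (level (x -ᶻ 1ℤ) *ᶻ + g +ᶻ_) 1+k≡g) (ring₃ (level (x -ᶻ 1ℤ)) (+ g))))
        y≢0 : y ≢ 0ℤ
        y≢0 y≡0 = x≢0 (trans x≡ (cong (_*ᶻ + g) y≡0))
        position : ∀ y → + g *ᶻ (y -ᶻ 1ℤ -ᶻ σ k +ᶻ σ k) +ᶻ + toℕ k +ᶻ 1ℤ ≡ y *ᶻ + g
        position y = trans (ring₄ y (σ k) (+ g) (+ toℕ k)) (trans (cong ((y -ᶻ 1ℤ) *ᶻ + g +ᶻ_) 1+k≡g)
          (trans (ring₃ (y -ᶻ 1ℤ) (+ g)) (cong (_*ᶻ + g) (i-j+j≡i y 1ℤ))))
        rect : ∀ y → (RectangleWord m (y -ᶻ σ k) → Bead B (y *ᶻ + g)) ×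
          (Bead B (y *ᶻ + g) → RectangleWord m (y -ᶻ σ k))
        rect y =
            (λ r → subst (Bead B) (position y) (proj₁ (quotient-bead k i)
              (subst (λ μ → Vertical μ i) (sym (ν≡rect k k≡))
                (proj₂ (rectangle-vertical m≥1) (subst (RectangleWord m) (sym (ring₅ y (σ k))) r)))))
          , (λ b′ → subst (RectangleWord m) (ring₅ y (σ k)) (proj₁ (rectangle-vertical m≥1)
              (subst (λ μ → Vertical μ i) (ν≡rect k k≡)
                (proj₂ (quotient-bead k i) (subst (Bead B) (sym (position y)) b′)))))
          where i = y -ᶻ 1ℤ -ᶻ σ k

-- The coding lists the edges

module Coding (t g : ℕ) (1+g≡t+t : suc g ≡ t ℕ.+ t)
  {ƛ B} (shp : Shape (part ƛ) (col ƛ) B) {v : Vector ℤ t} (coding : IsVCoding g t ƛ v)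
  where
  open Evolution t g 1+g≡t+t
  open QuotientEdges t g 1+g≡t+t
  open IsVCoding coding renaming (decreasing to v-decreasing)

  position : ℤ → Fin g → ℤ
  position k i = k *ᶻ + g +ᶻ + toℕ i +ᶻ 1ℤ

  position-word : ∀ k i → (word ƛ (k *ᶻ + g +ᶻ + toℕ i) ≡ 0F → Bead B (position k i)) ×
                          (Bead B (position k i) → word ƛ (k *ᶻ + g +ᶻ + toℕ i) ≡ 0F)
  position-word k i = word-bead {ƛ} shp (k *ᶻ + g +ᶻ + toℕ i)

  top : Fin g → ℤ
  top i = proj₁ (proj₁ (β-maximum i))

  top-bead : ∀ i → Bead B (position (top i) i)
  top-bead i = proj₁ (position-word (top i) i) (proj₂ (proj₂ (proj₁ (β-maximum i))))

  above : ∀ k (i : Fin g) → k *ᶻ + g +ᶻ + toℕ i +ᶻ + g ≡ (k +ᶻ 1ℤ) *ᶻ + g +ᶻ + toℕ i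
  above k i = ring k (+ g) (+ toℕ i)
    where
    ring : ∀ k g i → k *ᶻ g +ᶻ i +ᶻ g ≡ (k +ᶻ 1ℤ) *ᶻ g +ᶻ i
    ring = solve-∀

  β≡ : ∀ i → β i +ᶻ 1ℤ ≡ position (top i) i +ᶻ + g
  β≡ i = trans (cong (_+ᶻ 1ℤ) (trans (proj₁ (proj₂ (proj₁ (β-maximum i)))) (sym (above (top i) i))))
    (ring (top i *ᶻ + g +ᶻ + toℕ i) (+ g))
    where
    ring : ∀ x g → x +ᶻ g +ᶻ 1ℤ ≡ x +ᶻ 1ℤ +ᶻ g
    ring = solve-∀

  bead-below-β : ∀ i k → Bead B (position k i) → position k i +ᶻ + g ℤ.≤ β i +ᶻ 1ℤ
  bead-below-β i k b = subst (ℤ._≤ β i +ᶻ 1ℤ) (trans (cong (_+ᶻ 1ℤ) (sym (above k i)))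
    (ring (k *ᶻ + g +ᶻ + toℕ i) (+ g)))
    (ℤ.+-monoˡ-≤ 1ℤ (proj₂ (β-maximum i) ((k +ᶻ 1ℤ) *ᶻ + g +ᶻ + toℕ i)
      (k , refl , proj₂ (position-word k i) b)))
    where
    ring : ∀ x g → x +ᶻ g +ᶻ 1ℤ ≡ x +ᶻ 1ℤ +ᶻ g
    ring = solve-∀

  -- A bead there would be g above the topmost bead of its class.
  β-gap : ∀ i → ¬ Bead B (β i +ᶻ 1ℤ)
  β-gap i b = ℤ.<⇒≱ (ℤ.≤∧≢⇒< (ℤ.i≤i+j (β i +ᶻ 1ℤ) (+ g)) λ eq → i+g≢i (sym eq))
    (subst (λ z → z +ᶻ + g ℤ.≤ β i +ᶻ 1ℤ) (sym β≡′) (bead-below-β i (top i +ᶻ 1ℤ) (subst (Bead B) β≡′ b)))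
    where
    β≡′ : β i +ᶻ 1ℤ ≡ position (top i +ᶻ 1ℤ) i
    β≡′ = cong (_+ᶻ 1ℤ) (proj₁ (proj₂ (proj₁ (β-maximum i))))

  β-edge : ∀ i → + g ℤ.< (β i +ᶻ 1ℤ) +ᶻ (β i +ᶻ 1ℤ) → Edge B (β i +ᶻ 1ℤ)
  β-edge i g<2w = g<2w , β-gap i , subst (Bead B)
    (sym (trans (cong (_-ᶻ + g) (β≡ i)) (i+j-j≡i (position (top i) i) (+ g)))) (top-bead i)

  module _ (closed : Closed B) where

    -- Every position passed lies above w > 0, so the exceptional bead 0 is never met.
    descend : ∀ d {w} → 0ℤ ℤ.< w → Bead B (w +ᶻ + d *ᶻ + g) → Bead B w
    descend zero    {w} _   b = subst (Bead B) (ring w (+ g)) b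
      where
      ring : ∀ w g → w +ᶻ 0ℤ *ᶻ g ≡ w
      ring = solve-∀
    descend (suc d) {w} 0<w b = descend d 0<w (subst (Bead B) (ring w (+ d) (+ g)) (closed b λ eq →
      ℤ.<-irrefl (sym eq) (ℤ.<-≤-trans 0<w (subst (w ℤ.≤_) (cong (w +ᶻ_) (ℤ.pos-* (suc d) g))
        (ℤ.i≤i+j w (+ (suc d ℕ.* g)))))))
      where
      ring : ∀ w d g → w +ᶻ (1ℤ +ᶻ d) *ᶻ g -ᶻ g ≡ w +ᶻ d *ᶻ g
      ring = solve-∀

    -- If the topmost bead of the class were above w, `descend` would make w a bead. This needs w
    -- positive, which the upper half guarantees.
    edge-β : ∀ {w} → Edge B w → ∃[ i ] w ≡ β i +ᶻ 1ℤ
    edge-β {w} (g<2w , ¬b , b) = i , ℤ.≤-antisym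
      (subst (ℤ._≤ β i +ᶻ 1ℤ) (sym w≡) (bead-below-β i q bead-q)) (ℤ.≮⇒≥ β≯w)
      where
      x = w -ᶻ + g -ᶻ 1ℤ
      i = class x
      q = level x
      w-g≡ : w -ᶻ + g ≡ position q i
      w-g≡ = i-j≡k⇒i≡k+j (class-level x)
      w≡ : w ≡ position q i +ᶻ + g
      w≡ = i-j≡k⇒i≡k+j w-g≡
      bead-q : Bead B (position q i)
      bead-q = subst (Bead B) w-g≡ b
      β≯w : ¬ w ℤ.< β i +ᶻ 1ℤ
      β≯w w<β = ¬b (descend d (upper⇒positive g<2w) (subst (Bead B) top≡ (top-bead i)))
        where
        q<top : q ℤ.< top i
        q<top = ℤ.*-cancelʳ-<-nonNeg (+ g) (subst₂ ℤ._<_ (ring₁ q (+ g) (+ toℕ i))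
          (ring₁ (top i) (+ g) (+ toℕ i))
          (ℤ.+-monoˡ-< (- (+ g +ᶻ + toℕ i +ᶻ 1ℤ)) (subst₂ ℤ._<_ w≡ (β≡ i) w<β)))
          where
          ring₁ : ∀ q g i → q *ᶻ g +ᶻ i +ᶻ 1ℤ +ᶻ g -ᶻ (g +ᶻ i +ᶻ 1ℤ) ≡ q *ᶻ g
          ring₁ = solve-∀
        d = ∣ top i -ᶻ (1ℤ +ᶻ q) ∣
        +d≡ : + d ≡ top i -ᶻ (1ℤ +ᶻ q)
        +d≡ = ℤ.0≤i⇒+∣i∣≡i (ℤ.i≤j⇒0≤j-i (ℤ.i<j⇒suc[i]≤j q<top))
        top≡ : position (top i) i ≡ w +ᶻ + d *ᶻ + g
        top≡ = trans (ring (top i) q (+ g) (+ toℕ i)) (cong₂ (λ w d → w +ᶻ d *ᶻ + g) (sym w≡) (sym +d≡))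
          where
          ring : ∀ p q g i → p *ᶻ g +ᶻ i +ᶻ 1ℤ ≡ q *ᶻ g +ᶻ i +ᶻ 1ℤ +ᶻ g +ᶻ (p -ᶻ (1ℤ +ᶻ q)) *ᶻ g
          ring = solve-∀

    w : Fin t → ℤ
    w i = v i +ᶻ 1ℤ

    w-unique : Unique (tabulate w)
    w-unique = Unique.tabulate⁺ λ {i} {j} wᵢ≡wⱼ → v-injective (∙-cancelʳ 1ℤ _ _ wᵢ≡wⱼ)
      where
      v-injective : ∀ {i j} → v i ≡ v j → i ≡ j
      v-injective {i} {j} vᵢ≡vⱼ with Fin.<-cmp i j
      ... | tri< i<j _ _ = contradiction (v-decreasing i<j) (ℤ.<-irrefl (sym vᵢ≡vⱼ))
      ... | tri≈ _ i≡j _ = i≡j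
      ... | tri> _ _ j<i = contradiction (v-decreasing j<i) (ℤ.<-irrefl vᵢ≡vⱼ)

    -- Each edge is some `β k +ᶻ 1ℤ`, so it is listed by v or lies below all of v. In the second
    -- case every entry of `w` is in the upper half as well, hence an edge, and a count decides.
    edges↭coding : ∀ {R} → Edges B R → length R ≡ t → R ↭ tabulate w
    edges↭coding {R} edges length≡t =
      unique-⊆⇒↭ unique R⊆w (ℕ.≤-reflexive (trans (List.length-tabulate w) (sym length≡t)))
      where
      open Edges edges
      raised : ∀ {k x} → x ∈ R → x ≡ β k +ᶻ 1ℤ → (∀ i → β k ℤ.< v i) → ∀ {y} → y ∈ tabulate w → y ∈ R
      raised {k} {x} x∈R x≡ βₖ<v {y} y∈w = in-R (∈-tabulate⁻ y∈w)
        where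
        in-R : ∃[ i ] y ≡ w i → y ∈ R
        in-R (i , y≡) = complete (subst (Edge B) (sym y≡β) (β-edge j (subst (λ z → + g ℤ.< z +ᶻ z) y≡β
          (ℤ.<-trans (proj₁ (sound x∈R)) (ℤ.+-mono-< x<y x<y)))))
          where
          j = proj₁ (chosen i)
          y≡β : y ≡ β j +ᶻ 1ℤ
          y≡β = trans y≡ (cong (_+ᶻ 1ℤ) (proj₂ (chosen i)))
          x<y : x ℤ.< y
          x<y = subst₂ ℤ._<_ (sym x≡) (sym y≡) (ℤ.+-monoˡ-< 1ℤ (βₖ<v i))
      covered : ∀ {k x} → x ∈ R → x ≡ β k +ᶻ 1ℤ → (∃[ i ] v i ≡ β k) ⊎ (∀ i → β k ℤ.< v i) → x ∈ tabulate w
      covered x∈R x≡ (inj₁ (i , vᵢ≡βₖ)) =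
        subst (_∈ tabulate w) (trans (cong (_+ᶻ 1ℤ) vᵢ≡βₖ) (sym x≡)) (∈-tabulate⁺ i)
      -- All t entries of w exceed x, hence lie in R, which has only t elements, one of them x.
      covered x∈R x≡ (inj₂ βₖ<v) = ∈-resp-↭ (↭.↭-sym (unique-⊆⇒↭ w-unique (raised x∈R x≡ βₖ<v)
        (ℕ.≤-reflexive (trans length≡t (sym (List.length-tabulate w)))))) x∈R
      R⊆w : ∀ {x} → x ∈ R → x ∈ tabulate w
      R⊆w x∈R = covered x∈R (proj₂ (edge-β (sound x∈R))) (largest (proj₁ (edge-β (sound x∈R))))

-- The size formula

module Size (t g : ℕ) (1+g≡t+t : suc g ≡ t ℕ.+ t) where
  open Evolution t g 1+g≡t+t
  open Sums ℤ.+-0-abelianGroup using (sum; sum<; sum<-cong; sum<-⊖; sum<-suc; sum-↭; sum-cong)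
  open ShapeSums ℤ.+-0-abelianGroup using (beadSum; sum<-reverse)
  open EdgeSums ℤ.+-0-abelianGroup t g 1+g≡t+t using (evolveSum; sum-tabulate)
  open ≡-Reasoning

  -- This is 4r² at w = r + g/2, which keeps the half-integers out of the computation.
  square : ℤ → ℤ
  square w = (w +ᶻ w -ᶻ + g) *ᶻ (w +ᶻ w -ᶻ + g)

  size≡sum : ∀ xs → + ℕ.sum xs ≡ sum< (length xs) (λ i → + lookup₀ xs i)
  size≡sum []       = refl
  size≡sum (x ∷ xs) = trans (cong (+ x +ᶻ_) (size≡sum xs))
    (sym (sum<-suc (length xs) (λ i → + lookup₀ (x ∷ xs) i)))

  size≡beads : ∀ {ƛ B} → Shape (part ƛ) (col ƛ) B → + size ƛ ≡ sum B (λ X → + X +ᶻ + X)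
  size≡beads {ƛ} {B} shp = begin
    + size ƛ
      ≡⟨ size≡sum (parts ƛ) ⟩
    sum< N (λ i → + part ƛ i)
      ≡⟨ sum<-cong N (λ {i} _ → ring (+ part ƛ i) (+ i)) ⟩
    sum< N (λ i → (+ part ƛ i -ᶻ + i) -ᶻ - + i)
      ≡⟨ sum<-⊖ N _ _ ⟩
    sum< N (λ i → + part ƛ i -ᶻ + i) -ᶻ sum< N (λ i → - + i)
      ≡⟨ cong (_-ᶻ sum< N (λ i → - + i)) (beadSum N (λ z → z) shp (lookup₀-length (parts ƛ))) ⟩
    sum< N (λ i → - + i) +ᶻ sum B (λ Z → + Z -ᶻ - + Z) -ᶻ sum< N (λ i → - + i)
      ≡⟨ ring′ (sum< N (λ i → - + i)) _ ⟩
    sum B (λ Z → + Z -ᶻ - + Z)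
      ≡⟨ sum-cong B (λ Z → cong (+ Z +ᶻ_) (ℤ.neg-involutive (+ Z))) ⟩
    sum B (λ Z → + Z +ᶻ + Z) ∎
    where
    N = length (parts ƛ)
    ring : ∀ p i → p ≡ (p -ᶻ i) -ᶻ - i
    ring = solve-∀
    ring′ : ∀ a b → a +ᶻ b -ᶻ a ≡ b
    ring′ = solve-∀

  odd-squares : ∀ n → + 3 *ᶻ sum< n (λ i → (+ i +ᶻ + suc i) *ᶻ (+ i +ᶻ + suc i))
    ≡ + n *ᶻ (+ n +ᶻ + n -ᶻ 1ℤ) *ᶻ (+ n +ᶻ + n +ᶻ 1ℤ)
  odd-squares zero    = refl
  odd-squares (suc n) = trans (ring₁ (sum< n (λ i → (+ i +ᶻ + suc i) *ᶻ (+ i +ᶻ + suc i))) (+ n))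
    (trans (cong (_+ᶻ + 3 *ᶻ ((+ n +ᶻ + suc n) *ᶻ (+ n +ᶻ + suc n))) (odd-squares n)) (ring₂ (+ n)))
    where
    ring₁ : ∀ s n → + 3 *ᶻ (s +ᶻ (n +ᶻ (1ℤ +ᶻ n)) *ᶻ (n +ᶻ (1ℤ +ᶻ n))) ≡ + 3 *ᶻ s +ᶻ + 3 *ᶻ
      ((n +ᶻ (1ℤ +ᶻ n)) *ᶻ (n +ᶻ (1ℤ +ᶻ n)))
    ring₁ = solve-∀
    ring₂ : ∀ n → n *ᶻ (n +ᶻ n -ᶻ 1ℤ) *ᶻ (n +ᶻ n +ᶻ 1ℤ) +ᶻ + 3 *ᶻ ((n +ᶻ (1ℤ +ᶻ n)) *ᶻ (n +ᶻ (1ℤ +ᶻ n)))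
      ≡ (1ℤ +ᶻ n) *ᶻ ((1ℤ +ᶻ n) +ᶻ (1ℤ +ᶻ n) -ᶻ 1ℤ) *ᶻ ((1ℤ +ᶻ n) +ᶻ (1ℤ +ᶻ n) +ᶻ 1ℤ)
    ring₂ = solve-∀

  +g≡ : + g ≡ + t +ᶻ + t -ᶻ 1ℤ
  +g≡ = trans (ring (+ g)) (cong (λ n → + n -ᶻ 1ℤ) 1+g≡t+t)
    where
    ring : ∀ g → g ≡ (1ℤ +ᶻ g) -ᶻ 1ℤ
    ring = solve-∀

  -- The values 2r of the empty diagram are the odd numbers 1, 3, ..., 2t - 1. Divided by 12g, the
  -- right-hand side is the constant of the theorem, as t = ⌊g/2⌋ + 1.
  ground-squares : + 3 *ᶻ sum (tabulate ground) square ≡ + t *ᶻ + g *ᶻ (+ g +ᶻ + 2)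
  ground-squares = begin
    + 3 *ᶻ sum (tabulate ground) square
      ≡⟨ cong (+ 3 *ᶻ_) (sum-tabulate t (λ i → + g -ᶻ + i) square) ⟩
    + 3 *ᶻ sum< t (λ i → square (+ g -ᶻ + i))
      ≡⟨ cong (+ 3 *ᶻ_) (sum<-cong t (λ {i} _ → trans
        (cong (λ γ → ((γ -ᶻ + i) +ᶻ (γ -ᶻ + i) -ᶻ γ) *ᶻ ((γ -ᶻ + i) +ᶻ (γ -ᶻ + i) -ᶻ γ)) +g≡)
          (ring₁ (+ t) (+ i)))) ⟩
    + 3 *ᶻ sum< t (λ i → F (+ t -ᶻ + i))
      ≡⟨ cong (+ 3 *ᶻ_) (sum<-reverse t F) ⟩
    + 3 *ᶻ sum< t (λ i → F (+ suc i))
      ≡⟨ cong (+ 3 *ᶻ_) (sum<-cong t (λ {i} _ → ring₂ (+ i))) ⟩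
    + 3 *ᶻ sum< t (λ i → (+ i +ᶻ + suc i) *ᶻ (+ i +ᶻ + suc i))
      ≡⟨ odd-squares t ⟩
    + t *ᶻ (+ t +ᶻ + t -ᶻ 1ℤ) *ᶻ (+ t +ᶻ + t +ᶻ 1ℤ)
      ≡⟨ ring₃ (+ t) ⟩
    + t *ᶻ (+ t +ᶻ + t -ᶻ 1ℤ) *ᶻ (+ t +ᶻ + t -ᶻ 1ℤ +ᶻ + 2)
      ≡⟨ cong (λ γ → + t *ᶻ γ *ᶻ (γ +ᶻ + 2)) +g≡ ⟨
    + t *ᶻ + g *ᶻ (+ g +ᶻ + 2) ∎
    where
    F : ℤ → ℤ
    F z = (z +ᶻ z -ᶻ 1ℤ) *ᶻ (z +ᶻ z -ᶻ 1ℤ)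
    ring₁ : ∀ t i → ((t +ᶻ t -ᶻ 1ℤ -ᶻ i) +ᶻ (t +ᶻ t -ᶻ 1ℤ -ᶻ i) -ᶻ (t +ᶻ t -ᶻ 1ℤ)) *ᶻ
      ((t +ᶻ t -ᶻ 1ℤ -ᶻ i) +ᶻ (t +ᶻ t -ᶻ 1ℤ -ᶻ i) -ᶻ (t +ᶻ t -ᶻ 1ℤ))
      ≡ ((t -ᶻ i) +ᶻ (t -ᶻ i) -ᶻ 1ℤ) *ᶻ ((t -ᶻ i) +ᶻ (t -ᶻ i) -ᶻ 1ℤ)
    ring₁ = solve-∀
    ring₂ : ∀ i → ((1ℤ +ᶻ i) +ᶻ (1ℤ +ᶻ i) -ᶻ 1ℤ) *ᶻ ((1ℤ +ᶻ i) +ᶻ (1ℤ +ᶻ i) -ᶻ 1ℤ) ≡ (i +ᶻ (1ℤ +ᶻ i)) *ᶻ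
      (i +ᶻ (1ℤ +ᶻ i))
    ring₂ = solve-∀
    ring₃ : ∀ t → t *ᶻ (t +ᶻ t -ᶻ 1ℤ) *ᶻ (t +ᶻ t +ᶻ 1ℤ) ≡ t *ᶻ (t +ᶻ t -ᶻ 1ℤ) *ᶻ (t +ᶻ t -ᶻ 1ℤ +ᶻ + 2)
    ring₃ = solve-∀

  -- A bead X contributes (2X + g)² - (2X - g)² = 4g · 2X, and the beads 2X add up to the size. The
  -- factor 3 clears the denominator in the sum of odd squares.
  squares≡size : ∀ {ƛ B R} → Shape (part ƛ) (col ƛ) B → Evolves B R →
    + 3 *ᶻ sum R square ≡ + t *ᶻ + g *ᶻ (+ g +ᶻ + 2) +ᶻ + 12 *ᶻ + g *ᶻ + size ƛ
  squares≡size {ƛ} {B} {R} shp evolves = begin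
    + 3 *ᶻ sum R square
      ≡⟨ cong (+ 3 *ᶻ_) (evolveSum square (λ w → reflect (+ g) w) evolves) ⟩
    + 3 *ᶻ (sum (tabulate ground) square +ᶻ sum B (λ X → square (+ X +ᶻ + g) -ᶻ square (+ X)))
      ≡⟨ cong (λ z → + 3 *ᶻ (sum (tabulate ground) square +ᶻ z)) (increments B) ⟩
    + 3 *ᶻ (sum (tabulate ground) square +ᶻ + 4 *ᶻ + g *ᶻ sum B (λ X → + X +ᶻ + X))
      ≡⟨ ring (sum (tabulate ground) square) (+ g) (sum B (λ X → + X +ᶻ + X)) ⟩
    + 3 *ᶻ sum (tabulate ground) square +ᶻ + 12 *ᶻ + g *ᶻ sum B (λ X → + X +ᶻ + X)
      ≡⟨ cong₂ (λ a b → a +ᶻ + 12 *ᶻ + g *ᶻ b) ground-squares (sym (size≡beads {ƛ} shp)) ⟩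
    + t *ᶻ + g *ᶻ (+ g +ᶻ + 2) +ᶻ + 12 *ᶻ + g *ᶻ + size ƛ ∎
    where
    reflect : ∀ g w → ((g -ᶻ w) +ᶻ (g -ᶻ w) -ᶻ g) *ᶻ ((g -ᶻ w) +ᶻ (g -ᶻ w) -ᶻ g) ≡ (w +ᶻ w -ᶻ g) *ᶻ
      (w +ᶻ w -ᶻ g)
    reflect = solve-∀
    increment : ∀ x g s → ((x +ᶻ g) +ᶻ (x +ᶻ g) -ᶻ g) *ᶻ ((x +ᶻ g) +ᶻ (x +ᶻ g) -ᶻ g) -ᶻ (x +ᶻ x -ᶻ g) *ᶻ
      (x +ᶻ x -ᶻ g) +ᶻ + 4 *ᶻ g *ᶻ s
      ≡ + 4 *ᶻ g *ᶻ (x +ᶻ x +ᶻ s)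
    increment = solve-∀
    increments : ∀ B → sum B (λ X → square (+ X +ᶻ + g) -ᶻ square (+ X)) ≡ + 4 *ᶻ + g *ᶻ sum B
      (λ X → + X +ᶻ + X)
    increments []      = sym (ℤ.*-zeroʳ (+ 4 *ᶻ + g))
    increments (X ∷ B) = trans (cong (square (+ X +ᶻ + g) -ᶻ square (+ X) +ᶻ_) (increments B))
      (increment (+ X) (+ g) (sum B (λ X → + X +ᶻ + X)))
    ring : ∀ a g s → + 3 *ᶻ (a +ᶻ + 4 *ᶻ g *ᶻ s) ≡ + 3 *ᶻ a +ᶻ + 12 *ᶻ g *ᶻ s
    ring = solve-∀

  open +-*-Solver using (solve; _:=_; _:+_; _:-_; _:*_; con)

  toℚᵘ-/ : ∀ x n → toℚᵘ (x ℚ./ suc n) ℚᵘ.≃ mkℚᵘ x n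
  toℚᵘ-/ x n = ℚ.toℚᵘ-fromℚᵘ (mkℚᵘ x n)

  /1-*-/ : ∀ x y n .{{_ : NonZero n}} → (x *ᶻ y) ℚ./ n ≡ (x ℚ./ 1) ℚ.* (y ℚ./ n)
  /1-*-/ x y (suc n) = ℚ.toℚᵘ-injective (ℚᵘ.≃-trans (toℚᵘ-/ (x *ᶻ y) n)
    (ℚᵘ.≃-trans (*≡* (cong (λ m → x *ᶻ y *ᶻ + m) (ℕ.*-identityˡ (suc n))))
      (ℚᵘ.≃-sym (ℚᵘ.≃-trans (ℚ.toℚᵘ-homo-* (x ℚ./ 1) (y ℚ./ suc n)) (ℚᵘ.*-cong (toℚᵘ-/ x 0) (toℚᵘ-/ y n))))))

  n/n≡1 : ∀ n .{{_ : NonZero n}} → + n ℚ./ n ≡ 1ℚ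
  n/n≡1 (suc n) = ℚ.toℚᵘ-injective (ℚᵘ.≃-trans (toℚᵘ-/ (+ suc n) n)
    (*≡* (ℤ.*-comm (+ suc n) 1ℤ)))

  -- Each 4r² is the square of r + r, which `r-sum` identifies with an integer.
  ∑ℚ-squares : ∀ n (v : Vector ℤ n) →
    (+ 4 ℚ./ 1) ℚ.* ∑ℚ (λ i → r g (v i) ℚ.* r g (v i)) ≡ sum (tabulate (λ i → v i +ᶻ 1ℤ)) square ℚ./ 1
  ∑ℚ-squares zero    v = refl
  ∑ℚ-squares (suc n) v = begin
    four ℚ.* (r₀ ℚ.* r₀ ℚ.+ rest)
      ≡⟨ solve 2 (λ a b → con four :* (a :* a :+ b) := (a :+ a) :* (a :+ a) :+ con four :* b) refl r₀ rest ⟩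
    (r₀ ℚ.+ r₀) ℚ.* (r₀ ℚ.+ r₀) ℚ.+ four ℚ.* rest
      ≡⟨ cong₂ (λ a b → a ℚ.* a ℚ.+ b) (sym (trans (cong (ℚ._/ 1) (ring (v zero) (+ g)))
        (proj₂ (r-sum g (v zero) (v zero))))) (∑ℚ-squares n (λ i → v (suc i))) ⟩
    (z ℚ./ 1) ℚ.* (z ℚ./ 1) ℚ.+ sum (tabulate (λ i → v (suc i) +ᶻ 1ℤ)) square ℚ./ 1
      ≡⟨ cong (ℚ._+ sum (tabulate (λ i → v (suc i) +ᶻ 1ℤ)) square ℚ./ 1) (/1-*-/ z z 1) ⟨
    square (v zero +ᶻ 1ℤ) ℚ./ 1 ℚ.+ sum (tabulate (λ i → v (suc i) +ᶻ 1ℤ)) square ℚ./ 1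
      ≡⟨ /1-homo-+ (square (v zero +ᶻ 1ℤ)) _ ⟨
    sum (tabulate (λ i → v i +ᶻ 1ℤ)) square ℚ./ 1 ∎
    where
    four = + 4 ℚ./ 1
    r₀ = r g (v zero)
    rest = ∑ℚ (λ i → r g (v (suc i)) ℚ.* r g (v (suc i)))
    z = (v zero +ᶻ 1ℤ) +ᶻ (v zero +ᶻ 1ℤ) -ᶻ + g
    ring : ∀ x g → (x +ᶻ 1ℤ) +ᶻ (x +ᶻ 1ℤ) -ᶻ g ≡ x +ᶻ x -ᶻ g +ᶻ + 2
    ring = solve-∀

  half-g : g ℕ./ 2 ℕ.+ 1 ≡ t
  half-g = go t g 1+g≡t+t
    where
    go : ∀ t g → suc g ≡ t ℕ.+ t → g ℕ./ 2 ℕ.+ 1 ≡ t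
    go (suc n) g eq = begin
      g ℕ./ 2 ℕ.+ 1               ≡⟨ cong (λ m → m ℕ./ 2 ℕ.+ 1) g≡ ⟩
      (1 ℕ.+ n ℕ.* 2) ℕ./ 2 ℕ.+ 1 ≡⟨ cong (ℕ._+ 1) (ℕ.+-distrib-/-∣ʳ 1 {n ℕ.* 2} {2} (ℕ.divides n refl)) ⟩
      n ℕ.* 2 ℕ./ 2 ℕ.+ 1         ≡⟨ cong (ℕ._+ 1) (ℕ.m*n/n≡m n 2) ⟩
      n ℕ.+ 1                     ≡⟨ ℕ.+-comm n 1 ⟩
      suc n                       ∎
      where
      g≡ : g ≡ 1 ℕ.+ n ℕ.* 2
      g≡ = trans (ℕ.suc-injective eq) (trans (ℕ.+-suc n n)
        (cong suc (trans (cong (n ℕ.+_) (sym (ℕ.+-identityʳ n))) (ℕ.*-comm 2 n))))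

  size-formula : .{{_ : NonZero g}} → ∀ {ƛ B R} (v : Vector ℤ t) → Shape (part ƛ) (col ƛ) B → Evolves B R →
    R ↭ tabulate (λ i → v i +ᶻ 1ℤ) →
    (+ size ƛ) ℚ./ 1
      ≡ ((+ 1) ℚ./ g) ℚ.* ∑ℚ (λ i → r g (v i) ℚ.* r g (v i)) ℚ.- (+ ((g ℕ.+ 2) ℕ.* (g ℕ./ 2 ℕ.+ 1))) ℚ./ 12
  size-formula {ƛ} {B} {R} v shp evolves R↭w = begin
    s
      ≡⟨ solve 2 (λ s k → s := s :+ con e :* k :- con e :* k) refl s k ⟩
    s ℚ.+ e ℚ.* k ℚ.- e ℚ.* k
      -- The factor 1 is exposed to be rewritten as `q ℚ.* γ`; the next step is then a polynomial
      -- identity in which q is a free variable.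
      ≡⟨ solve 2 (λ a b → a :- b := con 1ℚ :* a :- b) refl (s ℚ.+ e ℚ.* k) (e ℚ.* k) ⟩
    1ℚ ℚ.* (s ℚ.+ e ℚ.* k) ℚ.- e ℚ.* k
      ≡⟨ cong (λ z → z ℚ.* (s ℚ.+ e ℚ.* k) ℚ.- e ℚ.* k) qγ≡1 ⟨
    q ℚ.* γ ℚ.* (s ℚ.+ e ℚ.* k) ℚ.- e ℚ.* k
      ≡⟨ solve 4 (λ s γ τ q → q :* γ :* (s :+ con e :* (τ :* (γ :+ con two))) :- con e :*
        (τ :* (γ :+ con two))
           := q :* con e :* (τ :* γ :* (γ :+ con two) :+ con twelve :* γ :* s) :- con e :*
             (τ :* (γ :+ con two))) refl s γ τ q ⟩
    q ℚ.* e ℚ.* (τ ℚ.* γ ℚ.* (γ ℚ.+ two) ℚ.+ twelve ℚ.* γ ℚ.* s) ℚ.- e ℚ.* k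
      ≡⟨ cong (λ z → q ℚ.* e ℚ.* z ℚ.- e ℚ.* k) twelve-S ⟨
    q ℚ.* e ℚ.* (twelve ℚ.* S) ℚ.- e ℚ.* k
      ≡⟨ solve 3 (λ q S k → q :* con e :* (con twelve :* S) :- con e :* k := q :* S :- k :* con e) refl
        q S k ⟩
    q ℚ.* S ℚ.- k ℚ.* e
      ≡⟨ cong (λ z → q ℚ.* S ℚ.- z) constant ⟨
    q ℚ.* S ℚ.- (+ ((g ℕ.+ 2) ℕ.* (g ℕ./ 2 ℕ.+ 1))) ℚ./ 12 ∎
    where
    s = + size ƛ ℚ./ 1
    γ = + g ℚ./ 1
    τ = + t ℚ./ 1
    q = + 1 ℚ./ g
    e = + 1 ℚ./ 12
    two = + 2 ℚ./ 1
    twelve = + 12 ℚ./ 1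
    k = τ ℚ.* (γ ℚ.+ two)
    S = ∑ℚ (λ i → r g (v i) ℚ.* r g (v i))
    qγ≡1 : q ℚ.* γ ≡ 1ℚ
    qγ≡1 = trans (ℚ.*-comm q γ) (trans (sym (/1-*-/ (+ g) 1ℤ g))
      (trans (cong (ℚ._/ g) (ℤ.*-identityʳ (+ g))) (n/n≡1 g)))
    constant : + ((g ℕ.+ 2) ℕ.* (g ℕ./ 2 ℕ.+ 1)) ℚ./ 12 ≡ k ℚ.* e
    constant = begin
      + ((g ℕ.+ 2) ℕ.* (g ℕ./ 2 ℕ.+ 1)) ℚ./ 12
        ≡⟨ cong (ℚ._/ 12) (trans (cong (λ t → + ((g ℕ.+ 2) ℕ.* t)) half-g)
          (trans (ℤ.pos-* (g ℕ.+ 2) t) (ring (+ g +ᶻ + 2) (+ t)))) ⟩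
      (+ t *ᶻ (+ g +ᶻ + 2) *ᶻ 1ℤ) ℚ./ 12
        ≡⟨ /1-*-/ (+ t *ᶻ (+ g +ᶻ + 2)) 1ℤ 12 ⟩
      ((+ t *ᶻ (+ g +ᶻ + 2)) ℚ./ 1) ℚ.* e
        ≡⟨ cong (ℚ._* e) (trans (/1-*-/ (+ t) (+ g +ᶻ + 2) 1) (cong (τ ℚ.*_) (/1-homo-+ (+ g) (+ 2)))) ⟩
      k ℚ.* e ∎
      where
      ring : ∀ a t → a *ᶻ t ≡ t *ᶻ a *ᶻ 1ℤ
      ring = solve-∀
    twelve-S : twelve ℚ.* S ≡ τ ℚ.* γ ℚ.* (γ ℚ.+ two) ℚ.+ twelve ℚ.* γ ℚ.* s
    twelve-S = begin
      twelve ℚ.* S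
        ≡⟨ solve 1 (λ S → con twelve :* S := con (+ 3 ℚ./ 1) :* (con (+ 4 ℚ./ 1) :* S)) refl S ⟩
      (+ 3 ℚ./ 1) ℚ.* ((+ 4 ℚ./ 1) ℚ.* S)
        ≡⟨ cong ((+ 3 ℚ./ 1) ℚ.*_) (trans (∑ℚ-squares t v) (cong (ℚ._/ 1) (sym (sum-↭ square R↭w)))) ⟩
      (+ 3 ℚ./ 1) ℚ.* (sum R square ℚ./ 1)
        ≡⟨ /1-*-/ (+ 3) (sum R square) 1 ⟨
      (+ 3 *ᶻ sum R square) ℚ./ 1
        ≡⟨ cong (ℚ._/ 1) (squares≡size {ƛ} shp evolves) ⟩
      (+ t *ᶻ + g *ᶻ (+ g +ᶻ + 2) +ᶻ + 12 *ᶻ + g *ᶻ + size ƛ) ℚ./ 1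
        ≡⟨ /1-homo-+ (+ t *ᶻ + g *ᶻ (+ g +ᶻ + 2)) (+ 12 *ᶻ + g *ᶻ + size ƛ) ⟩
      (+ t *ᶻ + g *ᶻ (+ g +ᶻ + 2)) ℚ./ 1 ℚ.+ (+ 12 *ᶻ + g *ᶻ + size ƛ) ℚ./ 1
        ≡⟨ cong₂ ℚ._+_ (trans (/1-*-/ (+ t *ᶻ + g) (+ g +ᶻ + 2) 1)
          (cong₂ ℚ._*_ (/1-*-/ (+ t) (+ g) 1) (/1-homo-+ (+ g) (+ 2))))
                       (trans (/1-*-/ (+ 12 *ᶻ + g) (+ size ƛ) 1) (cong (ℚ._* s) (/1-*-/ (+ 12) (+ g) 1))) ⟩
      τ ℚ.* γ ℚ.* (γ ℚ.+ two) ℚ.+ twelve ℚ.* γ ℚ.* s ∎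

-- Units as an abelian group

module UnitGroup {c ℓ} (M : CommutativeMonoid c ℓ) where

  open CommutativeMonoid M
    renaming (ε to 1#; refl to ≈-refl; sym to ≈-sym; trans to ≈-trans)
  open import Algebra.Properties.CommutativeSemigroup commutativeSemigroup using (interchange)
  open SetoidReasoning setoid

  -- Since the inverse is stored, the value of a difference of units computes to the quotient `÷` of
  -- the theorem.
  record Unit : Set (c ⊔ˡ ℓ) where
    constructor mkUnit
    field
      value   : Carrier
      inverse : Carrier
      unital  : value ∙ inverse ≈ 1#

  open Unit public

  -- A record, so that both sides can be inferred from a proof.
  record _≈ᵘ_ (u v : Unit) : Set ℓ where
    constructor equal
    field value≈ : value u ≈ value v

  open _≈ᵘ_ public

  units : AbelianGroup (c ⊔ˡ ℓ) ℓ
  units = record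
    { Carrier = Unit
    ; _≈_ = _≈ᵘ_
    ; _∙_ = λ u v → mkUnit (value u ∙ value v) (inverse u ∙ inverse v)
        (≈-trans (interchange (value u) (value v) (inverse u) (inverse v))
          (≈-trans (∙-cong (unital u) (unital v)) (identityˡ 1#)))
    ; ε = mkUnit 1# 1# (identityˡ 1#)
    ; _⁻¹ = λ u → mkUnit (inverse u) (value u) (≈-trans (comm (inverse u) (value u)) (unital u))
    ; isAbelianGroup = record
      { isGroup = record
        { isMonoid = record
          { isSemigroup = record
            { isMagma = record
              { isEquivalence = record
                { refl  = equal ≈-refl
                ; sym   = λ (equal e) → equal (≈-sym e)
                ; trans = λ (equal e) (equal f) → equal (≈-trans e f)
                }
              ; ∙-cong = λ (equal e) (equal f) → equal (∙-cong e f)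
              }
            ; assoc = λ u v w → equal (assoc (value u) (value v) (value w))
            }
          ; identity = (λ u → equal (identityˡ (value u))) , (λ u → equal (identityʳ (value u)))
          }
        ; inverse = (λ u → equal (≈-trans (comm (inverse u) (value u)) (unital u))) , (λ u → equal (unital u))
        ; ⁻¹-cong = λ {u} {v} (equal e) → equal (inverse-cong u v e)
        }
      ; comm = λ u v → equal (comm (value u) (value v))
      }
    }
    where
    inverse-cong : ∀ u v → value u ≈ value v → inverse u ≈ inverse v
    inverse-cong u v u≈v = begin
      inverse u                            ≈⟨ identityʳ (inverse u) ⟨
      inverse u ∙ 1#                       ≈⟨ ∙-congˡ (unital v) ⟨
      inverse u ∙ (value v ∙ inverse v)    ≈⟨ ∙-congˡ (∙-congʳ u≈v) ⟨
      inverse u ∙ (value u ∙ inverse v)    ≈⟨ assoc (inverse u) (value u) (inverse v) ⟨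
      inverse u ∙ value u ∙ inverse v      ≈⟨ ∙-congʳ (≈-trans (comm (inverse u) (value u)) (unital u)) ⟩
      1# ∙ inverse v                       ≈⟨ identityˡ (inverse v) ⟩
      inverse v                            ∎

-- Filtered sums, double sums and sums over pairs of indices

module FilterSums {a ℓ} (G : AbelianGroup a ℓ) where
  open Sums G
  open BoxSums G
  open Mult (AbelianGroup.monoid G) using () renaming (_×_ to _⋆ⁿ_)

  module _ {b p} {A : Set b} {P : A → Set p} (P? : Decidable P) where

    sum-filter : ∀ xs (F : A → Carrier) →
      sum (filter P? xs) F ≈ (∑[ x ∈ xs ] (if does (P? x) then F x else 𝟘))
    sum-filter []       F = ≈-refl
    sum-filter (x ∷ xs) F with does (P? x)
    ... | true  = ⊕-congˡ (sum-filter xs F)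
    ... | false = ≈-trans (sum-filter xs F) (≈-sym (⊕-identityˡ _))

    sum-filter-cong : ∀ xs {F H : A → Carrier} → (∀ x → P x → F x ≈ H x) →
      sum (filter P? xs) F ≈ sum (filter P? xs) H
    sum-filter-cong []       F≈H = ≈-refl
    sum-filter-cong (x ∷ xs) F≈H with P? x
    ... | yes px = ⊕-cong (F≈H x px) (sum-filter-cong xs F≈H)
    ... | no _   = sum-filter-cong xs F≈H

    sum-const : ∀ xs e → (∑[ x ∈ xs ] (if does (P? x) then e else 𝟘)) ≈ length (filter P? xs) ⋆ⁿ e
    sum-const []       e = ≈-refl
    sum-const (x ∷ xs) e with does (P? x)
    ... | true  = ⊕-congˡ (sum-const xs e)
    ... | false = ≈-trans (⊕-identityˡ _) (sum-const xs e)

  if-yes : ∀ {p} {P : Set p} {x y : Carrier} (P? : Dec P) → P → (if does P? then x else y) ≈ x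
  if-yes (yes _) _ = ≈-refl
  if-yes (no ¬p) p = contradiction p ¬p

  if-no : ∀ {p} {P : Set p} {x y : Carrier} (P? : Dec P) → ¬ P → (if does P? then x else y) ≈ y
  if-no (yes p) ¬p = contradiction p ¬p
  if-no (no _)  _  = ≈-refl

  sum-𝟘 : ∀ {b} {A : Set b} (xs : List A) → (∑[ x ∈ xs ] 𝟘) ≈ 𝟘
  sum-𝟘 []       = ≈-refl
  sum-𝟘 (x ∷ xs) = ≈-trans (⊕-identityˡ _) (sum-𝟘 xs)

  sum-swap : ∀ {b d} {A : Set b} {D : Set d} (xs : List A) (ys : List D) (F : A → D → Carrier) →
    (∑[ x ∈ xs ] ∑[ y ∈ ys ] F x y) ≈ (∑[ y ∈ ys ] ∑[ x ∈ xs ] F x y)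
  sum-swap []       ys F = ≈-sym (sum-𝟘 ys)
  sum-swap (x ∷ xs) ys F = ≈-trans (⊕-congˡ (sum-swap xs ys F)) (≈-sym (sum-⊕ ys _ _))

  sum<-single : ∀ n (F : ℕ → Carrier) {k} → k < n → (∀ {i} → i ≢ k → F i ≈ 𝟘) → sum< n F ≈ F k
  sum<-single (suc n) F {k} k<1+n F≈0 with k ℕ.≟ n
  ... | yes refl = ≈-trans (⊕-congʳ (sum<-≡0 n λ i<n → F≈0 (ℕ.<⇒≢ i<n))) (⊕-identityˡ _)
  ... | no k≢n = ≈-trans (⊕-cong (sum<-single n F (ℕ.≤∧≢⇒< (ℕ.s≤s⁻¹ k<1+n) k≢n) F≈0)
    (F≈0 (λ n≡k → k≢n (sym n≡k)))) (⊕-identityʳ _)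

  sum-cartesianProduct : ∀ {b d} {A : Set b} {D : Set d} (xs : List A) (ys : List D) F →
    sum (cartesianProduct xs ys) F ≈ (∑[ x ∈ xs ] ∑[ y ∈ ys ] F (x , y))
  sum-cartesianProduct []       ys F = ≈-refl
  sum-cartesianProduct (x ∷ xs) ys F = ≈-trans (sum-++ (map (x ,_) ys) _ F)
    (⊕-cong (sum-map (x ,_) ys F) (sum-cartesianProduct xs ys F))

  sum-tabulate-∘ : ∀ {b d} {A : Set b} {D : Set d} {n} (h : A → D) (f : Fin n → A) F →
    sum (tabulate (λ i → h (f i))) F ≈ (∑[ x ∈ tabulate f ] F (h x))
  sum-tabulate-∘ {n = zero}  h f F = ≈-refl
  sum-tabulate-∘ {n = suc n} h f F = ⊕-congˡ (sum-tabulate-∘ h (λ i → f (suc i)) F)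

  sum-pairs : ∀ {b} {A : Set b} {n} (H : A → A → Carrier) (f : Fin n → A) →
    (∑[ ij ∈ pairs n ] H (f (proj₁ ij)) (f (proj₂ ij))) ≈ pairSum H (tabulate f)
  sum-pairs {n = n} H f = ≈-trans (sum-filter (λ (i , j) → i Fin.<? j)
    (cartesianProduct (allFin n) (allFin n)) _)
    (≈-trans (sum-cartesianProduct (allFin n) (allFin n) _) (go f))
    where
    term : ∀ {n} → (Fin n → _) → Fin n → Fin n → Carrier
    term f i j = if does (i Fin.<? j) then H (f i) (f j) else 𝟘
    go : ∀ {n} (f : Fin n → _) → (∑[ i ∈ allFin n ] ∑[ j ∈ allFin n ] term f i j) ≈ pairSum H (tabulate f)
    go {zero}  f = ≈-refl
    go {suc n} f = ⊕-cong
      (≈-trans (⊕-identityˡ _) (≈-trans (sum-tabulate-∘ suc (λ j → j) (term f zero))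
        (≈-sym (sum-tabulate-∘ (λ j → f (suc j)) (λ j → j) (H (f zero))))))
      (≈-trans (sum-tabulate-∘ suc (λ i → i) (λ i → sum (allFin (suc n)) (term f i)))
        (≈-trans (sum-cong (allFin n) λ i → ≈-trans (⊕-identityˡ _)
          (sum-tabulate-∘ suc (λ j → j) (term f (suc i))))
          (go (λ i → f (suc i)))))

-- The product formula

module Products {c ℓ₁ ℓ₂} (F : HeytingField c ℓ₁ ℓ₂) (τ : ℤ → FieldNotation.F× F) where
  open FieldNotation F using (_÷_; ⁻¹-inverseʳ; ∏; _^_; F×) renaming (_⁻¹ to _⁻¹ᶠ; Carrier to C; _≈_ to _≈ᶠ_)

  open UnitGroup (CommutativeRing.*-commutativeMonoid
    (HeytingCommutativeRing.commutativeRing (HeytingField.heytingCommutativeRing F)))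
    public using (mkUnit; value; value≈) renaming (units to Units)

  open Sums Units
  open ShapeSums Units using (resp; hooksSum)
  open BoxSums Units
  open FilterSums Units
  open Mult (AbelianGroup.monoid Units) using () renaming (_×_ to _⋆ⁿ_)
  open SetoidReasoning setoid

  unit : F× → Carrier
  unit u = mkUnit (proj₁ u) (u ⁻¹ᶠ) (⁻¹-inverseʳ u)

  ∏≡sum : ∀ {b} {A : Set b} (xs : List A) (f : A → Carrier) → ∏ xs (λ x → value (f x)) ≡ value (sum xs f)
  ∏≡sum []       f = refl
  ∏≡sum (x ∷ xs) f = cong (HeytingField._*_ F (value (f x))) (∏≡sum xs f)

  ^≡⋆ : ∀ u n → value u ^ n ≡ value (n ⋆ⁿ u)
  ^≡⋆ u zero    = refl
  ^≡⋆ u (suc n) = cong (HeytingField._*_ F (value u)) (^≡⋆ u n)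

  ∏^≡sum : ∀ {b} {A : Set b} (xs : List A) (n : A → ℕ) (f : A → Carrier) →
    ∏ xs (λ x → value (f x) ^ n x) ≡ value (∑[ x ∈ xs ] n x ⋆ⁿ f x)
  ∏^≡sum []       n f = refl
  ∏^≡sum (x ∷ xs) n f = cong₂ (HeytingField._*_ F) (^≡⋆ (f x) (n x)) (∏^≡sum xs n f)

  T′ : ℤ → Carrier
  T′ z = unit (τ z)

  T : ℤ → Carrier
  T z = T′ (+ ∣ z ∣)

  T-even : ∀ z → T (- z) ≈ T z
  T-even z = reflexive (cong (λ n → T′ (+ n)) (ℤ.∣-i∣≡∣i∣ z))

  T-nonNegative : ∀ {z} → 0ℤ ℤ.≤ z → T z ≈ T′ z
  T-nonNegative 0≤z = resp T′ (ℤ.0≤i⇒+∣i∣≡i 0≤z)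

  module _ (t g : ℕ) (1+g≡t+t : suc g ≡ t ℕ.+ t) where
    open Evolution t g 1+g≡t+t
    open EdgeSums Units t g 1+g≡t+t using (K; φ; pairSum-evolve; sum-tabulate; K-sym)

    boxUnit : Partition → Box → Carrier
    boxUnit ƛ s = T′ (+ hook ƛ s -ᶻ ε s *ᶻ + g) ⊖ T′ (+ hook ƛ s)

    signUnit : ℕ → Carrier
    signUnit i = T′ (- + i) ⊖ T′ (+ i)

    -- The same test as in `α`, so that the multiplicity found by `sum-const` is `α g ƛ i` by
    -- computation.
    counted? : ∀ ƛ i → Decidable (λ s → + hook ƛ s ≡ + g -ᶻ + i × ε s ≡ 1ℤ)
    counted? ƛ i s = (+ hook ƛ s ℤ.≟ + g -ᶻ + i) ×-dec (ε s ℤ.≟ 1ℤ)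

    indicator : Partition → Box → ℕ → Carrier
    indicator ƛ s i = if does (counted? ƛ i s) then signUnit i else 𝟘

    indicator-no : ∀ ƛ s i → ¬ (+ hook ƛ s ≡ + g -ᶻ + i × ε s ≡ 1ℤ) → indicator ƛ s i ≈ 𝟘
    indicator-no ƛ s i = if-no (counted? ƛ i s)

    indicator-yes : ∀ ƛ s i → + hook ƛ s ≡ + g -ᶻ + i → ε s ≡ 1ℤ → indicator ƛ s i ≈ signUnit i
    indicator-yes ƛ s i q₁ q₂ = if-yes (counted? ƛ i s) (q₁ , q₂)

    hook>0 : ∀ ƛ s → 0 < hook ƛ s
    hook>0 ƛ s = ℕ.m≤n+m 1 _

    -- At most one index contributes, namely g - h for a box with ε = 1 and hook length h < g.
    -- Summing over all indices allows the order of summation to be exchanged and the boxes to be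
    -- counted.
    correction : Partition → Box → Carrier
    correction ƛ s = ∑[ i < g ∸ 1 ] indicator ƛ s (suc i)

    -- Only a box with ε = 1 and hook length h < g puts a negative argument h - g into τ.
    boxUnit≈ : ∀ ƛ s → boxUnit ƛ s ≈ correction ƛ s ⊕ φ T T-even (does (proj₂ s ℕ.<? proj₁ s)) (+ hook ƛ s)
    boxUnit≈ ƛ s = go (does (proj₂ s ℕ.<? proj₁ s)) refl
      where
      h = hook ƛ s
      go : ∀ b → ε s ≡ (if b then -1ℤ else 1ℤ) → boxUnit ƛ s ≈ correction ƛ s ⊕ φ T T-even b (+ h)
      go true ε≡ = begin
        T′ (+ h -ᶻ ε s *ᶻ + g) ⊖ T′ (+ h)
          ≈⟨ ⊖-cong (resp T′ (trans (cong (λ e → + h -ᶻ e *ᶻ + g) ε≡) (ring (+ h) (+ g)))) ≈-refl ⟩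
        φ T T-even true (+ h)
          ≈⟨ ⊕-identityˡ _ ⟨
        𝟘 ⊕ φ T T-even true (+ h)
          ≈⟨ ⊕-congʳ (sum<-≡0 (g ∸ 1) λ {i} _ → indicator-no ƛ s (suc i) λ (_ , ε≡1) → contradiction
            (trans (sym ε≡) ε≡1) λ ()) ⟨
        correction ƛ s ⊕ φ T T-even true (+ h) ∎
        where
        ring : ∀ h g → h -ᶻ -1ℤ *ᶻ g ≡ h +ᶻ g
        ring = solve-∀
      go false ε≡ = ≈-trans (⊖-cong (resp T′ (trans (cong (λ e → + h -ᶻ e *ᶻ + g) ε≡)
        (cong (λ z → + h -ᶻ z) (ℤ.*-identityˡ (+ g))))) ≈-refl) (split (g ℕ.≤? h))
        where
        split : Dec (g ≤ h) → T′ (+ h -ᶻ + g) ⊖ T′ (+ h) ≈ correction ƛ s ⊕ φ T T-even false (+ h)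
        split (yes g≤h) = begin
          T′ (+ h -ᶻ + g) ⊖ T′ (+ h)
            ≈⟨ ⊖-cong (≈-sym (T-nonNegative (ℤ.i≤j⇒0≤j-i (ℤ.+≤+ g≤h)))) ≈-refl ⟩
          φ T T-even false (+ h)
            ≈⟨ ⊕-identityˡ _ ⟨
          𝟘 ⊕ φ T T-even false (+ h)
            ≈⟨ ⊕-congʳ (sum<-≡0 (g ∸ 1) λ {i} _ → indicator-no ƛ s (suc i) λ (h≡ , _) →
                 ℕ.<⇒≱ (ℤ.drop‿+<+ (subst₂ ℤ._<_ (sym h≡) (ℤ.+-identityʳ (+ g))
                   (ℤ.+-monoʳ-< (+ g) (ℤ.-<+ {i} {0})))) g≤h) ⟨
          correction ƛ s ⊕ φ T T-even false (+ h) ∎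
        split (no g≰h) = begin
          T′ (+ h -ᶻ + g) ⊖ T′ (+ h)
            -- The index g - h is `suc k`, and h ≥ 1 keeps it below g. Inserting T(h - g) = τ(g - h)
            -- separates the sign factor from the even part.
            ≈⟨ solve 3 (λ a b c → a :- c ⊜ (a :- b) :+ (b :- c)) ≈-refl _ (T′ (+ suc k)) _ ⟩
          (T′ (+ h -ᶻ + g) ⊖ T′ (+ suc k)) ⊕ (T′ (+ suc k) ⊖ T′ (+ h))
            ≈⟨ ⊕-cong (⊖-cong (resp T′ h-g≡) ≈-refl)
              (⊖-cong (≈-sym (resp (λ z → T′ (+ ∣ z ∣)) h-g≡)) ≈-refl) ⟩
          signUnit (suc k) ⊕ φ T T-even false (+ h)
            ≈⟨ ⊕-congʳ (≈-trans (sum<-single (g ∸ 1) _ k<g-1 other) (indicator-yes ƛ s (suc k) h≡ ε≡)) ⟨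
          correction ƛ s ⊕ φ T T-even false (+ h) ∎
          where
          k = g ∸ suc h
          g≡ : suc h ℕ.+ k ≡ g
          g≡ = ℕ.m+[n∸m]≡n (ℕ.≰⇒> g≰h)
          ring₁ : ∀ h k → h -ᶻ (1ℤ +ᶻ h +ᶻ k) ≡ - (1ℤ +ᶻ k)
          ring₁ = solve-∀
          ring₂ : ∀ h k → h ≡ 1ℤ +ᶻ h +ᶻ k -ᶻ (1ℤ +ᶻ k)
          ring₂ = solve-∀
          ring₃ : ∀ g k → k ≡ g -ᶻ (g -ᶻ k)
          ring₃ = solve-∀
          h-g≡ : + h -ᶻ + g ≡ - + suc k
          h-g≡ = trans (cong (λ n → + h -ᶻ + n) (sym g≡)) (ring₁ (+ h) (+ k))
          h≡ : + h ≡ + g -ᶻ + suc k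
          h≡ = trans (ring₂ (+ h) (+ k)) (cong (λ n → + n -ᶻ + suc k) g≡)
          k<g-1 : k < g ∸ 1
          k<g-1 = subst (λ g → k < g ∸ 1) g≡ (ℕ.m<n+m k (hook>0 ƛ s))
          other : ∀ {i} → i ≢ k → indicator ƛ s (suc i) ≈ 𝟘
          other {i} i≢k = indicator-no ƛ s (suc i) λ (h≡′ , _) → i≢k (ℕ.suc-injective (ℤ.+-injective
            (trans (ring₃ (+ g) (+ suc i)) (trans (cong (λ z → + g -ᶻ z) (trans (sym h≡′) h≡))
              (sym (ring₃ (+ g) (+ suc k)))))))

    boxes-product : ∀ {ƛ B} → Shape (part ƛ) (col ƛ) B →
      sum (boxes ƛ) (boxUnit ƛ) ≈ (∑[ i ∈ applyUpTo suc (g ∸ 1) ] α g ƛ i ⋆ⁿ signUnit i) ⊕ hooksSum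
        (φ T T-even) B
    boxes-product {ƛ} {B} shp = begin
      sum (boxes ƛ) (boxUnit ƛ)
        ≈⟨ sum-cong (boxes ƛ) (boxUnit≈ ƛ) ⟩
      (∑[ s ∈ boxes ƛ ] (correction ƛ s ⊕ φ T T-even (does (proj₂ s ℕ.<? proj₁ s)) (+ hook ƛ s)))
        ≈⟨ sum-⊕ (boxes ƛ) _ _ ⟩
      sum (boxes ƛ) (correction ƛ) ⊕ (∑[ s ∈ boxes ƛ ] φ T T-even (does (proj₂ s ℕ.<? proj₁ s)) (+ hook ƛ s))
        ≈⟨ ⊕-cong corrections (sum-hooks {ƛ} (φ T T-even) shp) ⟩
      (∑[ i ∈ applyUpTo suc (g ∸ 1) ] α g ƛ i ⋆ⁿ signUnit i) ⊕ hooksSum (φ T T-even) B ∎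
      where
      corrections : sum (boxes ƛ) (correction ƛ) ≈ (∑[ i ∈ applyUpTo suc (g ∸ 1) ] α g ƛ i ⋆ⁿ signUnit i)
      corrections = begin
        sum (boxes ƛ) (correction ƛ)
          ≈⟨ sum-cong (boxes ƛ) (λ s → sum-applyUpTo suc (g ∸ 1) (indicator ƛ s)) ⟨
        (∑[ s ∈ boxes ƛ ] ∑[ i ∈ applyUpTo suc (g ∸ 1) ] indicator ƛ s i)
          ≈⟨ sum-swap (boxes ƛ) (applyUpTo suc (g ∸ 1)) (indicator ƛ) ⟩
        (∑[ i ∈ applyUpTo suc (g ∸ 1) ] ∑[ s ∈ boxes ƛ ] indicator ƛ s i)
          ≈⟨ sum-cong (applyUpTo suc (g ∸ 1)) (λ i → sum-const (counted? ƛ i) (boxes ƛ) (signUnit i)) ⟩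
        (∑[ i ∈ applyUpTo suc (g ∸ 1) ] α g ƛ i ⋆ⁿ signUnit i) ∎

    -- Both arguments are nonnegative, a + b - g because it is at least 2b - g, so T agrees with τ
    -- on them.
    K≈T′ : ∀ {a b} → + g ℤ.< a +ᶻ a → + g ℤ.< b +ᶻ b → b ℤ.≤ a →
      K T T-even a b ≈ T′ (a -ᶻ b) ⊕ T′ (a +ᶻ b -ᶻ + g)
    K≈T′ {a} {b} g<2a g<2b b≤a = ⊕-cong (T-nonNegative (ℤ.i≤j⇒0≤j-i b≤a))
      (T-nonNegative (ℤ.i≤j⇒0≤j-i (ℤ.≤-trans (ℤ.<⇒≤ g<2b) (ℤ.+-monoˡ-≤ b b≤a))))

    -- The arguments are the very integers supplied by `r-difference` and `r-sum`, so the value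
    -- computes to the factor in the theorem.
    pairUnit : (Fin t → ℤ) → Fin t × Fin t → Carrier
    pairUnit v (i , j) =
      (T′ (v i -ᶻ v j) ⊖ T′ (+ suc (toℕ j) -ᶻ + suc (toℕ i)))
      ⊕ (T′ (v i +ᶻ v j -ᶻ + g +ᶻ + 2) ⊖ T′ (+ g +ᶻ + 2 -ᶻ + suc (toℕ i) -ᶻ + suc (toℕ j)))

    -- The denominators are the kernel of the empty diagram: with indices from 1, its edges g + 1 -
    -- i have differences j - i, and their sums minus g are g + 2 - i - j.
    pairs-product : (v : Fin t → ℤ) → (∀ {i j} → i Fin.< j → v j ℤ.< v i) →
      (∀ i → + g ℤ.< (v i +ᶻ 1ℤ) +ᶻ (v i +ᶻ 1ℤ)) →
      sum (pairs t) (pairUnit v) ≈ pairSum (K T T-even) (tabulate (λ i → v i +ᶻ 1ℤ)) ⊖ pairSum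
        (K T T-even) (tabulate ground)
    pairs-product v v-decreasing upper = begin
      sum (pairs t) (pairUnit v)
        ≈⟨ sum-filter-cong (λ (i , j) → i Fin.<? j) (cartesianProduct (allFin t) (allFin t))
          (λ (i , j) → kernel i j) ⟩
      (∑[ ij ∈ pairs t ] (K T T-even (v (proj₁ ij) +ᶻ 1ℤ) (v (proj₂ ij) +ᶻ 1ℤ) ⊖ K T T-even
        (ground (proj₁ ij)) (ground (proj₂ ij))))
        ≈⟨ sum-⊖ (pairs t) _ _ ⟩
      (∑[ ij ∈ pairs t ] K T T-even (v (proj₁ ij) +ᶻ 1ℤ) (v (proj₂ ij) +ᶻ 1ℤ))
        ⊖ (∑[ ij ∈ pairs t ] K T T-even (ground (proj₁ ij)) (ground (proj₂ ij)))
        ≈⟨ ⊖-cong (sum-pairs (K T T-even) (λ i → v i +ᶻ 1ℤ)) (sum-pairs (K T T-even) ground) ⟩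
      pairSum (K T T-even) (tabulate (λ i → v i +ᶻ 1ℤ)) ⊖ pairSum (K T T-even) (tabulate ground) ∎
      where
      ring₁ : ∀ x y → (x +ᶻ 1ℤ) -ᶻ (y +ᶻ 1ℤ) ≡ x -ᶻ y
      ring₁ = solve-∀
      ring₂ : ∀ x y g → (x +ᶻ 1ℤ) +ᶻ (y +ᶻ 1ℤ) -ᶻ g ≡ x +ᶻ y -ᶻ g +ᶻ + 2
      ring₂ = solve-∀
      ring₃ : ∀ i j g → (g -ᶻ i) -ᶻ (g -ᶻ j) ≡ (1ℤ +ᶻ j) -ᶻ (1ℤ +ᶻ i)
      ring₃ = solve-∀
      ring₄ : ∀ i j g → (g -ᶻ i) +ᶻ (g -ᶻ j) -ᶻ g ≡ g +ᶻ + 2 -ᶻ (1ℤ +ᶻ i) -ᶻ (1ℤ +ᶻ j)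
      ring₄ = solve-∀
      kernel : ∀ i j → i Fin.< j →
        pairUnit v (i , j) ≈ K T T-even (v i +ᶻ 1ℤ) (v j +ᶻ 1ℤ) ⊖ K T T-even (ground i) (ground j)
      kernel i j i<j = begin
        pairUnit v (i , j)
          ≈⟨ solve 4 (λ a b c d → (a :- b) :+ (c :- d) ⊜ (a :+ c) :- (b :+ d)) ≈-refl _ _ _ _ ⟩
        (T′ (v i -ᶻ v j) ⊕ T′ (v i +ᶻ v j -ᶻ + g +ᶻ + 2))
          ⊖ (T′ (+ suc (toℕ j) -ᶻ + suc (toℕ i)) ⊕ T′ (+ g +ᶻ + 2 -ᶻ + suc (toℕ i) -ᶻ + suc (toℕ j)))
          ≈⟨ ⊖-cong (⊕-cong (resp T′ (ring₁ (v i) (v j))) (resp T′ (ring₂ (v i) (v j) (+ g))))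
                    (⊕-cong (resp T′ (ring₃ (+ toℕ i) (+ toℕ j) (+ g)))
                      (resp T′ (ring₄ (+ toℕ i) (+ toℕ j) (+ g)))) ⟨
        (T′ ((v i +ᶻ 1ℤ) -ᶻ (v j +ᶻ 1ℤ)) ⊕ T′ ((v i +ᶻ 1ℤ) +ᶻ (v j +ᶻ 1ℤ) -ᶻ + g))
          ⊖ (T′ (ground i -ᶻ ground j) ⊕ T′ (ground i +ᶻ ground j -ᶻ + g))
          ≈⟨ ⊖-cong (K≈T′ (upper i) (upper j) (ℤ.+-monoˡ-≤ 1ℤ (ℤ.<⇒≤ (v-decreasing i<j))))
                    (K≈T′ (proj₁ (ground-edge i)) (proj₁ (ground-edge j))
                      (ℤ.+-monoʳ-≤ (+ g) (ℤ.neg-mono-≤ (ℤ.+≤+ (ℕ.<⇒≤ i<j))))) ⟨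
        K T T-even (v i +ᶻ 1ℤ) (v j +ᶻ 1ℤ) ⊖ K T T-even (ground i) (ground j) ∎

    product-formula : ∀ {ƛ B R v} → Shape (part ƛ) (col ƛ) B → Evolves B R → Edges B R →
      R ↭ tabulate (λ i → v i +ᶻ 1ℤ) → (∀ {i j} → i Fin.< j → v j ℤ.< v i) →
      sum (boxes ƛ) (boxUnit ƛ)
        ≈ (∑[ i ∈ applyUpTo suc (g ∸ 1) ] α g ƛ i ⋆ⁿ signUnit i) ⊕ sum (pairs t) (pairUnit v)
    product-formula {ƛ} {B} {R} {v} shp evolves edges R↭w v-decreasing = begin
      sum (boxes ƛ) (boxUnit ƛ)
        ≈⟨ boxes-product {ƛ} shp ⟩
      signs ⊕ hooksSum (φ T T-even) B
        ≈⟨ ⊕-congˡ (solve 2 (λ h p → h ⊜ (p :+ h) :- p) ≈-refl (hooksSum (φ T T-even) B) base) ⟩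
      signs ⊕ (base ⊕ hooksSum (φ T T-even) B ⊖ base)
        ≈⟨ ⊕-congˡ (⊖-cong (pairSum-evolve T T-even (descending shp) evolves) ≈-refl) ⟨
      signs ⊕ (pairSum (K T T-even) R ⊖ base)
        ≈⟨ ⊕-congˡ (⊖-cong (pairSum-↭ (K-sym T T-even) R↭w) ≈-refl) ⟩
      signs ⊕ (pairSum (K T T-even) (tabulate (λ i → v i +ᶻ 1ℤ)) ⊖ base)
        ≈⟨ ⊕-congˡ (pairs-product v v-decreasing upper) ⟨
      signs ⊕ sum (pairs t) (pairUnit v) ∎
      where
      signs = ∑[ i ∈ applyUpTo suc (g ∸ 1) ] α g ƛ i ⋆ⁿ signUnit i
      base = pairSum (K T T-even) (tabulate ground)
      upper : ∀ i → + g ℤ.< (v i +ᶻ 1ℤ) +ᶻ (v i +ᶻ 1ℤ)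
      upper i = proj₁ (Edges.sound edges (∈-resp-↭ (↭.↭-sym R↭w) (∈-tabulate⁺ i)))

-- Both formulas for g = 2t - 1

open import Data.Nat.Base using (_+_; _*_) renaming (_/_ to _div_)

suc[2t∸1]≡t+t : ∀ t .{{_ : NonZero t}} → suc (2 * t ∸ 1) ≡ t + t
suc[2t∸1]≡t+t t = trans (ℕ.m+[n∸m]≡n (ℕ.≤-trans (ℕ.>-nonZero⁻¹ t) (ℕ.m≤m+n t (t + 0))))
  (cong (λ n → t + n) (ℕ.+-identityʳ t))

theorem4p19 : ∀ {c ℓ₁ ℓ₂} (t : ℕ) .{{_ : NonZero t}} (ƛ : Partition) (v : Vector ℤ t) →
  let g = 2 * t ∸ 1 in
  DD′¹ t ƛ →
  IsVCoding g t ƛ v →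
  let rᵢ : Fin t → ℚ
      rᵢ i = r g (v i)
  in
  ((+ size ƛ) ℚ./ 1
    ≡ ((+ 1) ℚ./ g) ℚ.* ∑ℚ (λ i → rᵢ i ℚ.* rᵢ i) ℚ.- (+ ((g + 2) * (g div 2 + 1))) ℚ./ 12)
  ×
  ((F : HeytingField c ℓ₁ ℓ₂) → let open FieldNotation F in
    (τ : ℤ → F×) →
    (∏[ s ∈ boxes ƛ ] τ (+ hook ƛ s ℤ.- ε s ℤ.* + g) ÷ τ (+ hook ƛ s))
    ≈
    (∏[ i ∈ applyUpTo suc (g ∸ 1) ] (τ (- + i) ÷ τ (+ i)) ^ α g ƛ i)
    · (∏[ (i , j) ∈ pairs t ]
          (τ (toInteger (rᵢ i ℚ.- rᵢ j) (r-difference g (v i) (v j)))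
             ÷ τ (+ suc (toℕ j) ℤ.- + suc (toℕ i)))
        · (τ (toInteger (rᵢ i ℚ.+ rᵢ j) (r-sum g (v i) (v j)))
             ÷ τ (+ g ℤ.+ + 2 ℤ.- + suc (toℕ i) ℤ.- + suc (toℕ j)))))
theorem4p19 t ƛ v (dd′ , ν , quotient , ν≡∅ , m , m≥1 , ν≡rectangle) coding =
  size-formula {ƛ} v shp evolves R↭w , product
  where
  g = 2 * t ∸ 1
  1+g≡t+t = suc[2t∸1]≡t+t t
  open Evolution t g 1+g≡t+t
  open Size t g 1+g≡t+t using (size-formula)
  open QuotientEdges t g 1+g≡t+t using (quotient⇒closed)
  shp = proj₂ (DD′-shape dd′)
  open Coding t g 1+g≡t+t {ƛ} shp coding using (edges↭coding)
  2t-2 : ℕ.pred g ≡ 2 * t ∸ 2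
  2t-2 = ℕ.pred[m∸n]≡m∸[1+n] (2 * t) 1
  closed : Closed (proj₁ (DD′-shape dd′))
  closed = quotient⇒closed {ƛ} shp {ν} quotient
    (λ k k≢ → ν≡∅ k (λ k≡ → k≢ (trans k≡ (sym 2t-2)))) m≥1 (λ k k≡ → ν≡rectangle k (trans k≡ 2t-2))
  evolved = evolution (descending shp) closed
  evolves = proj₁ (proj₂ evolved)
  edges = proj₂ (proj₂ evolved)
  R↭w = edges↭coding closed edges (Evolves-length evolves)
  product : ∀ F τ → _
  -- Only the passage from sums of units to products and powers is rewritten; the individual factors
  -- agree by computation.
  product F τ = subst₂ (HeytingField._≈_ F)
    (sym (∏≡sum (boxes ƛ) (boxUnit t g 1+g≡t+t ƛ)))
    (sym (cong₂ (HeytingField._*_ F)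
      (∏^≡sum (applyUpTo suc (g ∸ 1)) (α g ƛ) (signUnit t g 1+g≡t+t))
      (∏≡sum (pairs t) (pairUnit t g 1+g≡t+t v))))
    (value≈ (product-formula t g 1+g≡t+t {ƛ} {v = v} shp evolves edges R↭w (IsVCoding.decreasing coding)))
    where
    open Products F τ
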